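{- Let $n\ge1$. As maps from $\mathcal A(\mathbf A^{n-1})$ to $\mathcal N_n$, \[\mathrm{AST}=\mathrm{Match}\circ\widehat{\mathrm{RSK}}\circ\mathrm{Exc}^{ -1}.\]
   Context: $\mathcal S_n(321)$ is the set of permutations $\pi$ of $\{1,\dots,n\}$ with no $i<j<k$ such that $\pi(i)>\pi(j)>\pi(k)$. $\mathbf A^{n-1}$ is the poset of intervals $\{[i,j]:1\le i\le j\le n-1\}$ ordered by inclusion, and $\mathcal A(\mathbf A^{n-1})$ is its set of antichains. The map $\mathrm{Exc}:\mathcal S_n(321)\to\mathcal A(\mathbf A^{n-1})$, $\mathrm{Exc}(\pi)=\{[i,\pi(i)-1]:\pi(i)>i\}$, is a bijection. $\mathcal N_n$ is the set of noncrossing perfect matchings of $\{1,\dots,2n\}$ (there are no $i<j<k<\ell$ with $i$ matched to $k$ and $j$ matched to $\ell$). The points are placed around a circle in clockwise order $1,2,\dots,2n$; write $\overline{i}$ for the point $2n+1-i$, $1\le i\le n$, so the clockwise order is $1,2,\dots,n,\overline n,\overline{n-1},\dots,\overline1$. $\mathrm{AST}:\mathcal A(\mathbf A^{n-1})\to\mathcal N_n$ (Armstrong--Stump--Thomas bijection, type $A$): given an antichain $A$, start with no matched points, and for $i=1,2,\dots,n$ in order: if $[i,j-1]\in A$ for some $j$, match the vertex $j$ with the nearest unmatched vertex in counterclockwise direction; otherwise match the vertex $\overline i$ with the nearest unmatched vertex in clockwise direction. $\mathcal D_n$ is the set of Dyck words: words with $n$ letters $\mathtt u$ and $n$ letters $\mathtt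 d$ such that every prefix has at least as many $\mathtt u$'s as $\mathtt d$'s. Viewing $\mathtt u$ and $\mathtt d$ as opening and closing parentheses, a pair of matched steps is called a tunnel. $\mathrm{Match}:\mathcal D_n\to\mathcal N_n$ matches $x$ and $y$ in $\mathrm{Match}(D)$ if and only if the steps of $D$ in positions $x$ and $y$ form a tunnel. $\mathrm{RSK}(\pi)=(P,Q)$ denotes the Robinson--Schensted--Knuth (row insertion) correspondence, with $P$ the insertion tableau and $Q$ the recording tableau; for $\pi\in\mathcal S_n(321)$ both have at most two rows. $\widehat{\mathrm{RSK}}:\mathcal S_n(321)\to\mathcal D_n$ is defined as follows: for $1\le i\le n$, the $i$th step of $\widehat{\mathrm{RSK}}(\pi)$ is $\mathtt u$ if $i$ is in the top row of $P$ and $\mathtt d$ otherwise; the $(2n+1-i)$th step is $\mathtt d$ if $i$ is in the top row of $Q$ and $\mathtt u$ otherwise. -}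

module Defs where

open import Data.Bool.Base using (Bool; true; false; not; if_then_else_)
open import Data.Empty using (⊥; ⊥-elim)
open import Data.Fin.Base using (Fin; zero; suc; toℕ; fromℕ<; cast; _<_; _≤_; _↑ˡ_; opposite)
open import Data.Fin.Induction using (<-wellFounded)
open import Data.Fin.Permutation as Perm using (Permutation′; permutation; _⟨$⟩ʳ_; _⟨$⟩ˡ_)
import Data.Fin.Properties as Fin
open import Data.List.Base
  using (List; []; _∷_; [_]; _++_; length; lookup; take; drop; filter; find; map; foldl; tabulate; allFin; applyUpTo)
import Data.List.Membership.DecPropositional as DecMembership
open import Data.List.Membership.Propositional using () renaming (_∈_ to _∈ˡ_; _∉_ to _∉ˡ_)
open import Data.List.Membership.Propositional.Properties
  using (∈-lookup; ∈-applyUpTo⁻; ∈-allFin; ∈-map⁻; ∈-filter⁺; ∈-filter⁻; ∈-++⁺ˡ; ∈-++⁺ʳ; ∈-++⁻)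
import Data.List.Properties as List
open import Data.List.Relation.Unary.All as All using (All; []; _∷_)
open import Data.List.Relation.Unary.AllPairs as AllPairs using (AllPairs; []; _∷_)
open import Data.List.Relation.Unary.Any using (here; there; index)
open import Data.List.Relation.Unary.Any.Properties using (lookup-index)
open import Data.List.Relation.Unary.Unique.Propositional using (Unique)
import Data.List.Relation.Unary.Unique.Propositional.Properties as Unique
open import Data.Maybe.Base using (Maybe; just; nothing; maybe′)
open import Data.Nat.Base as ℕ using (ℕ; zero; suc; _+_; _∸_; z≤n; s≤s)
open import Data.Nat.DivMod using (_mod_; m<n⇒m%n≡m; [m+n]%n≡m%n)
import Data.Nat.Properties as ℕ
open import Data.Nat.Tactic.RingSolver using (solve-∀)
open import Data.Product using (∃; ∃₂; _×_; _,_; proj₁; proj₂)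
open import Data.Sum as Sum using (_⊎_; inj₁; inj₂)
open import Data.Vec.Base as Vec using (Vec; []; _∷_; toList)
import Data.Vec.Properties as Vec
open import Function.Base using (_∘_; id)
open import Function.Bundles using (_⇔_; mk⇔)
open import Induction.WellFounded using (Acc; acc)
open import Level using (0ℓ)
open import Relation.Binary using (Poset; DecidableEquality; tri<; tri≈; tri>)
open import Relation.Binary.PropositionalEquality
  using (_≡_; _≢_; refl; sym; trans; cong; cong₂; subst; subst₂; isEquivalence; module ≡-Reasoning)
open import Relation.Nullary using (¬_; Dec; yes; no; does; contradiction)
open import Relation.Nullary.Decidable using (_×-dec_; map′; dec-true; dec-false; decidable-stable)
open import Relation.Unary using (Pred; Decidable; _∈_; _≐_)

-- An element of Fin n with toℕ equal to k stands for the number k + 1 of {1,…,n}.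
-- In particular Fin (n + n) is the circle 1,2,…,2n, read clockwise.

record Interval (m : ℕ) : Set where
  constructor interval
  field
    lo hi : Fin m
    lo≤hi : lo ≤ hi

open Interval public

_∈ᴵ_ : ∀ {m} → Fin m → Interval m → Set
k ∈ᴵ I = lo I ≤ k × k ≤ hi I

_⊆ᴵ_ : ∀ {m} → Interval m → Interval m → Set
I ⊆ᴵ J = ∀ k → k ∈ᴵ I → k ∈ᴵ J

interval-≡ : ∀ {m} {I J : Interval m} →
             toℕ (lo I) ≡ toℕ (lo J) → toℕ (hi I) ≡ toℕ (hi J) → I ≡ J
interval-≡ {I = interval a b p} {interval c d q} e f
  with refl ← Fin.toℕ-injective e | refl ← Fin.toℕ-injective f
  = cong (interval a b) (ℕ.≤-irrelevant p q)

𝐀 : ℕ → Poset 0ℓ 0ℓ 0ℓ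
𝐀 m = record
  { Carrier = Interval m
  ; _≈_ = _≡_
  ; _≤_ = _⊆ᴵ_
  ; isPartialOrder = record
    { isPreorder = record
      { isEquivalence = isEquivalence
      ; reflexive = λ { refl _ k∈ → k∈ }
      ; trans = λ I⊆J J⊆K k k∈ → J⊆K k (I⊆J k k∈)
      }
    ; antisym = λ {I} {J} I⊆J J⊆I →
        let (a , _) = I⊆J (lo I) (ℕ.≤-refl , lo≤hi I)
            (_ , b) = I⊆J (hi I) (lo≤hi I , ℕ.≤-refl)
            (c , _) = J⊆I (lo J) (ℕ.≤-refl , lo≤hi J)
            (_ , d) = J⊆I (hi J) (lo≤hi J , ℕ.≤-refl)
        in interval-≡ (ℕ.≤-antisym c a) (ℕ.≤-antisym b d)
    }
  }

-- Subsets of a finite poset are decidable predicates.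
record 𝒜 (P : Poset 0ℓ 0ℓ 0ℓ) : Set₁ where
  open Poset P renaming (_≤_ to _≼_)
  field
    members  : Pred Carrier 0ℓ
    _∈?      : Decidable members
    antichain : ∀ {x y} → x ∈ members → y ∈ members → x ≼ y → x ≈ y

open 𝒜 public

_≈ᴬ_ : ∀ {P} → 𝒜 P → 𝒜 P → Set
A ≈ᴬ B = members A ≐ members B

record 𝒮₃₂₁ (n : ℕ) : Set where
  field
    perm   : Permutation′ n
    avoids : ∀ {i j k} → i < j → j < k →
             ¬ (perm ⟨$⟩ʳ j < perm ⟨$⟩ʳ i × perm ⟨$⟩ʳ k < perm ⟨$⟩ʳ j)

open 𝒮₃₂₁ public

infixl 9 _·_
_·_ : ∀ {n} → 𝒮₃₂₁ n → Fin n → Fin n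
π · i = perm π ⟨$⟩ʳ i

_≈ˢ_ : ∀ {n} → 𝒮₃₂₁ n → 𝒮₃₂₁ n → Set
π ≈ˢ ρ = ∀ i → π · i ≡ ρ · i

-- Spans I i j  means  I = [i , j − 1].
record Spans {n} (I : Interval (n ∸ 1)) (i j : Fin n) : Set where
  constructor _&_
  field
    at-lo : toℕ (lo I) ≡ toℕ i
    at-hi : suc (toℕ (hi I)) ≡ toℕ j

open Spans public

ExcSet : ∀ {n} → 𝒮₃₂₁ n → Pred (Interval (n ∸ 1)) 0ℓ
ExcSet π I = ∃ λ i → i < π · i × Spans I i (π · i)

spans-unique : ∀ {n} {I J : Interval (n ∸ 1)} {i j : Fin n} →
               Spans I i j → Spans J i j → I ≡ J
spans-unique (a & b) (c & d) =
  interval-≡ (trans a (sym c)) (ℕ.suc-injective (trans b (sym d)))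

spans? : ∀ {n} (I : Interval (n ∸ 1)) (i j : Fin n) → Dec (Spans I i j)
spans? I i j = map′ (λ (a , b) → a & b) (λ (a & b) → a , b)
                    ((toℕ (lo I) ℕ.≟ toℕ i) ×-dec (suc (toℕ (hi I)) ℕ.≟ toℕ j))

spanning : ∀ {n} {i j : Fin n} → i < j → ∃ λ I → Spans I i j
spanning {i = i} {suc j} (s≤s i≤j) =
  interval (fromℕ< i<m) j (subst (ℕ._≤ toℕ j) (sym (Fin.toℕ-fromℕ< i<m)) i≤j)
  , (Fin.toℕ-fromℕ< i<m & refl)
  where i<m = ℕ.≤-<-trans i≤j (Fin.toℕ<n j)

spanned : ∀ {n} (I : Interval (n ∸ 1)) → ∃₂ λ (i j : Fin n) → i < j × Spans I i j
spanned {suc m} (interval a b a≤b) =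
  i , suc b , s≤s (subst (ℕ._≤ toℕ b) (sym i≡a) a≤b) , (sym i≡a & refl)
  where
  i = fromℕ< (ℕ.m<n⇒m<1+n (Fin.toℕ<n a))
  i≡a = Fin.toℕ-fromℕ< (ℕ.m<n⇒m<1+n (Fin.toℕ<n a))

spans-< : ∀ {n} {I : Interval (n ∸ 1)} {i j : Fin n} → Spans I i j → i < j
spans-< {I = I} (a & b) = subst₂ ℕ._<_ a b (s≤s (lo≤hi I))

spans-⊆ : ∀ {n} {I J : Interval (n ∸ 1)} {i j i′ j′ : Fin n} →
          Spans I i j → Spans J i′ j′ → i′ ≤ i → j ≤ j′ → I ⊆ᴵ J
spans-⊆ (a & b) (c & d) p q k (x , y) =
  ℕ.≤-trans (subst₂ ℕ._≤_ (sym c) (sym a) p) x ,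
  ℕ.≤-trans y (ℕ.≤-pred (subst₂ ℕ._≤_ (sym b) (sym d) q))

module _ {n} (π : 𝒮₃₂₁ n) where

  ·-injective : ∀ {i j} → π · i ≡ π · j → i ≡ j
  ·-injective {i} {j} e =
    trans (sym (Perm.inverseˡ (perm π))) (trans (cong (perm π ⟨$⟩ˡ_) e) (Perm.inverseˡ (perm π)))

squeeze : ∀ {n} (f : Fin n → Fin n) {a b} → a ℕ.≤ n →
          (∀ {i j} → toℕ i ℕ.< a → toℕ j ℕ.< a → f i ≡ f j → i ≡ j) →
          (∀ i → toℕ i ℕ.< a → toℕ (f i) ℕ.< b) → a ℕ.≤ b
squeeze {n} f {a} {b} a≤n inj bound = Fin.injective⇒≤ {f = g} g-inj
  where
  up : Fin a → Fin n
  up x = fromℕ< (ℕ.<-≤-trans (Fin.toℕ<n x) a≤n)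
  up-toℕ : ∀ x → toℕ (up x) ≡ toℕ x
  up-toℕ x = Fin.toℕ-fromℕ< _
  up< : ∀ x → toℕ (up x) ℕ.< a
  up< x = subst (ℕ._< a) (sym (up-toℕ x)) (Fin.toℕ<n x)
  g : Fin a → Fin b
  g x = fromℕ< (bound (up x) (up< x))
  g-inj : ∀ {x y} → g x ≡ g y → x ≡ y
  g-inj {x} {y} e = Fin.toℕ-injective (trans (sym (up-toℕ x)) (trans (cong toℕ
    (inj (up< x) (up< y) (Fin.toℕ-injective
      (trans (sym (Fin.toℕ-fromℕ< _)) (trans (cong toℕ e) (Fin.toℕ-fromℕ< _)))))) (up-toℕ y)))

≰⇒>ᶠ : ∀ {n} {i j : Fin n} → ¬ i < j → i ≢ j → j < i
≰⇒>ᶠ i≮j i≢j = Fin.≤∧≢⇒< (ℕ.≮⇒≥ i≮j) (i≢j ∘ sym)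

module _ {n} (π : 𝒮₃₂₁ n) where

  exc-increasing : ∀ {p q} → p < q → q < π · q → π · p < π · q
  exc-increasing {p} {q} p<q q<πq
    with Fin._<?_ (π · p) (π · q)
  ... | yes lt = lt
  ... | no ≮ = contradiction (squeeze (perm π ⟨$⟩ˡ_) (Fin.toℕ<n (π · q)) inj bound) (ℕ.<⇒≱ (s≤s q<πq))
    where
    πq<πp : π · q < π · p
    πq<πp = ≰⇒>ᶠ ≮ (Fin.<⇒≢ p<q ∘ ·-injective π)
    inj : ∀ {i j} → toℕ i ℕ.< suc (toℕ (π · q)) → toℕ j ℕ.< suc (toℕ (π · q)) →
          perm π ⟨$⟩ˡ i ≡ perm π ⟨$⟩ˡ j → i ≡ j
    inj _ _ e = trans (sym (Perm.inverseʳ (perm π))) (trans (cong (π ·_) e) (Perm.inverseʳ (perm π)))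
    bound : ∀ v → toℕ v ℕ.< suc (toℕ (π · q)) → toℕ (perm π ⟨$⟩ˡ v) ℕ.< suc (toℕ q)
    bound v (s≤s v≤πq) with Fin._<?_ q (perm π ⟨$⟩ˡ v)
    ... | no ≮ = s≤s (ℕ.≮⇒≥ ≮)
    ... | yes q<k = contradiction (πq<πp , Fin.≤∧≢⇒< πk≤πq
                      (λ e → Fin.<⇒≢ q<k (sym (·-injective π e)))) (avoids π p<q q<k)
      where
      πk≤πq : π · (perm π ⟨$⟩ˡ v) ≤ π · q
      πk≤πq = subst (_≤ π · q) (sym (Perm.inverseʳ (perm π))) v≤πq

  nonexc-increasing : ∀ {p q} → p < q → ¬ p < π · p → π · p < π · q
  nonexc-increasing {p} {q} p<q p≮πp
    with Fin._<?_ (π · p) (π · q)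
  ... | yes lt = lt
  ... | no ≮ = contradiction (ℕ.≤-trans (squeeze f (Fin.toℕ<n p) inj bound) (ℕ.≮⇒≥ p≮πp)) ℕ.1+n≰n
    where
    πq<πp : π · q < π · p
    πq<πp = ≰⇒>ᶠ ≮ (Fin.<⇒≢ p<q ∘ ·-injective π)
    g : Fin n → Fin n
    g x with x Fin.≟ p
    ... | yes _ = q
    ... | no _ = x
    f : Fin n → Fin n
    f x = π · g x
    inj : ∀ {i j} → toℕ i ℕ.< suc (toℕ p) → toℕ j ℕ.< suc (toℕ p) → f i ≡ f j → i ≡ j
    inj {i} {j} (s≤s i≤p) (s≤s j≤p) e with i Fin.≟ p | j Fin.≟ p | ·-injective π e
    ... | yes a | yes b | _ = trans a (sym b)
    ... | yes _ | no _  | refl = contradiction j≤p (ℕ.<⇒≱ p<q)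
    ... | no _  | yes _ | refl = contradiction i≤p (ℕ.<⇒≱ p<q)
    ... | no _  | no _  | e′ = e′
    bound : ∀ i → toℕ i ℕ.< suc (toℕ p) → toℕ (f i) ℕ.< toℕ (π · p)
    bound i (s≤s i≤p) with i Fin.≟ p
    ... | yes _ = πq<πp
    ... | no i≢p with Fin._<?_ (π · i) (π · p)
    ... | yes lt = lt
    ... | no ≮′ = contradiction (≰⇒>ᶠ ≮′ (i≢p ∘ ·-injective π) , πq<πp)
                    (avoids π (Fin.≤∧≢⇒< i≤p i≢p) p<q)

Exc-antichain : ∀ {n} (π : 𝒮₃₂₁ n) {I J} → I ∈ ExcSet π → J ∈ ExcSet π → I ⊆ᴵ J → I ≡ J
Exc-antichain π {I} {J} (i , i<πi , sI@(a & b)) (j , j<πj , sJ@(c & d)) I⊆J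
  with Fin.<-cmp i j
... | tri≈ _ refl _ = spans-unique sI sJ
... | tri< i<j _ _ = contradiction
        (subst₂ ℕ._≤_ c a (proj₁ (I⊆J (lo I) (ℕ.≤-refl , lo≤hi I)))) (ℕ.<⇒≱ i<j)
... | tri> _ _ j<i = contradiction
        (subst₂ ℕ._≤_ b d (s≤s (proj₂ (I⊆J (hi I) (lo≤hi I , ℕ.≤-refl)))))
        (ℕ.<⇒≱ (exc-increasing π j<i i<πi))

Exc : ∀ {n} → 𝒮₃₂₁ n → 𝒜 (𝐀 (n ∸ 1))
Exc π = record
  { members = ExcSet π
  ; _∈? = λ I → Fin.any? λ i →
      (i Fin.<? π · i) ×-dec spans? I i (π · i)
  ; antichain = Exc-antichain π
  }

-- Arc A i j  means  [i , j − 1] ∈ A.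
Arc : ∀ {n} → 𝒜 (𝐀 (n ∸ 1)) → Fin n → Fin n → Set
Arc A i j = ∃ λ I → I ∈ members A × Spans I i j

arc? : ∀ {n} (A : 𝒜 (𝐀 (n ∸ 1))) (i j : Fin n) → Dec (Arc A i j)
arc? A i j with Fin._<?_ i j
... | no i≮j = no λ (I , _ , s) → i≮j (spans-< s)
... | yes i<j with spanning i<j
... | I , s = map′ (λ I∈ → I , I∈ , s)
                   (λ (J , J∈ , t) → subst (_∈ members A) (spans-unique t s) J∈) ((A ∈?) I)

module _ {n} (A : 𝒜 (𝐀 (n ∸ 1))) where

  arc-< : ∀ {i j : Fin n} → Arc A i j → i < j
  arc-< (_ , _ , s) = spans-< s

  arc-≤ : ∀ {i i′ j j′ : Fin n} → Arc A i j → Arc A i′ j′ → i′ ≤ i → j ≤ j′ → i ≡ i′ × j ≡ j′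
  arc-≤ (I , I∈ , sI) (J , J∈ , sJ) p q
    with refl ← antichain A I∈ J∈ (spans-⊆ sI sJ p q)
    = Fin.toℕ-injective (trans (sym (at-lo sI)) (at-lo sJ)) ,
      Fin.toℕ-injective (trans (sym (at-hi sI)) (at-hi sJ))

  arc-increasing : ∀ {i i′ j j′ : Fin n} → Arc A i j → Arc A i′ j′ → i < i′ → j < j′
  arc-increasing {j = j} {j′} a a′ i<i′ with Fin._<?_ j j′
  ... | yes lt = lt
  ... | no ≮ = contradiction (proj₁ (arc-≤ a′ a (ℕ.<⇒≤ i<i′) (ℕ.≮⇒≥ ≮)) ) (Fin.<⇒≢ i<i′ ∘ sym)

  arc-functional : ∀ {i j j′ : Fin n} → Arc A i j → Arc A i j′ → j ≡ j′
  arc-functional {j = j} {j′} a a′ with ℕ.≤-total (toℕ j) (toℕ j′)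
  ... | inj₁ p = proj₂ (arc-≤ a a′ ℕ.≤-refl p)
  ... | inj₂ p = sym (proj₂ (arc-≤ a′ a ℕ.≤-refl p))

  arc-injective : ∀ {i i′ j : Fin n} → Arc A i j → Arc A i′ j → i ≡ i′
  arc-injective {i} {i′} a a′ with ℕ.≤-total (toℕ i) (toℕ i′)
  ... | inj₁ p = sym (proj₁ (arc-≤ a′ a p ℕ.≤-refl))
  ... | inj₂ p = proj₁ (arc-≤ a a′ p ℕ.≤-refl)

grow : Bool → ℕ → ℕ
grow b s = if b then suc s else s

size : ∀ {n} → (Fin n → Bool) → ℕ
size {zero}  P = 0
size {suc n} P = grow (P zero) (size (P ∘ suc))

select-step : ∀ b {s n} → (Fin s → Fin n) → Fin (grow b s) → Fin (suc n)
select-step true  f zero    = zero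
select-step true  f (suc k) = suc (f k)
select-step false f k       = suc (f k)

select : ∀ {n} (P : Fin n → Bool) → Fin (size P) → Fin n
select {suc n} P = select-step (P zero) (select (P ∘ suc))

rank-zero : ∀ {b s} → b ≡ true → Fin (grow b s)
rank-zero refl = zero

rank-suc : ∀ b {s} → Fin s → Fin (grow b s)
rank-suc true  k = suc k
rank-suc false k = k

rank : ∀ {n} (P : Fin n → Bool) (i : Fin n) → P i ≡ true → Fin (size P)
rank P zero    Pi = rank-zero Pi
rank P (suc i) Pi = rank-suc (P zero) (rank (P ∘ suc) i Pi)

select-rank-zero : ∀ {b s n} (f : Fin s → Fin n) (e : b ≡ true) →
                   select-step b f (rank-zero e) ≡ zero
select-rank-zero f refl = refl

select-rank-suc : ∀ b {s n} (f : Fin s → Fin n) k →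
                  select-step b f (rank-suc b k) ≡ suc (f k)
select-rank-suc true  f k = refl
select-rank-suc false f k = refl

select-rank : ∀ {n} (P : Fin n → Bool) i Pi → select P (rank P i Pi) ≡ i
select-rank P zero    Pi = select-rank-zero (select (P ∘ suc)) Pi
select-rank P (suc i) Pi = trans (select-rank-suc (P zero) (select (P ∘ suc)) _)
                                 (cong suc (select-rank (P ∘ suc) i Pi))

select-∈ : ∀ {n} (P : Fin n → Bool) k → P (select P k) ≡ true
select-∈ {suc n} P k with P zero in eq
select-∈ {suc n} P zero    | true  = eq
select-∈ {suc n} P (suc k) | true  = select-∈ (P ∘ suc) k
select-∈ {suc n} P k       | false = select-∈ (P ∘ suc) k

select-mono : ∀ {n} (P : Fin n → Bool) {k l} → k < l → select P k < select P l
select-mono {suc n} P {k} {l} k<l with P zero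
select-mono {suc n} P {zero}  {suc l} k<l       | true  = s≤s z≤n
select-mono {suc n} P {suc k} {suc l} (s≤s k<l) | true  = s≤s (select-mono (P ∘ suc) k<l)
select-mono {suc n} P                 k<l       | false = s≤s (select-mono (P ∘ suc) k<l)

size-not : ∀ {n} (P : Fin n → Bool) → size P + size (not ∘ P) ≡ n
size-not {zero} P = refl
size-not {suc n} P with P zero
... | true = cong suc (size-not (P ∘ suc))
... | false = trans (ℕ.+-suc (size (P ∘ suc)) _) (cong suc (size-not (P ∘ suc)))

select-reflects : ∀ {n} (P : Fin n → Bool) {k l} → select P k < select P l → k < l
select-reflects P {k} {l} lt with Fin.<-cmp k l
... | tri< k<l _ _ = k<l
... | tri≈ _ refl _ = contradiction lt (ℕ.<-irrefl refl)
... | tri> _ _ l<k = contradiction lt (ℕ.<-asym (select-mono P l<k))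

select-injective : ∀ {n} (P : Fin n → Bool) {k l} → select P k ≡ select P l → k ≡ l
select-injective P {k} {l} e with Fin.<-cmp k l
... | tri< k<l _ _ = contradiction e (Fin.<⇒≢ (select-mono P k<l))
... | tri≈ _ k≡l _ = k≡l
... | tri> _ _ l<k = contradiction (sym e) (Fin.<⇒≢ (select-mono P l<k))

size-≤ : ∀ {n} (P Q : Fin n → Bool) (f : ∀ i → P i ≡ true → Fin n) →
         (∀ i p → Q (f i p) ≡ true) → (∀ i j p q → f i p ≡ f j q → i ≡ j) → size P ℕ.≤ size Q
size-≤ P Q f f∈ inj = Fin.injective⇒≤ {f = g} λ {k} {l} e →
  select-injective P (inj _ _ _ _ (trans (sym (select-rank Q _ (f∈ _ (select-∈ P k))))
    (trans (cong (select Q) e) (select-rank Q _ (f∈ _ (select-∈ P l))))))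
  where
  g : Fin (size P) → Fin (size Q)
  g k = rank Q (f (select P k) (select-∈ P k)) (f∈ _ _)

matchRank : ∀ {n} (P Q : Fin n → Bool) → size P ≡ size Q → ∀ i → P i ≡ true → Fin n
matchRank P Q e i Pi = select Q (cast e (rank P i Pi))

matchRank-inverse : ∀ {n} (P Q : Fin n → Bool) e e′ i Pi Qj →
                    matchRank Q P e′ (matchRank P Q e i Pi) Qj ≡ i
matchRank-inverse P Q e e′ i Pi Qj = trans (cong (select P) (Fin.toℕ-injective
    (trans (Fin.toℕ-cast e′ _) (trans (cong toℕ (select-injective Q
      (select-rank Q (matchRank P Q e i Pi) Qj))) (Fin.toℕ-cast e (rank P i Pi))))))
  (select-rank P i Pi)

matchRank-mono : ∀ {n} (P Q : Fin n → Bool) e {i j} Pi Pj → i < j →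
                 matchRank P Q e i Pi < matchRank P Q e j Pj
matchRank-mono P Q e {i} {j} Pi Pj i<j = select-mono Q
  (subst₂ ℕ._<_ (sym (Fin.toℕ-cast e _)) (sym (Fin.toℕ-cast e _))
    (select-reflects P (subst₂ _<_ (sym (select-rank P i Pi)) (sym (select-rank P j Pj)) i<j)))

module FromAntichain {n} (A : 𝒜 (𝐀 (n ∸ 1))) where

  source? : ∀ (i : Fin n) → Dec (∃ λ j → Arc A i j)
  source? i = Fin.any? (arc? A i)

  target? : ∀ (j : Fin n) → Dec (∃ λ i → Arc A i j)
  target? j = Fin.any? (λ i → arc? A i j)

  free freeValue : Fin n → Bool
  free i = not (does (source? i))
  freeValue j = not (does (target? j))

  ¬-not : ∀ {b} → not b ≡ true → b ≢ true
  ¬-not {false} _ ()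

  sizes : size free ≡ size freeValue
  sizes = ℕ.+-cancelˡ-≡ (size (does ∘ source?)) _ _
    (trans (size-not (does ∘ source?)) (trans (sym (size-not (does ∘ target?)))
      (cong (_+ size freeValue) (sym same))))
    where
    src : ∀ i → does (source? i) ≡ true → ∃ λ j → Arc A i j
    src i p with source? i
    ... | yes s = s
    tgt : ∀ j → does (target? j) ≡ true → ∃ λ i → Arc A i j
    tgt j p with target? j
    ... | yes s = s
    same : size (does ∘ source?) ≡ size (does ∘ target?)
    same = ℕ.≤-antisym
      (size-≤ _ _ (λ i p → proj₁ (src i p))
        (λ i p → dec-true (target? _) (i , proj₂ (src i p)))
        (λ i j p q e → arc-injective A (proj₂ (src i p)) (subst (Arc A j) (sym e) (proj₂ (src j q)))))
      (size-≤ _ _ (λ j p → proj₁ (tgt j p))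
        (λ j p → dec-true (source? _) (j , proj₂ (tgt j p)))
        (λ i j p q e → arc-functional A (proj₂ (tgt i p))
          (subst (λ k → Arc A k j) (sym e) (proj₂ (tgt j q)))))

  ¬src : ∀ {i} → ¬ (∃ λ j → Arc A i j) → free i ≡ true
  ¬src {i} ¬s = cong not (dec-false (source? i) ¬s)
  ¬tgt : ∀ {j} → ¬ (∃ λ i → Arc A i j) → freeValue j ≡ true
  ¬tgt {j} ¬s = cong not (dec-false (target? j) ¬s)

  ¬src⁻ : ∀ {i} → free i ≡ true → ¬ (∃ λ j → Arc A i j)
  ¬src⁻ {i} p s = ¬-not p (dec-true (source? i) s)
  ¬tgt⁻ : ∀ {j} → freeValue j ≡ true → ¬ (∃ λ i → Arc A i j)
  ¬tgt⁻ {j} p s = ¬-not p (dec-true (target? j) s)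

  to from : Fin n → Fin n
  to i with source? i
  ... | yes (j , _) = j
  ... | no ¬s = matchRank free freeValue sizes i (¬src ¬s)
  from j with target? j
  ... | yes (i , _) = i
  ... | no ¬t = matchRank freeValue free (sym sizes) j (¬tgt ¬t)

  data Graph (i j : Fin n) : Set where
    arc  : Arc A i j → Graph i j
    rest : (p : free i ≡ true) (q : freeValue j ≡ true) →
           j ≡ matchRank free freeValue sizes i p →
           i ≡ matchRank freeValue free (sym sizes) j q → Graph i j

  to-graph : ∀ i → Graph i (to i)
  to-graph i with source? i
  ... | yes (_ , a) = arc a
  ... | no ¬s = rest (¬src ¬s) q refl
                  (sym (matchRank-inverse free freeValue sizes (sym sizes) i (¬src ¬s) q))
    where q = select-∈ freeValue _

  from-graph : ∀ j → Graph (from j) j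
  from-graph j with target? j
  ... | yes (_ , a) = arc a
  ... | no ¬t = rest p (¬tgt ¬t)
                  (sym (matchRank-inverse freeValue free (sym sizes) sizes j (¬tgt ¬t) p)) refl
    where p = select-∈ free _

  ≡-irr : ∀ {b} (p q : b ≡ true) → p ≡ q
  ≡-irr refl refl = refl

  functional : ∀ {i j j′} → Graph i j → Graph i j′ → j ≡ j′
  functional (arc a) (arc b) = arc-functional A a b
  functional (arc a) (rest p _ _ _) = contradiction (_ , a) (¬src⁻ p)
  functional (rest p _ _ _) (arc a) = contradiction (_ , a) (¬src⁻ p)
  functional (rest p _ e _) (rest p′ _ e′ _) =
    trans e (trans (cong (matchRank free freeValue sizes _) (≡-irr p p′)) (sym e′))

  injective : ∀ {i i′ j} → Graph i j → Graph i′ j → i ≡ i′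
  injective (arc a) (arc b) = arc-injective A a b
  injective (arc a) (rest _ q _ _) = contradiction (_ , a) (¬tgt⁻ q)
  injective (rest _ q _ _) (arc a) = contradiction (_ , a) (¬tgt⁻ q)
  injective (rest _ q _ e) (rest _ q′ _ e′) =
    trans e (trans (cong (matchRank freeValue free (sym sizes) _) (≡-irr q q′)) (sym e′))

  π₀ : Permutation′ n
  π₀ = permutation to from
    (λ j → functional (to-graph (from j)) (from-graph j))
    (λ i → injective (from-graph (to i)) (to-graph i))

  rest-increasing : ∀ {i i′ j j′} (p : free i ≡ true) (p′ : free i′ ≡ true) →
    j ≡ matchRank free freeValue sizes i p → j′ ≡ matchRank free freeValue sizes i′ p′ →
    i < i′ → j < j′
  rest-increasing p p′ refl refl i<i′ = matchRank-mono free freeValue sizes p p′ i<i′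

  no-321 : ∀ {i j k u v w} → Graph i u → Graph j v → Graph k w →
           i < j → j < k → v < u → w < v → ⊥
  no-321 (arc a) (arc b) _ i<j _ v<u _ = ℕ.<-asym (arc-increasing A a b i<j) v<u
  no-321 (rest p _ e _) (rest p′ _ e′ _) _ i<j _ v<u _ =
    ℕ.<-asym (rest-increasing p p′ e e′ i<j) v<u
  no-321 _ (arc b) (arc c) _ j<k _ w<v = ℕ.<-asym (arc-increasing A b c j<k) w<v
  no-321 _ (rest p _ e _) (rest p′ _ e′ _) _ j<k _ w<v =
    ℕ.<-asym (rest-increasing p p′ e e′ j<k) w<v
  no-321 (arc a) (rest _ _ _ _) (arc c) i<j j<k v<u w<v =
    ℕ.<-asym (arc-increasing A a c (ℕ.<-trans i<j j<k)) (ℕ.<-trans w<v v<u)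
  no-321 (rest p _ e _) (arc _) (rest p′ _ e′ _) i<j j<k v<u w<v =
    ℕ.<-asym (rest-increasing p p′ e e′ (ℕ.<-trans i<j j<k)) (ℕ.<-trans w<v v<u)

  from-injective : ∀ {x y} → from x ≡ from y → x ≡ y
  from-injective {x} {y} e = functional (from-graph x) (subst (λ k → Graph k y) (sym e) (from-graph y))

  before : ∀ {i j k v} → free i ≡ true → Graph i j → i < j → Graph k v → v ≤ i → k < i
  before _ _ _ (arc a) v≤i = ℕ.<-≤-trans (arc-< A a) v≤i
  before p (arc a) _ (rest _ _ _ _) _ = contradiction (_ , a) (¬src⁻ p)
  before {i} {j} {k} p g@(rest p₁ _ e _) i<j g′@(rest p′ _ e′ _) v≤i = compare (Fin.<-cmp k i)
    where
    compare : _ → k < i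
    compare (tri< k<i _ _) = k<i
    compare (tri≈ _ k≡i _) = contradiction
      (subst (_≤ i) (functional (subst (λ l → Graph l _) k≡i g′) g) v≤i) (ℕ.<⇒≱ i<j)
    compare (tri> _ _ i<k) = contradiction (ℕ.<-trans i<j (rest-increasing p₁ p′ e e′ i<k)) (ℕ.≤⇒≯ v≤i)

  rest-nonexc : ∀ {i j} → free i ≡ true → Graph i j → j ≤ i
  rest-nonexc {i} {j} p g = ℕ.≮⇒≥ λ i<j → ℕ.1+n≰n
    (squeeze from (Fin.toℕ<n i) (λ _ _ → from-injective)
      (λ { v (s≤s v≤i) → before p g i<j (from-graph v) v≤i }))

-- Excedances are prescribed by A; the other values are placed in increasing order.
-- Exc-Exc⁻¹ and Exc⁻¹-Exc below show that this is the two-sided inverse of Exc.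
Exc⁻¹ : ∀ n → 𝒜 (𝐀 (n ∸ 1)) → 𝒮₃₂₁ n
Exc⁻¹ n A = record
  { perm = π₀
  ; avoids = λ i<j j<k (v<u , w<v) →
      no-321 (to-graph _) (to-graph _) (to-graph _) i<j j<k v<u w<v
  }
  where open FromAntichain {n} A

Exc-Exc⁻¹ : ∀ {n} (A : 𝒜 (𝐀 (n ∸ 1))) → Exc (Exc⁻¹ n A) ≈ᴬ A
Exc-Exc⁻¹ {n} A = ⇒ , ⇐
  where
  open FromAntichain {n} A
  ⇒ : ∀ {I} → I ∈ ExcSet (Exc⁻¹ n A) → I ∈ members A
  ⇒ (i , i<πi , s) with to i | to-graph i
  ... | _ | arc (J , J∈ , t) = subst (_∈ members A) (spans-unique t s) J∈
  ... | _ | g@(rest p _ _ _) = contradiction i<πi (ℕ.≤⇒≯ (rest-nonexc p g))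
  ⇐ : ∀ {I} → I ∈ members A → I ∈ ExcSet (Exc⁻¹ n A)
  ⇐ {I} I∈ with spanned {n} I
  ... | i , j , i<j , s = i , subst (i <_) j≡ i<j , subst (Spans I i) j≡ s
    where
    j≡ : j ≡ to i
    j≡ = functional (arc (I , I∈ , s)) (to-graph i)

Exc-injective : ∀ {n} (π ρ : 𝒮₃₂₁ n) → Exc π ≈ᴬ Exc ρ → π ≈ˢ ρ
Exc-injective {n} π ρ (π⊆ρ , ρ⊆π) i = go i (<-wellFounded i)
  where
  agree : ∀ (σ τ : 𝒮₃₂₁ n) → (∀ {I} → I ∈ ExcSet σ → I ∈ ExcSet τ) →
          ∀ {i} → i < σ · i → σ · i ≡ τ · i
  agree σ τ σ⊆τ {i} i<σi with spanning i<σi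
  ... | I , s with σ⊆τ (i , i<σi , s)
  ... | k , _ , t with refl ← Fin.toℕ-injective (trans (sym (at-lo t)) (at-lo s)) =
    Fin.toℕ-injective (trans (sym (at-hi s)) (at-hi t))

  impossible : ∀ (σ τ : 𝒮₃₂₁ n) → (∀ {I} → I ∈ ExcSet τ → I ∈ ExcSet σ) →
    ∀ p → (∀ {q} → q < p → σ · q ≡ τ · q) → ¬ (p < τ · p) → ¬ (σ · p < τ · p)
  impossible σ τ τ⊆σ p ih p≮ lt = case′ (Fin.<-cmp q p)
    where
    q = perm τ ⟨$⟩ˡ (σ · p)
    τq : τ · q ≡ σ · p
    τq = Perm.inverseʳ (perm τ)
    q≢p : q ≢ p
    q≢p e = Fin.<⇒≢ lt (trans (sym τq) (cong (τ ·_) e))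
    case′ : _ → ⊥
    case′ (tri< q<p _ _) = q≢p (·-injective σ (trans (ih q<p) τq))
    case′ (tri≈ _ e _) = q≢p e
    case′ (tri> _ _ p<q) with Fin._<?_ q (τ · q)
    ... | yes q<τq = q≢p (·-injective σ (trans (sym (agree τ σ τ⊆σ q<τq)) τq))
    ... | no _ = ℕ.<-asym (subst (τ · p <_) τq (nonexc-increasing τ p<q p≮)) lt

  go : ∀ i → Acc _<_ i → π · i ≡ ρ · i
  go i (acc rs) with Fin._<?_ i (π · i) | Fin._<?_ i (ρ · i)
  ... | yes i<πi | _ = agree π ρ π⊆ρ i<πi
  ... | no _ | yes i<ρi = sym (agree ρ π ρ⊆π i<ρi)
  ... | no i≮πi | no i≮ρi with Fin.<-cmp (π · i) (ρ · i)
  ... | tri≈ _ e _ = e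
  ... | tri< lt _ _ = contradiction lt (impossible π ρ ρ⊆π i (λ q<i → go _ (rs q<i)) i≮ρi)
  ... | tri> _ _ gt = contradiction gt (impossible ρ π π⊆ρ i (λ q<i → sym (go _ (rs q<i))) i≮πi)

Exc⁻¹-Exc : ∀ {n} (π : 𝒮₃₂₁ n) → Exc⁻¹ n (Exc π) ≈ˢ π
Exc⁻¹-Exc {n} π = Exc-injective (Exc⁻¹ n (Exc π)) π (Exc-Exc⁻¹ {n} (Exc π))

record 𝒩 (n : ℕ) : Set where
  field
    partner     : Fin (n + n) → Fin (n + n)
    involutive  : ∀ x → partner (partner x) ≡ x
    no-fixed    : ∀ x → partner x ≢ x
    noncrossing : ∀ {i j k l} → i < j → j < k → k < l → ¬ (partner i ≡ k × partner j ≡ l)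

open 𝒩 public

_≈ᴺ_ : ∀ {n} → 𝒩 n → 𝒩 n → Set
M ≈ᴺ M′ = ∀ x → partner M x ≡ partner M′ x

-- A partial matching is represented by an involution whose fixed points are the unmatched points.
PartialMatching : ℕ → Set
PartialMatching N = Fin N → Fin N

link : ∀ {N} → Fin N → Fin N → PartialMatching N → PartialMatching N
link v w σ x = if does (x Fin.≟ v) then w else if does (x Fin.≟ w) then v else σ x

-- The point k steps from v around a circle of N points, for k ≤ N.
clockwise counterclockwise : ∀ {N} → Fin N → ℕ → Fin N
clockwise        {suc m} v k = (toℕ v + k) mod suc m
counterclockwise {suc m} v k = (toℕ v + (suc m ∸ k)) mod suc m

nearestUnmatched : ∀ {N} → (Fin N → ℕ → Fin N) → PartialMatching N → Fin N → Maybe (Fin N)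
nearestUnmatched {N} walk σ v =
  find (λ x → σ x Fin.≟ x) (applyUpTo (λ k → walk v (suc k)) (N ∸ 1))

-- The default σ is never used in AST: by matchNearest-good an unmatched point is always found.
matchNearest : ∀ {N} → (Fin N → ℕ → Fin N) → Fin N → PartialMatching N → PartialMatching N
matchNearest walk v σ = maybe′ (λ w → link v w σ) σ (nearestUnmatched walk σ v)

-- vertex i is the point i and barred i the point 2n + 1 − i.
vertex barred : ∀ {n} → Fin n → Fin (n + n)
vertex {n} i = i ↑ˡ n
barred i = opposite (vertex i)

AST-step : ∀ n → 𝒜 (𝐀 (n ∸ 1)) → PartialMatching (n + n) → Fin n → PartialMatching (n + n)
AST-step n A σ i with Fin.any? (arc? A i)
... | yes (j , _) = matchNearest counterclockwise (vertex j) σ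
... | no _        = matchNearest clockwise (barred i) σ

AST-result : ∀ n → 𝒜 (𝐀 (n ∸ 1)) → PartialMatching (n + n)
AST-result n A = foldl (AST-step n A) id (allFin n)

foldl-invariant : ∀ {n} {S : Set} (P : ℕ → S → Set) (g : S → Fin n → S) {s} → P 0 s →
  (∀ i s → P (toℕ i) s → P (suc (toℕ i)) (g s i)) → P n (foldl g s (allFin n))
foldl-invariant {n} {S} P g {s} base step = go n 0 s id (λ _ → refl) base
  where
  go : ∀ k o s (f : Fin k → Fin n) → (∀ i → toℕ (f i) ≡ o + toℕ i) →
       P o s → P (o + k) (foldl g s (tabulate f))
  go zero    o s f f≡ p = subst (λ t → P t s) (sym (ℕ.+-identityʳ o)) p
  go (suc k) o s f f≡ p =
    subst (λ t → P t (foldl g (g s (f zero)) (tabulate (f ∘ suc)))) (sym (ℕ.+-suc o k))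
      (go k (suc o) (g s (f zero)) (f ∘ suc) (λ i → trans (f≡ (suc i)) (ℕ.+-suc o (toℕ i)))
        (subst (λ t → P (suc t) _) o≡ (step (f zero) s (subst (λ t → P t s) (sym o≡) p))))
    where o≡ = trans (f≡ zero) (ℕ.+-identityʳ o)

lookup-injective : ∀ {A : Set} {xs : List A} → Unique xs → ∀ {i j} → lookup xs i ≡ lookup xs j → i ≡ j
lookup-injective (_ ∷ u)  {zero}  {zero}  e = refl
lookup-injective (x≢ ∷ _) {zero}  {suc j} e = contradiction e (All.lookup x≢ (∈-lookup j))
lookup-injective (x≢ ∷ _) {suc i} {zero}  e = contradiction (sym e) (All.lookup x≢ (∈-lookup i))
lookup-injective (_ ∷ u)  {suc i} {suc j} e = cong suc (lookup-injective u e)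

unique-⊆⇒length-≤ : ∀ {A : Set} {xs ys : List A} → Unique xs →
  (∀ {x} → x ∈ˡ xs → x ∈ˡ ys) → length xs ℕ.≤ length ys
unique-⊆⇒length-≤ {xs = xs} {ys} u sub = Fin.injective⇒≤ {f = λ i → index (sub (∈-lookup i))}
  λ {i} {j} e → lookup-injective u (trans (lookup-index (sub (∈-lookup i)))
    (trans (cong (lookup ys) e) (sym (lookup-index (sub (∈-lookup j))))))

Inside Outside : ∀ {N} → Fin N → Fin N → Fin N → Set
Inside  v w y = (v < y × y < w) ⊎ (w < y × y < v)
Outside v w y = (y < v × y < w) ⊎ (v < y × w < y)

-- For an arc {v , w} of σ: all unmatched points other than v and w are on the same side of it.
OneSided : ∀ {N} → PartialMatching N → Fin N → Fin N → Set
OneSided σ v w = (∀ y → Inside v w y → σ y ≢ y) ⊎ (∀ y → Outside v w y → σ y ≢ y)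

record Good {N} (σ : PartialMatching N) (m : ℕ) : Set where
  field
    invol    : ∀ x → σ (σ x) ≡ x
    uncrossed : ∀ {i j k l} → i < j → j < k → k < l → ¬ (σ i ≡ k × σ j ≡ l)
    one-sided : ∀ x → σ x ≢ x → OneSided σ x (σ x)
    matched  : List (Fin N)
    count    : length matched ≡ m + m
    distinct : Unique matched
    sound    : ∀ {x} → x ∈ˡ matched → σ x ≢ x
    complete : ∀ {x} → σ x ≢ x → x ∈ˡ matched

good-empty : ∀ {N} → Good {N} id 0
good-empty = record
  { invol = λ _ → refl
  ; uncrossed = λ { i<j j<k _ (refl , _) → ℕ.<-asym i<j j<k }
  ; one-sided = λ x x≢x → contradiction refl x≢x
  ; matched = [] ; count = refl ; distinct = []
  ; sound = λ () ; complete = λ x≢x → contradiction refl x≢x }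

data LinkView {N} (v w : Fin N) (σ : PartialMatching N) (x y : Fin N) : Set where
  at-v  : x ≡ v → y ≡ w → LinkView v w σ x y
  at-w  : x ≢ v → x ≡ w → y ≡ v → LinkView v w σ x y
  other : x ≢ v → x ≢ w → y ≡ σ x → LinkView v w σ x y

link-view : ∀ {N} (v w : Fin N) σ x → LinkView v w σ x (link v w σ x)
link-view v w σ x with x Fin.≟ v
... | yes e = at-v e refl
... | no ≢v with x Fin.≟ w
... | yes e = at-w ≢v e refl
... | no ≢w = other ≢v ≢w refl

module _ {N} {σ : PartialMatching N} {m} (G : Good σ m) {v w : Fin N}
         (v-free : σ v ≡ v) (w-free : σ w ≡ w) (v≢w : v ≢ w) (side : OneSided σ v w) where
  open Good G

  private
    τ = link v w σ

    τ-v : τ v ≡ w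
    τ-v with link-view v w σ v
    ... | at-v _ e = e
    ... | at-w v≢ _ _ = contradiction refl v≢
    ... | other v≢ _ _ = contradiction refl v≢

    τ-w : τ w ≡ v
    τ-w with link-view v w σ w
    ... | at-v e _ = contradiction (sym e) v≢w
    ... | at-w _ _ e = e
    ... | other _ w≢ _ = contradiction refl w≢

    τ-other : ∀ {x} → x ≢ v → x ≢ w → τ x ≡ σ x
    τ-other {x} a b with link-view v w σ x
    ... | at-v e _ = contradiction e a
    ... | at-w _ e _ = contradiction e b
    ... | other _ _ e = e

    matched-≢ : ∀ {x y} → σ y ≡ y → σ x ≢ x → x ≢ y
    matched-≢ e ne refl = ne e

    image-matched : ∀ {x} → σ x ≢ x → σ (σ x) ≢ σ x
    image-matched ne e = ne (trans (sym e) (invol _))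

    grows : ∀ {x} → σ x ≢ x → τ x ≢ x
    grows ne e = ne (trans (sym (τ-other (matched-≢ v-free ne) (matched-≢ w-free ne))) e)

    σ≢ : ∀ {x y} → σ y ≡ y → x ≢ y → σ x ≢ y
    σ≢ e x≢y σx≡y = x≢y (trans (sym (invol _)) (trans (cong σ σx≡y) e))

    τ-invol : ∀ x → τ (τ x) ≡ x
    τ-invol x with link-view v w σ x
    ... | at-v e₁ e₂ = trans (cong τ e₂) (trans τ-w (sym e₁))
    ... | at-w _ e₁ e₂ = trans (cong τ e₂) (trans τ-v (sym e₁))
    ... | other a b e = trans (cong τ e) (trans (τ-other (σ≢ v-free a) (σ≢ w-free b)) (invol x))

    transfer : ∀ {x y} → OneSided σ x y → OneSided τ x y
    transfer (inj₁ f) = inj₁ λ y p → grows (f y p)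
    transfer (inj₂ f) = inj₂ λ y p → grows (f y p)

    swap-side : ∀ {x y} → OneSided τ x y → OneSided τ y x
    swap-side (inj₁ f) = inj₁ λ { y (inj₁ p) → f y (inj₂ p) ; y (inj₂ p) → f y (inj₁ p) }
    swap-side (inj₂ f) = inj₂ λ { y (inj₁ (p , q)) → f y (inj₁ (q , p)) ; y (inj₂ (p , q)) → f y (inj₂ (q , p)) }

    τ-sided : ∀ x → τ x ≢ x → OneSided τ x (τ x)
    τ-sided x ne with link-view v w σ x
    ... | at-v e₁ e₂ = subst₂ (OneSided τ) (sym e₁) (sym e₂) (transfer side)
    ... | at-w _ e₁ e₂ = subst₂ (OneSided τ) (sym e₁) (sym e₂) (swap-side (transfer side))
    ... | other _ _ e = subst (OneSided τ x) (sym e) (transfer (one-sided x (ne ∘ trans e)))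

    -- v and w are both unmatched in σ, so no arc of σ separates them
    unseparated : ∀ {i k y z} → σ i ≡ k → i ≢ k → σ y ≡ y → σ z ≡ z →
                  Inside i k y → Outside i k z → ⊥
    unseparated {i} refl i≢k ey ez p q with one-sided i (i≢k ∘ sym)
    ... | inj₁ f = f _ p ey
    ... | inj₂ f = f _ q ez

    τ-uncrossed : ∀ {i j k l} → i < j → j < k → k < l → ¬ (τ i ≡ k × τ j ≡ l)
    τ-uncrossed {i} {j} {k} {l} i<j j<k k<l (e , f)
      with link-view v w σ i | link-view v w σ j
    ... | at-v a b   | at-v c _   = contradiction (trans a (sym c)) (Fin.<⇒≢ i<j)
    ... | at-v a b   | at-w _ c _ = contradiction (trans (sym e) (trans b (sym c))) (Fin.<⇒≢ j<k ∘ sym)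
    ... | at-w _ a b | at-w _ c _ = contradiction (trans a (sym c)) (Fin.<⇒≢ i<j)
    ... | at-w _ a b | at-v c _   = contradiction (trans (sym e) (trans b (sym c))) (Fin.<⇒≢ j<k ∘ sym)
    ... | other _ _ a | other _ _ b = uncrossed i<j j<k k<l (trans (sym a) e , trans (sym b) f)
    ... | at-v a b   | other _ _ c =
      unseparated (trans (sym c) f) (Fin.<⇒≢ (ℕ.<-trans j<k k<l))
        (subst (λ z → σ z ≡ z) (trans (sym b) e) w-free) (subst (λ z → σ z ≡ z) (sym a) v-free)
        (inj₁ (j<k , k<l)) (inj₁ (i<j , ℕ.<-trans i<j (ℕ.<-trans j<k k<l)))
    ... | at-w _ a b | other _ _ c =
      unseparated (trans (sym c) f) (Fin.<⇒≢ (ℕ.<-trans j<k k<l))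
        (subst (λ z → σ z ≡ z) (trans (sym b) e) v-free) (subst (λ z → σ z ≡ z) (sym a) w-free)
        (inj₁ (j<k , k<l)) (inj₁ (i<j , ℕ.<-trans i<j (ℕ.<-trans j<k k<l)))
    ... | other _ _ c | at-v a b =
      unseparated (trans (sym c) e) (Fin.<⇒≢ (ℕ.<-trans i<j j<k))
        (subst (λ z → σ z ≡ z) (sym a) v-free) (subst (λ z → σ z ≡ z) (trans (sym b) f) w-free)
        (inj₁ (i<j , j<k)) (inj₂ (ℕ.<-trans i<j (ℕ.<-trans j<k k<l) , k<l))
    ... | other _ _ c | at-w _ a b =
      unseparated (trans (sym c) e) (Fin.<⇒≢ (ℕ.<-trans i<j j<k))
        (subst (λ z → σ z ≡ z) (sym a) w-free) (subst (λ z → σ z ≡ z) (trans (sym b) f) v-free)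
        (inj₁ (i<j , j<k)) (inj₂ (ℕ.<-trans i<j (ℕ.<-trans j<k k<l) , k<l))

    free-∉ : ∀ {y} → σ y ≡ y → All (y ≢_) matched
    free-∉ e = All.tabulate λ {x} x∈ y≡x → sound x∈ (subst (λ z → σ z ≡ z) y≡x e)

  link-good : Good τ (suc m)
  link-good = record
    { invol = τ-invol
    ; uncrossed = τ-uncrossed
    ; one-sided = τ-sided
    ; matched = v ∷ w ∷ matched
    ; count = cong suc (trans (cong suc count) (sym (ℕ.+-suc m m)))
    ; distinct = (v≢w ∷ free-∉ v-free) ∷ free-∉ w-free ∷ distinct
    ; sound = λ { (here refl) e → v≢w (trans (sym e) τ-v)
                ; (there (here refl)) e → v≢w (trans (sym τ-w) e)
                ; (there (there x∈)) → grows (sound x∈) }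
    ; complete = λ {x} → complete′ x
    }
    where
    complete′ : ∀ x → τ x ≢ x → x ∈ˡ (v ∷ w ∷ matched)
    complete′ x ne with link-view v w σ x
    ... | at-v e _ = here e
    ... | at-w _ e _ = there (here e)
    ... | other _ _ e = there (there (complete (ne ∘ trans e)))

  link-matched : ∀ {x} → τ x ≢ x → x ≡ v ⊎ x ≡ w ⊎ σ x ≢ x
  link-matched {x} ne with link-view v w σ x
  ... | at-v e _ = inj₁ e
  ... | at-w _ e _ = inj₂ (inj₁ e)
  ... | other _ _ e = inj₂ (inj₂ (ne ∘ trans e))

mod-small : ∀ {m a} (y : Fin (suc m)) → toℕ y ≡ a → a mod suc m ≡ y
mod-small y refl = Fin.toℕ-injective (trans (Fin.toℕ-fromℕ< _) (m<n⇒m%n≡m (Fin.toℕ<n y)))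

mod-large : ∀ {m a} (y : Fin (suc m)) → toℕ y + suc m ≡ a → a mod suc m ≡ y
mod-large {m} y refl = Fin.toℕ-injective (trans (Fin.toℕ-fromℕ< _)
  (trans ([m+n]%n≡m%n (toℕ y) (suc m)) (m<n⇒m%n≡m (Fin.toℕ<n y))))

mod-cases : ∀ {m a} → a ℕ.< suc m + suc m →
            toℕ (a mod suc m) ≡ a ⊎ toℕ (a mod suc m) + suc m ≡ a
mod-cases {m} {a} a< with a ℕ.<? suc m
... | yes lt = inj₁ (trans (cong toℕ (mod-small (fromℕ< lt) (Fin.toℕ-fromℕ< lt))) (Fin.toℕ-fromℕ< lt))
... | no ≮ = inj₂ (trans (cong (λ y → toℕ y + suc m) (mod-large y y≡)) y≡)
  where
  N≤a = ℕ.≮⇒≥ ≮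
  lt : a ∸ suc m ℕ.< suc m
  lt = subst (a ∸ suc m ℕ.<_) (ℕ.m+n∸n≡m (suc m) (suc m)) (ℕ.∸-monoˡ-< a< N≤a)
  y = fromℕ< lt
  y≡ : toℕ y + suc m ≡ a
  y≡ = trans (cong (_+ suc m) (Fin.toℕ-fromℕ< lt)) (ℕ.m∸n+n≡m N≤a)

-- Near v k y and Far v k y both say that y is k steps from v; Far if the walk passes between N and 1.
record Walk {N} (walk : Fin N → ℕ → Fin N) : Set₁ where
  field
    Near Far : Fin N → ℕ → Fin N → Set
    near     : ∀ {v k y} → k ℕ.< N → Near v k y → walk v k ≡ y
    far      : ∀ {v k y} → k ℕ.< N → Far v k y → walk v k ≡ y
    position : ∀ v k → k ℕ.< N → Near v k (walk v k) ⊎ Far v k (walk v k)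
    near-inj : ∀ {v k l y} → Near v k y → Near v l y → k ≡ l
    far-inj  : ∀ {v k l y} → Far v k y → Far v l y → k ≡ l
    near-far : ∀ {v k l y} → k ℕ.< N → l ℕ.< N → Near v k y → Far v l y → ⊥
    near-self : ∀ {v k} → Near v k v → k ≡ 0
    far-self : ∀ {v k} → k ℕ.< N → ¬ Far v k v
    near-side : ∀ {v k w y} → k ℕ.< N → Near v k w → Inside v w y →
                ∃ λ l → l ℕ.< k × 0 ℕ.< l × Near v l y
    far-side  : ∀ {v k w y} → k ℕ.< N → Far v k w → Outside v w y →
                ∃ λ l → l ℕ.< k × 0 ℕ.< l × (Near v l y ⊎ Far v l y)
open Walk

n≢m+n : ∀ {n m} → 0 ℕ.< m → n ≢ m + n
n≢m+n {n} 0<m e = ℕ.<-irrefl e (ℕ.m<n+m n 0<m)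

clockwise-walk : ∀ {m} → Walk (clockwise {suc m})
clockwise-walk {m} = record
  { Near = λ v k y → toℕ y ≡ toℕ v + k
  ; Far  = λ v k y → toℕ y + N ≡ toℕ v + k
  ; near = λ {_} {_} {y} _ → mod-small y
  ; far  = λ {_} {_} {y} _ → mod-large y
  ; position = λ v k k<N → mod-cases (ℕ.+-mono-< (Fin.toℕ<n v) k<N)
  ; near-inj = λ {v} p q → ℕ.+-cancelˡ-≡ (toℕ v) _ _ (trans (sym p) q)
  ; far-inj  = λ {v} p q → ℕ.+-cancelˡ-≡ (toℕ v) _ _ (trans (sym p) q)
  ; near-far = λ {v} {k} {l} {y} _ l<N p q →
      ℕ.<-irrefl (sym q) (ℕ.<-≤-trans (ℕ.+-monoʳ-< (toℕ v) l<N)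
        (ℕ.+-monoˡ-≤ N (subst (toℕ v ℕ.≤_) (sym p) (ℕ.m≤m+n (toℕ v) k))))
  ; near-self = λ {v} {k} p → ℕ.+-cancelˡ-≡ (toℕ v) _ _ (trans (sym p) (sym (ℕ.+-identityʳ (toℕ v))))
  ; far-self = λ {v} k<N p → ℕ.<-irrefl (sym (ℕ.+-cancelˡ-≡ (toℕ v) _ _ p)) k<N
  ; near-side = λ
      { {v} {k} {w} {y} _ p (inj₁ (v<y , y<w)) →
          let e = ℕ.m+[n∸m]≡n (ℕ.<⇒≤ v<y) in
          toℕ y ∸ toℕ v
          , ℕ.+-cancelˡ-< (toℕ v) _ _ (subst₂ ℕ._<_ (sym e) p y<w)
          , ℕ.m<n⇒0<n∸m v<y
          , sym e
      ; {v} {k} _ p (inj₂ (w<y , y<v)) →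
          contradiction (ℕ.<-trans w<y y<v) (ℕ.≤⇒≯ (subst (toℕ v ℕ.≤_) (sym p) (ℕ.m≤m+n (toℕ v) k))) }
  ; far-side = λ
      { {v} {k} {w} {y} _ p (inj₁ (y<v , y<w)) →
          let v<y+N = ℕ.<-≤-trans (Fin.toℕ<n v) (ℕ.m≤n+m N (toℕ y))
              e = ℕ.m+[n∸m]≡n (ℕ.<⇒≤ v<y+N) in
          toℕ y + N ∸ toℕ v
          , ℕ.+-cancelˡ-< (toℕ v) _ _ (subst₂ ℕ._<_ (sym e) p (ℕ.+-monoˡ-< N y<w))
          , ℕ.m<n⇒0<n∸m v<y+N
          , inj₂ (sym e)
      ; {v} {k} {w} {y} _ p (inj₂ (v<y , w<y)) →
          let e = ℕ.m+[n∸m]≡n (ℕ.<⇒≤ v<y) in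
          toℕ y ∸ toℕ v
          , ℕ.+-cancelˡ-< (toℕ v) _ _
              (subst₂ ℕ._<_ (sym e) p (ℕ.<-≤-trans (Fin.toℕ<n y) (ℕ.m≤n+m N (toℕ w))))
          , ℕ.m<n⇒0<n∸m v<y
          , inj₁ (sym e) }
  }
  where N = suc m

counterclockwise-walk : ∀ {m} → Walk (counterclockwise {suc m})
counterclockwise-walk {m} = record
  { Near = λ v k y → toℕ y + k ≡ toℕ v
  ; Far  = λ v k y → toℕ y + k ≡ toℕ v + N
  ; near = λ {v} {k} {y} k<N p → mod-large y (near⁻ (toℕ y) (ℕ.<⇒≤ k<N) p)
  ; far  = λ {v} {k} {y} k<N p → mod-small y (far⁻ (toℕ y) (ℕ.<⇒≤ k<N) p)
  ; position = position′
  ; near-inj = λ {v} {k} {l} {y} p q → ℕ.+-cancelˡ-≡ (toℕ y) _ _ (trans p (sym q))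
  ; far-inj  = λ {v} {k} {l} {y} p q → ℕ.+-cancelˡ-≡ (toℕ y) _ _ (trans p (sym q))
  ; near-far = λ {v} {k} {l} {y} _ l<N p q →
      ℕ.<-irrefl q (ℕ.+-mono-≤-< (subst (toℕ y ℕ.≤_) p (ℕ.m≤m+n (toℕ y) k)) l<N)
  ; near-self = λ {v} p → ℕ.+-cancelˡ-≡ (toℕ v) _ _ (trans p (sym (ℕ.+-identityʳ (toℕ v))))
  ; far-self = λ {v} k<N p → ℕ.<-irrefl (ℕ.+-cancelˡ-≡ (toℕ v) _ _ p) k<N
  ; near-side = λ
      { {v} {k} {w} {y} _ p (inj₁ (v<y , y<w)) →
          contradiction (ℕ.<-trans v<y y<w) (ℕ.≤⇒≯ (subst (toℕ w ℕ.≤_) p (ℕ.m≤m+n (toℕ w) k)))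
      ; {v} {k} {w} {y} _ p (inj₂ (w<y , y<v)) →
          let e = ℕ.m+[n∸m]≡n (ℕ.<⇒≤ y<v) in
          toℕ v ∸ toℕ y
          , smaller {w = toℕ w} {toℕ y} (trans p (sym e)) w<y
          , ℕ.m<n⇒0<n∸m y<v
          , e }
  ; far-side = λ
      { {v} {k} {w} {y} _ p (inj₁ (y<v , y<w)) →
          let e = ℕ.m+[n∸m]≡n (ℕ.<⇒≤ y<v) in
          toℕ v ∸ toℕ y
          , ℕ.+-cancelˡ-< (toℕ w) _ _ (subst (toℕ w + (toℕ v ∸ toℕ y) ℕ.<_) (sym p)
              (subst (ℕ._< toℕ v + N) (ℕ.+-comm (toℕ v ∸ toℕ y) (toℕ w))
                (ℕ.+-mono-≤-< (ℕ.m∸n≤m (toℕ v) (toℕ y)) (Fin.toℕ<n w))))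
          , ℕ.m<n⇒0<n∸m y<v
          , inj₁ e
      ; {v} {k} {w} {y} _ p (inj₂ (v<y , w<y)) →
          let y<v+N = ℕ.<-≤-trans (Fin.toℕ<n y) (ℕ.m≤n+m N (toℕ v))
              e = ℕ.m+[n∸m]≡n (ℕ.<⇒≤ y<v+N) in
          toℕ v + N ∸ toℕ y
          , smaller {w = toℕ w} {toℕ y} (trans p (sym e)) w<y
          , ℕ.m<n⇒0<n∸m y<v+N
          , inj₂ e }
  }
  where
  N = suc m

  smaller : ∀ {w y k l} → w + k ≡ y + l → w ℕ.< y → l ℕ.< k
  smaller {w} {y} {k} {l} e w<y = ℕ.≰⇒> λ k≤l → ℕ.<-irrefl e (ℕ.+-mono-<-≤ w<y k≤l)

  near⁻ : ∀ y {v k} → k ℕ.≤ N → y + k ≡ v → y + N ≡ v + (N ∸ k)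
  near⁻ y {_} {k} k≤N refl = trans (cong (y +_) (sym (ℕ.m+[n∸m]≡n k≤N))) (sym (ℕ.+-assoc y k _))

  far⁻ : ∀ y {v k} → k ℕ.≤ N → y + k ≡ v + N → y ≡ v + (N ∸ k)
  far⁻ y {v} {k} k≤N e = ℕ.+-cancelʳ-≡ k _ _ (trans e
    (trans (cong (v +_) (sym (ℕ.m∸n+n≡m k≤N))) (sym (ℕ.+-assoc v (N ∸ k) k))))

  near⁺ : ∀ y {v k} → k ℕ.≤ N → y + N ≡ v + (N ∸ k) → y + k ≡ v
  near⁺ y {v} {k} k≤N e = ℕ.+-cancelʳ-≡ (N ∸ k) _ _ (trans (ℕ.+-assoc y k _)
    (trans (cong (y +_) (ℕ.m+[n∸m]≡n k≤N)) e))

  far⁺ : ∀ y {v k} → k ℕ.≤ N → y ≡ v + (N ∸ k) → y + k ≡ v + N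
  far⁺ _ {v} {k} k≤N refl = trans (ℕ.+-assoc v (N ∸ k) k) (cong (v +_) (ℕ.m∸n+n≡m k≤N))

  position′ : ∀ v k → k ℕ.< N → toℕ (counterclockwise v k) + k ≡ toℕ v
                              ⊎ toℕ (counterclockwise v k) + k ≡ toℕ v + N
  position′ v k k<N with mod-cases {m} {toℕ v + (N ∸ k)} (ℕ.+-mono-<-≤ (Fin.toℕ<n v) (ℕ.m∸n≤m N k))
  ... | inj₁ e = inj₂ (far⁺ _ (ℕ.<⇒≤ k<N) e)
  ... | inj₂ e = inj₁ (near⁺ _ (ℕ.<⇒≤ k<N) e)

find-first : ∀ {A : Set} {P : Pred A 0ℓ} (P? : Decidable P) (f : ℕ → A) M k₀ → k₀ ℕ.< M → P (f k₀) →
  ∃ λ k → k ℕ.≤ k₀ × (∀ l → l ℕ.< k → ¬ P (f l)) × P (f k) × find P? (applyUpTo f M) ≡ just (f k)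
find-first P? f (suc M) k₀ k₀< pk₀ with P? (f 0)
... | yes p = 0 , z≤n , (λ _ ()) , p , refl
... | no ¬p with k₀
...   | zero = contradiction pk₀ ¬p
...   | suc k₁ with find-first P? (f ∘ suc) M k₁ (ℕ.≤-pred k₀<) pk₀
...     | k , k≤ , before , pk , e =
  suc k , s≤s k≤ , (λ { zero _ → ¬p ; (suc l) (s≤s l<k) → before l l<k }) , pk , e

module _ {N} {walk : Fin N → ℕ → Fin N} (W : Walk walk)
         {σ : PartialMatching N} {m} (G : Good σ m)
         (room : suc (m + m) ℕ.< N) {v : Fin N} (v-free : σ v ≡ v) where

  open Good G

  matchNearest-good : ∃₂ λ k w →
    matchNearest walk v σ ≡ link v w σ × Good (link v w σ) (suc m)
    × k ℕ.≤ suc (m + m) × (Near W v k w ⊎ Far W v k w)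
    × (∀ {x} → link v w σ x ≢ x → x ≡ v ⊎ x ≡ w ⊎ σ x ≢ x)
  matchNearest-good with Fin.any? (λ (k : Fin (suc (m + m))) → σ (walk v (suc (toℕ k))) Fin.≟ walk v (suc (toℕ k)))
  ... | no none = contradiction
          (subst₂ ℕ._≤_ (List.length-applyUpTo f (suc (m + m))) count
            (unique-⊆⇒length-≤ (Unique.applyUpTo⁺₁ f (suc (m + m)) different) all-matched))
          ℕ.1+n≰n
    where
    f : ℕ → Fin N
    f k = walk v (suc k)
    different : ∀ {i j} → i ℕ.< j → j ℕ.< suc (m + m) → f i ≢ f j
    different {i} {j} i<j j< e = ℕ.<⇒≢ i<j (ℕ.suc-injective (conflict (position W v (suc i) i<N) (position W v (suc j) j<N)))
      where
      j<N = ℕ.≤-<-trans j< room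
      i<N = ℕ.<-trans (s≤s i<j) j<N
      conflict : Near W v (suc i) (f i) ⊎ Far W v (suc i) (f i) →
                 Near W v (suc j) (f j) ⊎ Far W v (suc j) (f j) → suc i ≡ suc j
      conflict (inj₁ p) (inj₁ q) = near-inj W p (subst (Near W v (suc j)) (sym e) q)
      conflict (inj₂ p) (inj₂ q) = far-inj W p (subst (Far W v (suc j)) (sym e) q)
      conflict (inj₁ p) (inj₂ q) = ⊥-elim (near-far W i<N j<N p (subst (Far W v (suc j)) (sym e) q))
      conflict (inj₂ p) (inj₁ q) = ⊥-elim (near-far W j<N i<N (subst (Near W v (suc j)) (sym e) q) p)
    all-matched : ∀ {x} → x ∈ˡ applyUpTo f (suc (m + m)) → x ∈ˡ matched
    all-matched x∈ with ∈-applyUpTo⁻ f x∈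
    ... | i , i< , refl = complete λ e → none (fromℕ< i< ,
            subst (λ t → σ (f t) ≡ f t) (sym (Fin.toℕ-fromℕ< i<)) e)
  ... | yes (k₀ , free₀)
    with find-first (λ x → σ x Fin.≟ x) (λ k → walk v (suc k)) (N ∸ 1) (toℕ k₀)
           (ℕ.<-≤-trans (Fin.toℕ<n k₀) (ℕ.<⇒≤pred room)) free₀
  ... | k , k≤k₀ , before , free , e =
    suc k , w , cong (maybe′ (λ w → link v w σ) σ) e , link-good G v-free free v≢w side
    , k≤ , pos , link-matched G v-free free v≢w side
    where
    w = walk v (suc k)
    k≤ : suc k ℕ.≤ suc (m + m)
    k≤ = ℕ.≤-trans (s≤s k≤k₀) (Fin.toℕ<n k₀)
    k<N = ℕ.≤-<-trans k≤ room
    pos = position W v (suc k) k<N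
    v≢w : v ≢ w
    v≢w v≡w with pos
    ... | inj₁ p = contradiction (near-self W (subst (Near W v (suc k)) (sym v≡w) p)) λ ()
    ... | inj₂ p = far-self W k<N (subst (Far W v (suc k)) (sym v≡w) p)
    passed : ∀ {l y} → l ℕ.< suc k → 0 ℕ.< l → walk v l ≡ y → σ y ≢ y
    passed {suc l} (s≤s l<k) _ refl = before l l<k
    side : OneSided σ v w
    side with pos
    ... | inj₁ p = inj₁ λ y y∈ → let (l , l<k , 0<l , q) = near-side W k<N p y∈ in
                     passed l<k 0<l (near W (ℕ.<-trans l<k k<N) q)
    ... | inj₂ p = inj₂ λ y y∈ → go (far-side W k<N p y∈)
      where
      go : ∀ {y} → (∃ λ l → l ℕ.< suc k × 0 ℕ.< l × (Near W v l y ⊎ Far W v l y)) → σ y ≢ y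
      go (l , l<k , 0<l , inj₁ q) = passed l<k 0<l (near W (ℕ.<-trans l<k k<N) q)
      go (l , l<k , 0<l , inj₂ q) = passed l<k 0<l (far W (ℕ.<-trans l<k k<N) q)

toℕ-vertex : ∀ {n} (i : Fin n) → toℕ (vertex i) ≡ toℕ i
toℕ-vertex {n} i = Fin.toℕ-↑ˡ i n

toℕ-barred : ∀ {n} (i : Fin n) → toℕ (barred i) + suc (toℕ i) ≡ n + n
toℕ-barred {n} i = trans (cong (_+ suc (toℕ i)) (trans (Fin.opposite-prop (vertex i)) (cong (λ t → n + n ∸ suc t) (toℕ-vertex i))))
  (ℕ.m∸n+n≡m (ℕ.≤-trans (Fin.toℕ<n i) (ℕ.m≤m+n n n)))

module ASTInvariant {n} (A : 𝒜 (𝐀 (n ∸ 1))) where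

  N = n + n

  Reached : ℕ → Fin N → Set
  Reached t x = N ℕ.≤ toℕ x + t ⊎ toℕ x ℕ.< t
              ⊎ ∃₂ λ (i j : Fin n) → toℕ i ℕ.< t × Arc A i j × toℕ x ℕ.≤ toℕ j

  record Invariant (t : ℕ) (σ : PartialMatching N) : Set where
    field
      good   : Good σ t
      region : ∀ {x} → σ x ≢ x → Reached t x

  open Invariant

  reached-suc : ∀ {t x} → Reached t x → Reached (suc t) x
  reached-suc {t} {x} (inj₁ p) = inj₁ (ℕ.≤-trans p (ℕ.+-monoʳ-≤ (toℕ x) (ℕ.n≤1+n t)))
  reached-suc (inj₂ (inj₁ p)) = inj₂ (inj₁ (ℕ.m<n⇒m<1+n p))
  reached-suc (inj₂ (inj₂ (i , j , p , a , q))) = inj₂ (inj₂ (i , j , ℕ.m<n⇒m<1+n p , a , q))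

  enough-room : ∀ (i : Fin n) → suc (toℕ i + toℕ i) ℕ.< N
  enough-room i = subst (ℕ._≤ N) (cong suc (ℕ.+-suc (toℕ i) (toℕ i)))
                        (ℕ.+-mono-≤ (Fin.toℕ<n i) (Fin.toℕ<n i))

  extend : ∀ {t σ walk} (W : Walk walk) v → suc (t + t) ℕ.< N → Invariant t σ →
    ¬ Reached t v → Reached (suc t) v →
    (∀ k w → k ℕ.≤ suc (t + t) → Near W v k w ⊎ Far W v k w → Reached (suc t) w) →
    Invariant (suc t) (matchNearest walk v σ)
  extend {t} {σ} {walk} W v room I v-new v-ok w-ok
    with matchNearest-good W (good I) room (decidable-stable (σ v Fin.≟ v) (v-new ∘ region I))
  ... | k , w , e , G , k≤ , pos , cases = subst (Invariant (suc t)) (sym e) (record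
    { good = G ; region = λ {x} ne → reach x (cases ne) })
    where
    reach : ∀ x → x ≡ v ⊎ x ≡ w ⊎ σ x ≢ x → Reached (suc t) x
    reach x (inj₁ refl) = v-ok
    reach x (inj₂ (inj₁ refl)) = w-ok k w k≤ pos
    reach x (inj₂ (inj₂ ne)) = reached-suc {t} {x} (region I ne)

  vertex-new : ∀ {i j : Fin n} → Arc A i j → ¬ Reached (toℕ i) (vertex j)
  vertex-new {i} {j} a r rewrite toℕ-vertex j = go r
    where
    go : _ → ⊥
    go (inj₁ p) = ℕ.<⇒≱ (ℕ.+-mono-< (Fin.toℕ<n j) (Fin.toℕ<n i)) p
    go (inj₂ (inj₁ p)) = ℕ.<-asym (arc-< A a) p
    go (inj₂ (inj₂ (i′ , j′ , p , a′ , q))) = ℕ.<⇒≱ (arc-increasing A a′ a p) q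

  barred-new : ∀ (i : Fin n) → ¬ Reached (toℕ i) (barred i)
  barred-new i = go
    where
    big : n ℕ.≤ toℕ (barred i)
    big = ℕ.+-cancelʳ-≤ (suc (toℕ i)) _ _
      (subst (n + suc (toℕ i) ℕ.≤_) (sym (toℕ-barred i)) (ℕ.+-monoʳ-≤ n (Fin.toℕ<n i)))
    go : ¬ Reached (toℕ i) (barred i)
    go (inj₁ p) = ℕ.1+n≰n (ℕ.+-cancelˡ-≤ (toℕ (barred i)) _ _
                    (subst (ℕ._≤ toℕ (barred i) + toℕ i) (sym (toℕ-barred i)) p))
    go (inj₂ (inj₁ p)) = ℕ.<⇒≱ (ℕ.<-trans p (Fin.toℕ<n i)) big
    go (inj₂ (inj₂ (_ , j , _ , _ , q))) = ℕ.<⇒≱ (ℕ.≤-<-trans q (Fin.toℕ<n j)) big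

  near-ccw : ∀ {t} {i j : Fin n} {w : Fin N} k → toℕ i ≡ t → Arc A i j →
             toℕ w + k ≡ toℕ (vertex j) → Reached (suc t) w
  near-ccw {j = j} {w} k refl a e = inj₂ (inj₂ (_ , j , ℕ.≤-refl , a ,
    subst (toℕ w ℕ.≤_) (trans e (toℕ-vertex j)) (ℕ.m≤m+n (toℕ w) k)))

  far-ccw : ∀ {t v w k} → suc t ℕ.≤ v → k ℕ.≤ suc (t + t) → w + k ≡ v + N → N ℕ.≤ w + suc t
  far-ccw {t} {v} {w} {k} t<v k≤ e = ℕ.+-cancelˡ-≤ v _ _ (begin
    v + N             ≡⟨ e ⟨
    w + k             ≤⟨ ℕ.+-monoʳ-≤ w k≤ ⟩
    w + (suc t + t)   ≤⟨ ℕ.+-monoʳ-≤ w (ℕ.+-mono-≤ t<v (ℕ.n≤1+n t)) ⟩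
    w + (v + suc t)   ≡⟨ ℕ.+-assoc w v (suc t) ⟨
    w + v + suc t     ≡⟨ cong (_+ suc t) (ℕ.+-comm w v) ⟩
    v + w + suc t     ≡⟨ ℕ.+-assoc v w (suc t) ⟩
    v + (w + suc t)   ∎)
    where open ℕ.≤-Reasoning

  near-cw : ∀ {t v w} k → v + suc t ≡ N → w ≡ v + k → N ℕ.≤ w + suc t
  near-cw {t} {v} k e refl = subst (ℕ._≤ v + k + suc t) e (ℕ.+-monoˡ-≤ (suc t) (ℕ.m≤m+n v k))

  far-cw : ∀ {t v w k} → v + suc t ≡ N → k ℕ.≤ suc (t + t) → w + N ≡ v + k → w ℕ.< suc t
  far-cw {t} {v} {w} {k} e k≤ f = s≤s (ℕ.+-cancelˡ-≤ (v + suc t) _ _ (begin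
    v + suc t + w     ≡⟨ cong (_+ w) e ⟩
    N + w             ≡⟨ ℕ.+-comm N w ⟩
    w + N             ≡⟨ f ⟩
    v + k             ≤⟨ ℕ.+-monoʳ-≤ v k≤ ⟩
    v + (suc t + t)   ≡⟨ ℕ.+-assoc v (suc t) t ⟨
    v + suc t + t     ∎))
    where open ℕ.≤-Reasoning

AST-step-invariant : ∀ n A i σ → ASTInvariant.Invariant {n} A (toℕ i) σ →
                     ASTInvariant.Invariant {n} A (suc (toℕ i)) (AST-step n A σ i)
AST-step-invariant n@(suc _) A i σ I with Fin.any? (arc? A i)
... | yes (j , a) = extend counterclockwise-walk (vertex j) (enough-room i) I
        (vertex-new a)
        (near-ccw {w = vertex j} 0 refl a (ℕ.+-identityʳ _))
        λ { k w k≤ (inj₁ p) → near-ccw {w = w} k refl a p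
          ; k w k≤ (inj₂ p) → inj₁ (far-ccw (subst (toℕ i ℕ.<_) (sym (toℕ-vertex j)) (arc-< A a)) k≤ p) }
  where open ASTInvariant {n} A
... | no _ = extend clockwise-walk (barred i) (enough-room i) I
        (barred-new i)
        (inj₁ (ℕ.≤-reflexive (sym (toℕ-barred i))))
        λ { k w k≤ (inj₁ p) → inj₁ (near-cw k (toℕ-barred i) p)
          ; k w k≤ (inj₂ p) → inj₂ (inj₁ (far-cw {v = toℕ (barred i)} (toℕ-barred i) k≤ p)) }
  where open ASTInvariant {n} A

good-full : ∀ {n} {σ : PartialMatching (n + n)} → Good σ n → ∀ x → σ x ≢ x
good-full {n} {σ} G x e = ℕ.1+n≰n (subst₂ ℕ._≤_ (cong suc count) (List.length-tabulate {n = n + n} id)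
  (unique-⊆⇒length-≤ {ys = allFin (n + n)}
    (All.tabulate (λ {y} y∈ x≡y → sound y∈ (subst (λ z → σ z ≡ z) x≡y e)) ∷ distinct)
    (λ {y} _ → ∈-allFin y)))
  where open Good G

AST : ∀ n → 𝒜 (𝐀 (n ∸ 1)) → 𝒩 n
AST n A = record
  { partner     = AST-result n A
  ; involutive  = Good.invol G
  ; no-fixed    = good-full G
  ; noncrossing = Good.uncrossed G
  }
  where
  open ASTInvariant {n} A using (Invariant)
  G : Good (AST-result n A) n
  G = Invariant.good (foldl-invariant Invariant (AST-step n A)
    (record { good = good-empty ; region = λ x≢x → contradiction refl x≢x })
    (AST-step-invariant n A))

data Step : Set where
  𝚞 𝚍 : Step

_≟ˢ_ : DecidableEquality Step
𝚞 ≟ˢ 𝚞 = yes refl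
𝚞 ≟ˢ 𝚍 = no λ ()
𝚍 ≟ˢ 𝚞 = no λ ()
𝚍 ≟ˢ 𝚍 = yes refl

# : Step → List Step → ℕ
# s w = length (filter (_≟ˢ s) w)

Ballot : List Step → Set
Ballot w = ∀ k → # 𝚍 (take k w) ℕ.≤ # 𝚞 (take k w)

record 𝒟 (n : ℕ) : Set where
  field
    word   : Vec Step (n + n)
    ups    : # 𝚞 (toList word) ≡ n
    downs  : # 𝚍 (toList word) ≡ n
    ballot : Ballot (toList word)

open 𝒟 public

between : ∀ {N} → Vec Step N → Fin N → Fin N → List Step
between w x y = take (toℕ y ∸ suc (toℕ x)) (drop (suc (toℕ x)) (toList w))

-- An opening and a closing parenthesis are matched when what they enclose is balanced.
record Tunnel {n} (D : 𝒟 n) (x y : Fin (n + n)) : Set where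
  field
    ordered  : x < y
    opening  : Vec.lookup (word D) x ≡ 𝚞
    closing  : Vec.lookup (word D) y ≡ 𝚍
    balanced : # 𝚞 (between (word D) x y) ≡ # 𝚍 (between (word D) x y)
    nonneg   : Ballot (between (word D) x y)

Matched : ∀ {n} → 𝒟 n → Fin (n + n) → Fin (n + n) → Set
Matched D x y = Tunnel D x y ⊎ Tunnel D y x

#-++ : ∀ s xs ys → # s (xs ++ ys) ≡ # s xs + # s ys
#-++ s xs ys = trans (cong length (List.filter-++ (_≟ˢ s) xs ys))
                     (List.length-++ (filter (_≟ˢ s) xs))

take-+ : ∀ {A : Set} a b (xs : List A) → take (a + b) xs ≡ take a xs ++ take b (drop a xs)
take-+ zero    b xs       = refl
take-+ (suc a) b []       = sym (List.take-[] b)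
take-+ (suc a) b (x ∷ xs) = cong (x ∷_) (take-+ a b xs)

take-suc-toList : ∀ {A : Set} {N} (v : Vec A N) x →
  take (suc (toℕ x)) (toList v) ≡ take (toℕ x) (toList v) ++ Vec.lookup v x ∷ []
take-suc-toList (a ∷ v) zero    = refl
take-suc-toList (a ∷ v) (suc x) = cong (a ∷_) (take-suc-toList v x)

module Heights {n} (D : 𝒟 n) where

  private
    N = n + n
    w = toList (word D)

  at : Fin N → Step
  at = Vec.lookup (word D)

  height : ℕ → ℕ
  height k = # 𝚞 (take k w) ∸ # 𝚍 (take k w)

  height-# : ∀ k → # 𝚞 (take k w) ≡ height k + # 𝚍 (take k w)
  height-# k = sym (ℕ.m∸n+n≡m (ballot D k))

  height-end : height N ≡ 0
  height-end = trans (cong (λ v → # 𝚞 v ∸ # 𝚍 v) (List.take-all N w (ℕ.≤-reflexive (Vec.length-toList (word D)))))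
    (trans (cong₂ _∸_ (ups D) (downs D)) (ℕ.n∸n≡0 n))

  #-suc : ∀ s x → # s (take (suc (toℕ x)) w) ≡ # s (take (toℕ x) w) + # s (at x ∷ [])
  #-suc s x = trans (cong (# s) (take-suc-toList (word D) x)) (#-++ s (take (toℕ x) w) _)

  height-up : ∀ x → at x ≡ 𝚞 → height (suc (toℕ x)) ≡ suc (height (toℕ x))
  height-up x e = ℕ.+-cancelʳ-≡ (# 𝚍 (take (toℕ x) w)) _ _ (begin
    height (suc (toℕ x)) + # 𝚍 (take (toℕ x) w)       ≡⟨ cong (height (suc (toℕ x)) +_) same ⟨
    height (suc (toℕ x)) + # 𝚍 (take (suc (toℕ x)) w) ≡⟨ height-# (suc (toℕ x)) ⟨
    # 𝚞 (take (suc (toℕ x)) w)                        ≡⟨ #-suc 𝚞 x ⟩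
    # 𝚞 (take (toℕ x) w) + # 𝚞 (at x ∷ [])            ≡⟨ cong (λ s → # 𝚞 (take (toℕ x) w) + # 𝚞 (s ∷ [])) e ⟩
    # 𝚞 (take (toℕ x) w) + 1                          ≡⟨ ℕ.+-comm _ 1 ⟩
    suc (# 𝚞 (take (toℕ x) w))                        ≡⟨ cong suc (height-# (toℕ x)) ⟩
    suc (height (toℕ x)) + # 𝚍 (take (toℕ x) w)       ∎)
    where
    open ≡-Reasoning
    same : # 𝚍 (take (suc (toℕ x)) w) ≡ # 𝚍 (take (toℕ x) w)
    same = trans (#-suc 𝚍 x) (trans (cong (λ s → # 𝚍 (take (toℕ x) w) + # 𝚍 (s ∷ [])) e) (ℕ.+-identityʳ _))

  height-down : ∀ x → at x ≡ 𝚍 → height (toℕ x) ≡ suc (height (suc (toℕ x)))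
  height-down x e = ℕ.+-cancelʳ-≡ (# 𝚍 (take (toℕ x) w)) _ _ (begin
    height (toℕ x) + # 𝚍 (take (toℕ x) w)             ≡⟨ height-# (toℕ x) ⟨
    # 𝚞 (take (toℕ x) w)                              ≡⟨ ℕ.+-identityʳ _ ⟨
    # 𝚞 (take (toℕ x) w) + 0                          ≡⟨ cong (λ s → # 𝚞 (take (toℕ x) w) + # 𝚞 (s ∷ [])) e ⟨
    # 𝚞 (take (toℕ x) w) + # 𝚞 (at x ∷ [])            ≡⟨ #-suc 𝚞 x ⟨
    # 𝚞 (take (suc (toℕ x)) w)                        ≡⟨ height-# (suc (toℕ x)) ⟩
    height (suc (toℕ x)) + # 𝚍 (take (suc (toℕ x)) w) ≡⟨ cong (height (suc (toℕ x)) +_) next ⟩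
    height (suc (toℕ x)) + suc (# 𝚍 (take (toℕ x) w)) ≡⟨ ℕ.+-suc _ _ ⟩
    suc (height (suc (toℕ x))) + # 𝚍 (take (toℕ x) w) ∎)
    where
    open ≡-Reasoning
    next : # 𝚍 (take (suc (toℕ x)) w) ≡ suc (# 𝚍 (take (toℕ x) w))
    next = trans (#-suc 𝚍 x) (trans (cong (λ s → # 𝚍 (take (toℕ x) w) + # 𝚍 (s ∷ [])) e) (ℕ.+-comm _ 1))

  segment : ∀ a c → # 𝚞 (take c (drop a w)) + height a ≡ height (a + c) + # 𝚍 (take c (drop a w))
  segment a c = ℕ.+-cancelʳ-≡ (# 𝚍 (take a w)) _ _ (begin
    # 𝚞 seg + height a + # 𝚍 (take a w)   ≡⟨ ℕ.+-assoc (# 𝚞 seg) _ _ ⟩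
    # 𝚞 seg + (height a + # 𝚍 (take a w)) ≡⟨ cong (# 𝚞 seg +_) (height-# a) ⟨
    # 𝚞 seg + # 𝚞 (take a w)              ≡⟨ ℕ.+-comm (# 𝚞 seg) _ ⟩
    # 𝚞 (take a w) + # 𝚞 seg              ≡⟨ total 𝚞 ⟨
    # 𝚞 (take (a + c) w)                  ≡⟨ height-# (a + c) ⟩
    height (a + c) + # 𝚍 (take (a + c) w) ≡⟨ cong (height (a + c) +_) (trans (total 𝚍) (ℕ.+-comm (# 𝚍 (take a w)) _)) ⟩
    height (a + c) + (# 𝚍 seg + # 𝚍 (take a w)) ≡⟨ ℕ.+-assoc (height (a + c)) _ _ ⟨
    height (a + c) + # 𝚍 seg + # 𝚍 (take a w) ∎)
    where
    open ≡-Reasoning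
    seg = take c (drop a w)
    total : ∀ s → # s (take (a + c) w) ≡ # s (take a w) + # s seg
    total s = trans (cong (# s) (take-+ a c w)) (#-++ s (take a w) seg)

  record SameLevel (x y : Fin N) : Set where
    field
      before : x < y
      up     : at x ≡ 𝚞
      down   : at y ≡ 𝚍
      level  : height (toℕ y) ≡ height (suc (toℕ x))
      above  : ∀ k → toℕ x ℕ.< k → k ℕ.≤ toℕ y → height (suc (toℕ x)) ℕ.≤ height k

  tunnel⇒level : ∀ {x y} → Tunnel D x y → SameLevel x y
  tunnel⇒level {x} {y} T = record
    { before = ordered ; up = opening ; down = closing
    ; level = ℕ.+-cancelʳ-≡ (# 𝚍 seg) _ _ (begin
        height (toℕ y) + # 𝚍 seg       ≡⟨ cong (λ k → height k + # 𝚍 seg) (ℕ.m+[n∸m]≡n ordered) ⟨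
        height (a + c) + # 𝚍 seg       ≡⟨ segment a c ⟨
        # 𝚞 seg + height a             ≡⟨ ℕ.+-comm (# 𝚞 seg) (height a) ⟩
        height a + # 𝚞 seg             ≡⟨ cong (height a +_) balanced ⟩
        height a + # 𝚍 seg             ∎)
    ; above = above′ }
    where
    open Tunnel T
    open ≡-Reasoning
    a = suc (toℕ x)
    c = toℕ y ∸ suc (toℕ x)
    seg = take c (drop a w)
    above′ : ∀ k → a ℕ.≤ k → k ℕ.≤ toℕ y → height a ℕ.≤ height k
    above′ k a≤k k≤y = ℕ.+-cancelʳ-≤ (# 𝚍 sub) _ _
      (ℕ.≤-trans (ℕ.+-monoʳ-≤ (height a) sub-ballot)
        (ℕ.≤-reflexive (trans (ℕ.+-comm (height a) (# 𝚞 sub))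
          (trans (segment a b) (cong (λ k → height k + # 𝚍 sub) (ℕ.m+[n∸m]≡n a≤k))))))
      where
      b = k ∸ a
      sub = take b (drop a w)
      sub-ballot : # 𝚍 sub ℕ.≤ # 𝚞 sub
      sub-ballot = subst (λ v → # 𝚍 v ℕ.≤ # 𝚞 v)
        (trans (List.take-take b c (drop a w)) (cong (λ t → take t (drop a w)) (ℕ.m≤n⇒m⊓n≡m (ℕ.∸-monoˡ-≤ a k≤y))))
        (nonneg b)

  level⇒tunnel : ∀ {x y} → SameLevel x y → Tunnel D x y
  level⇒tunnel {x} {y} T = record
    { ordered = before ; opening = up ; closing = down
    ; balanced = ℕ.+-cancelʳ-≡ (height a) _ _ (begin
        # 𝚞 seg + height a       ≡⟨ segment a c ⟩
        height (a + c) + # 𝚍 seg ≡⟨ cong (λ k → height k + # 𝚍 seg) (ℕ.m+[n∸m]≡n before) ⟩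
        height (toℕ y) + # 𝚍 seg ≡⟨ cong (_+ # 𝚍 seg) level ⟩
        height a + # 𝚍 seg       ≡⟨ ℕ.+-comm (height a) _ ⟩
        # 𝚍 seg + height a       ∎)
    ; nonneg = λ k → subst (λ v → # 𝚍 v ℕ.≤ # 𝚞 v) (sym (List.take-take k c (drop a w)))
        (sub-ballot (k ℕ.⊓ c) (ℕ.m⊓n≤n k c)) }
    where
    open SameLevel T
    open ≡-Reasoning
    a = suc (toℕ x)
    c = toℕ y ∸ suc (toℕ x)
    seg = take c (drop a w)
    sub-ballot : ∀ b → b ℕ.≤ c → # 𝚍 (take b (drop a w)) ℕ.≤ # 𝚞 (take b (drop a w))
    sub-ballot b b≤c = ℕ.+-cancelʳ-≤ (height a) _ _
      (ℕ.≤-trans (ℕ.+-monoʳ-≤ (# 𝚍 sub) (above (a + b) (ℕ.m≤m+n a b)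
          (ℕ.≤-trans (ℕ.+-monoʳ-≤ a b≤c) (ℕ.≤-reflexive (ℕ.m+[n∸m]≡n before)))))
        (ℕ.≤-reflexive (trans (ℕ.+-comm (# 𝚍 sub) _) (sym (segment a b)))))
      where sub = take b (drop a w)

  closing-of : ∀ x → at x ≡ 𝚞 → ∃ λ y → SameLevel x y
  closing-of x ux = go (N ∸ a) a (ℕ.m+[n∸m]≡n (Fin.toℕ<n x)) ℕ.≤-refl
                      (λ j p q → ℕ.≤-reflexive (cong height (ℕ.≤-antisym p q)))
    where
    a = suc (toℕ x)
    go : ∀ fuel k → k + fuel ≡ N → a ℕ.≤ k →
         (∀ j → a ℕ.≤ j → j ℕ.≤ k → height a ℕ.≤ height j) → ∃ λ y → SameLevel x y
    go zero k e a≤k ab = contradiction (ℕ.≤-trans (ℕ.≤-reflexive (sym (height-up x ux)))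
      (ℕ.≤-trans (ab k a≤k ℕ.≤-refl)
        (ℕ.≤-reflexive (trans (cong height (trans (sym (ℕ.+-identityʳ k)) e)) height-end)))) λ ()
    go (suc fuel) k e a≤k ab = letter (at y) refl
      where
      k<N : k ℕ.< N
      k<N = subst (suc k ℕ.≤_) e (ℕ.≤-trans (s≤s (ℕ.m≤m+n k fuel)) (ℕ.≤-reflexive (sym (ℕ.+-suc k fuel))))
      y = fromℕ< k<N
      y≡ : toℕ y ≡ k
      y≡ = Fin.toℕ-fromℕ< k<N
      continue : height a ℕ.≤ height (suc k) → ∃ λ y → SameLevel x y
      continue p = go fuel (suc k) (trans (sym (ℕ.+-suc k fuel)) e) (ℕ.m≤n⇒m≤1+n a≤k) ab′
        where
        ab′ : ∀ j → a ℕ.≤ j → j ℕ.≤ suc k → height a ℕ.≤ height j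
        ab′ j a≤j j≤ with ℕ.m≤n⇒m<n∨m≡n j≤
        ... | inj₁ j< = ab j a≤j (ℕ.≤-pred j<)
        ... | inj₂ refl = p
      letter : ∀ s → at y ≡ s → ∃ λ y → SameLevel x y
      letter 𝚞 e′ = continue (ℕ.≤-trans (ab k a≤k ℕ.≤-refl)
        (subst (λ t → height t ℕ.≤ height (suc t)) y≡
          (ℕ.≤-trans (ℕ.n≤1+n _) (ℕ.≤-reflexive (sym (height-up y e′))))))
      letter 𝚍 e′ with height k ℕ.≟ height a
      ... | yes h = y , record { before = subst (toℕ x ℕ.<_) (sym y≡) a≤k ; up = ux ; down = e′
                               ; level = trans (cong height y≡) h
                               ; above = λ j p q → ab j p (subst (j ℕ.≤_) y≡ q) }
      ... | no h = continue (ℕ.≤-pred (subst (suc (height a) ℕ.≤_)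
                     (subst (λ t → height t ≡ suc (height (suc t))) y≡ (height-down y e′))
                     (ℕ.≤∧≢⇒< (ab k a≤k ℕ.≤-refl) (h ∘ sym))))

  opening-of : ∀ y → at y ≡ 𝚍 → ∃ λ x → SameLevel x y
  opening-of y dy = go b ℕ.≤-refl (λ j p q → ℕ.≤-reflexive (cong height (ℕ.≤-antisym p q)))
    where
    b = toℕ y
    go : ∀ k → k ℕ.≤ b → (∀ j → k ℕ.≤ j → j ℕ.≤ b → height b ℕ.≤ height j) → ∃ λ x → SameLevel x y
    go zero k≤b ab = contradiction (ℕ.≤-trans (ℕ.≤-reflexive (sym (height-down y dy))) (ab 0 z≤n z≤n)) λ ()
    go (suc k) k<b ab = letter (at x) refl
      where
      k<N = ℕ.<-trans k<b (Fin.toℕ<n y)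
      x = fromℕ< k<N
      x≡ : toℕ x ≡ k
      x≡ = Fin.toℕ-fromℕ< k<N
      continue : height b ℕ.≤ height k → ∃ λ x → SameLevel x y
      continue p = go k (ℕ.<⇒≤ k<b) ab′
        where
        ab′ : ∀ j → k ℕ.≤ j → j ℕ.≤ b → height b ℕ.≤ height j
        ab′ j k≤j j≤b with ℕ.m≤n⇒m<n∨m≡n k≤j
        ... | inj₁ k<j = ab j k<j j≤b
        ... | inj₂ refl = p
      letter : ∀ s → at x ≡ s → ∃ λ x → SameLevel x y
      letter 𝚍 e′ = continue (ℕ.≤-trans (ab (suc k) ℕ.≤-refl k<b)
        (subst (λ t → height (suc t) ℕ.≤ height t) x≡
          (ℕ.≤-trans (ℕ.n≤1+n _) (ℕ.≤-reflexive (sym (height-down x e′))))))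
      letter 𝚞 e′ with height (suc k) ℕ.≟ height b
      ... | yes h = x , record { before = subst (ℕ._< b) (sym x≡) k<b ; up = e′ ; down = dy
                               ; level = trans (sym h) (cong (height ∘ suc) (sym x≡))
                               ; above = λ j p q → subst (ℕ._≤ height j)
                                   (trans (sym h) (cong (height ∘ suc) (sym x≡)))
                                   (ab j (subst (ℕ._< j) x≡ p) q) }
      ... | no h = continue (ℕ.≤-pred (subst (suc (height b) ℕ.≤_)
                     (subst (λ t → height (suc t) ≡ suc (height t)) x≡ (height-up x e′))
                     (ℕ.≤∧≢⇒< (ab (suc k) ℕ.≤-refl k<b) (h ∘ sym))))

  open SameLevel

  no-later-closing : ∀ {x y y′} → SameLevel x y → SameLevel x y′ → ¬ y < y′
  no-later-closing {x} {y} {y′} T T′ y<y′ = ℕ.1+n≰n (ℕ.≤-trans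
    (ℕ.≤-reflexive (trans (sym (height-down y (down T))) (level T)))
    (above T′ (suc (toℕ y)) (ℕ.m<n⇒m<1+n (before T)) y<y′))

  no-later-opening : ∀ {x x′ y} → SameLevel x y → SameLevel x′ y → ¬ x < x′
  no-later-opening {x} {x′} {y} T T′ x<x′ = ℕ.1+n≰n (ℕ.≤-trans
    (ℕ.≤-reflexive (trans (sym (height-up x′ (up T′))) (trans (sym (level T′)) (level T))))
    (above T (toℕ x′) x<x′ (ℕ.<⇒≤ (before T′))))

  closing-unique : ∀ {x y y′} → SameLevel x y → SameLevel x y′ → y ≡ y′
  closing-unique {y = y} {y′} T T′ with Fin.<-cmp y y′
  ... | tri< lt _ _ = contradiction lt (no-later-closing T T′)
  ... | tri≈ _ e _ = e
  ... | tri> _ _ gt = contradiction gt (no-later-closing T′ T)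

  opening-unique : ∀ {x x′ y} → SameLevel x y → SameLevel x′ y → x ≡ x′
  opening-unique {x} {x′} T T′ with Fin.<-cmp x x′
  ... | tri< lt _ _ = contradiction lt (no-later-opening T T′)
  ... | tri≈ _ e _ = e
  ... | tri> _ _ gt = contradiction gt (no-later-opening T′ T)

  levels-uncrossed : ∀ {i j k l} → i < j → j < k → k < l → SameLevel i k → ¬ SameLevel j l
  levels-uncrossed {i} {j} {k} i<j j<k k<l S T = ℕ.<-irrefl refl (begin-strict
    height (suc (toℕ i))       ≤⟨ above S (toℕ j) i<j (ℕ.<⇒≤ j<k) ⟩
    height (toℕ j)             <⟨ ℕ.n<1+n _ ⟩
    suc (height (toℕ j))       ≡⟨ height-up j (up T) ⟨
    height (suc (toℕ j))       ≤⟨ above T (suc (toℕ k)) (ℕ.m<n⇒m<1+n j<k) k<l ⟩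
    height (suc (toℕ k))       <⟨ ℕ.n<1+n _ ⟩
    suc (height (suc (toℕ k))) ≡⟨ height-down k (down S) ⟨
    height (toℕ k)             ≡⟨ level S ⟩
    height (suc (toℕ i))       ∎)
    where open ℕ.≤-Reasoning

  u≢d : ∀ {s : Step} → s ≡ 𝚞 → ¬ s ≡ 𝚍
  u≢d refl ()

matched-exists : ∀ {n} (D : 𝒟 n) x → ∃ λ y → Matched D x y
matched-exists D x = letter (at x) refl
  where
  open Heights D
  letter : ∀ s → at x ≡ s → ∃ λ y → Matched D x y
  letter 𝚞 e = let (y , T) = closing-of x e in y , inj₁ (level⇒tunnel T)
  letter 𝚍 e = let (y , T) = opening-of x e in y , inj₂ (level⇒tunnel T)

matched-unique : ∀ {n} (D : 𝒟 n) {x y y′} → Matched D x y → Matched D x y′ → y ≡ y′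
matched-unique D = cases
  where
  open Heights D
  open Tunnel
  cases : ∀ {x y y′} → Matched D x y → Matched D x y′ → y ≡ y′
  cases (inj₁ S) (inj₁ T) = closing-unique (tunnel⇒level S) (tunnel⇒level T)
  cases (inj₂ S) (inj₂ T) = opening-unique (tunnel⇒level S) (tunnel⇒level T)
  cases (inj₁ S) (inj₂ T) = contradiction (closing T) (u≢d (opening S))
  cases (inj₂ S) (inj₁ T) = contradiction (closing S) (u≢d (opening T))

-- Match D is determined by Match-tunnel below: x and y are partners iff they form a tunnel.
Match : ∀ {n} → 𝒟 n → 𝒩 n
Match {n} D = record
  { partner     = partner′
  ; involutive  = λ x → matched-unique D (matched (partner′ x)) (Sum.swap (matched x))
  ; no-fixed    = λ x e → irreflexive (subst (Matched D x) e (matched x))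
  ; noncrossing = λ { {i} {j} i<j j<k k<l (e , f) →
      levels-uncrossed i<j j<k k<l
        (ascending (ℕ.<-trans i<j j<k) (subst (Matched D i) e (matched i)))
        (ascending (ℕ.<-trans j<k k<l) (subst (Matched D j) f (matched j))) }
  }
  where
  open Heights D
  partner′ : Fin (n + n) → Fin (n + n)
  partner′ x = proj₁ (matched-exists D x)
  matched : ∀ x → Matched D x (partner′ x)
  matched x = proj₂ (matched-exists D x)
  irreflexive : ∀ {x} → ¬ Matched D x x
  irreflexive (inj₁ T) = ℕ.<-irrefl refl (Tunnel.ordered T)
  irreflexive (inj₂ T) = ℕ.<-irrefl refl (Tunnel.ordered T)
  ascending : ∀ {x y} → x < y → Matched D x y → SameLevel x y
  ascending _ (inj₁ T) = tunnel⇒level T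
  ascending x<y (inj₂ T) = contradiction (Tunnel.ordered T) (ℕ.<-asym x<y)

Match-tunnel : ∀ {n} (D : 𝒟 n) x y → partner (Match D) x ≡ y ⇔ Matched D x y
Match-tunnel D x y = mk⇔
  (λ { refl → proj₂ (matched-exists D x) })
  (λ m → matched-unique D (proj₂ (matched-exists D x)) m)

-- insertRow x row is the new row together with the entry bumped out of it, if any.
insertRow : ∀ {n} → Fin n → List (Fin n) → List (Fin n) × Maybe (Fin n)
insertRow x [] = [ x ] , nothing
insertRow x (y ∷ ys) with x Fin.<? y
... | yes _ = x ∷ ys , just y
... | no _  = let (ys′ , bumped) = insertRow x ys in y ∷ ys′ , bumped

-- The list of pairs of corresponding rows of P and Q.
Tableaux : ℕ → Set
Tableaux n = List (List (Fin n) × List (Fin n))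

insert : ∀ {n} → Fin n → Fin n → Tableaux n → Tableaux n
insert t x [] = [ [ x ] , [ t ] ]
insert t x ((p , q) ∷ rows) with insertRow x p
... | p′ , nothing = (p′ , q ++ [ t ]) ∷ rows
... | p′ , just y  = (p′ , q) ∷ insert t y rows

insertAll : ∀ {n} → Permutation′ n → Tableaux n
insertAll {n} π = foldl (λ rows t → insert t (π ⟨$⟩ʳ t) rows) [] (allFin n)

RSK : ∀ {n} → Permutation′ n → List (List (Fin n)) × List (List (Fin n))
RSK π = map proj₁ (insertAll π) , map proj₂ (insertAll π)

topRow : ∀ {n} → List (List (Fin n)) → List (Fin n)
topRow []        = []
topRow (row ∷ _) = row

_∈?ˡ_ : ∀ {n} (i : Fin n) (row : List (Fin n)) → Dec (i ∈ˡ row)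
_∈?ˡ_ {n} = DecMembership._∈?_ (Fin._≟_ {n})

stepP stepQ : ∀ {n} → Permutation′ n → Fin n → Step
stepP π i = if does (i ∈?ˡ topRow (proj₁ (RSK π))) then 𝚞 else 𝚍
stepQ π i = if does (i ∈?ˡ topRow (proj₂ (RSK π))) then 𝚍 else 𝚞

-- The k-th step of the second half is the (2n + 1 − i)-th step for i = n + 1 − k.
RSK-word : ∀ {n} → Permutation′ n → Vec Step (n + n)
RSK-word π = Vec.tabulate (stepP π) Vec.++ Vec.tabulate (stepQ π ∘ opposite)

unique-map : ∀ {A B : Set} {f : A → B} {xs} →
  (∀ {x y} → x ∈ˡ xs → y ∈ˡ xs → f x ≡ f y → x ≡ y) → Unique xs → Unique (map f xs)
unique-map inj [] = []
unique-map {f = f} inj (x∉ ∷ uniq) =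
  All.tabulate (λ y∈ fx≡y → let (z , z∈ , y≡) = ∈-map⁻ f y∈ in
    All.lookup x∉ z∈ (inj (here refl) (there z∈) (trans fx≡y y≡)))
  ∷ unique-map (λ x∈ y∈ → inj (there x∈) (there y∈)) uniq

injection⇒length-≤ : ∀ {A B : Set} (f : A → B) {xs ys} → Unique xs →
  (∀ {x y} → x ∈ˡ xs → y ∈ˡ xs → f x ≡ f y → x ≡ y) → (∀ {x} → x ∈ˡ xs → f x ∈ˡ ys) →
  length xs ℕ.≤ length ys
injection⇒length-≤ f {xs} {ys} uniq inj f∈ = subst (ℕ._≤ length ys) (List.length-map f xs)
  (unique-⊆⇒length-≤ (unique-map inj uniq)
    (λ y∈ → let (x , x∈ , y≡) = ∈-map⁻ f y∈ in subst (_∈ˡ ys) (sym y≡) (f∈ x∈)))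

pre : ∀ {n} → (Fin n → Step) → ℕ → List Step
pre f k = take k (tabulate f)

below : ∀ n → ℕ → List (Fin n)
below n k = take k (allFin n)

∈-below⁻ : ∀ {m n} (f : Fin m → Fin n) o k → (∀ i → toℕ (f i) ≡ o + toℕ i) →
           ∀ {i} → i ∈ˡ take k (tabulate f) → toℕ i ℕ.< o + k
∈-below⁻ {suc m} f o (suc k) f≡ (here refl) =
  subst₂ ℕ._<_ (sym (f≡ zero)) refl (ℕ.+-monoʳ-< o (s≤s z≤n))
∈-below⁻ {suc m} f o (suc k) f≡ {i} (there i∈) = subst (toℕ i ℕ.<_) (sym (ℕ.+-suc o k))
  (∈-below⁻ (f ∘ suc) (suc o) k (λ j → trans (f≡ (suc j)) (ℕ.+-suc o (toℕ j))) i∈)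

∈-below⁺ : ∀ {m} {A : Set} (f : Fin m → A) k i → toℕ i ℕ.< k → f i ∈ˡ take k (tabulate f)
∈-below⁺ f (suc k) zero    _         = here refl
∈-below⁺ f (suc k) (suc i) (s≤s i<k) = there (∈-below⁺ (f ∘ suc) k i i<k)

#-map : ∀ {A : Set} s (f : A → Step) xs → # s (map f xs) ≡ length (filter (λ x → f x ≟ˢ s) xs)
#-map s f [] = refl
#-map s f (x ∷ xs) with f x ≟ˢ s
... | yes _ = cong suc (#-map s f xs)
... | no _  = #-map s f xs

#-pre : ∀ {n} s (f : Fin n → Step) k → # s (pre f k) ≡ length (filter (λ i → f i ≟ˢ s) (below n k))
#-pre {n} s f k = trans (cong (# s) (trans (cong (take k) (sym (List.map-tabulate id f)))
  (List.take-map k (allFin n)))) (#-map s f (below n k))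

injection⇒ballot : ∀ {n} (f : Fin n → Step) (φ : Fin n → Fin n) →
  (∀ {i} → f i ≡ 𝚍 → f (φ i) ≡ 𝚞) → (∀ {i} → f i ≡ 𝚍 → φ i < i) →
  (∀ {i j} → f i ≡ 𝚍 → f j ≡ 𝚍 → φ i ≡ φ j → i ≡ j) → Ballot (tabulate f)
injection⇒ballot {n} f φ φ∈ φ< φ-inj k = subst₂ ℕ._≤_ (sym (#-pre 𝚍 f k)) (sym (#-pre 𝚞 f k))
  (injection⇒length-≤ φ (Unique.filter⁺ is𝚍 (Unique.take⁺ k (Unique.allFin⁺ n)))
    (λ x∈ y∈ → φ-inj (proj₂ (∈-filter⁻ is𝚍 {xs = below n k} x∈)) (proj₂ (∈-filter⁻ is𝚍 {xs = below n k} y∈)))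
    (λ {x} x∈ → let (x∈′ , e) = ∈-filter⁻ is𝚍 x∈ in
      ∈-filter⁺ (λ i → f i ≟ˢ 𝚞)
        (∈-below⁺ id k (φ x) (ℕ.<-trans (φ< e) (∈-below⁻ id 0 k (λ _ → refl) x∈′))) (φ∈ e)))
  where
  is𝚍 : Decidable (λ i → f i ≡ 𝚍)
  is𝚍 i = f i ≟ˢ 𝚍

pre-cong : ∀ {n} {f g : Fin n → Step} k → (∀ i → toℕ i ℕ.< k → f i ≡ g i) → pre f k ≡ pre g k
pre-cong zero h = refl
pre-cong {zero}  (suc k) h = refl
pre-cong {suc n} (suc k) h = cong₂ _∷_ (h zero (s≤s z≤n)) (pre-cong k (λ i i<k → h (suc i) (s≤s i<k)))

#-pre-suc : ∀ {n} s (f : Fin n → Step) i →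
            # s (pre f (suc (toℕ i))) ≡ # s (pre f (toℕ i)) + # s [ f i ]
#-pre-suc s f i = trans (cong (# s) (List.take-suc-tabulate f i)) (#-++ s (pre f (toℕ i)) _)

#-total : ∀ w → # 𝚞 w + # 𝚍 w ≡ length w
#-total [] = refl
#-total (𝚞 ∷ w) = cong suc (#-total w)
#-total (𝚍 ∷ w) = trans (ℕ.+-suc _ _) (cong suc (#-total w))

pre-full : ∀ {n} (f : Fin n → Step) {k} → n ℕ.≤ k → pre f k ≡ tabulate f
pre-full {n} f {k} n≤k = List.take-all k _ (subst (ℕ._≤ k) (sym (List.length-tabulate f)) n≤k)

length-pre : ∀ {n} (f : Fin n → Step) {k} → k ℕ.≤ n → length (pre f k) ≡ k
length-pre f {k} k≤n = trans (List.length-take k _)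
  (trans (cong (k ℕ.⊓_) (List.length-tabulate f)) (ℕ.m≤n⇒m⊓n≡m k≤n))

#-opposite : ∀ {n} s (g : Fin n → Step) k → k ℕ.≤ n →
             # s (pre (g ∘ opposite) k) + # s (pre g (n ∸ k)) ≡ # s (tabulate g)
#-opposite s g zero _ = cong (# s) (pre-full g ℕ.≤-refl)
#-opposite {n} s g (suc k) k<n = begin
  # s (pre g′ (suc k)) + # s (pre g (n ∸ suc k))
    ≡⟨ cong (λ t → # s (pre g′ (suc t)) + # s (pre g (n ∸ suc t))) i≡ ⟨
  # s (pre g′ (suc (toℕ i))) + # s (pre g (n ∸ suc (toℕ i)))
    ≡⟨ cong₂ _+_ (#-pre-suc s g′ i) (cong (# s ∘ pre g) (sym (Fin.opposite-prop i))) ⟩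
  # s (pre g′ (toℕ i)) + # s [ g (opposite i) ] + # s (pre g (toℕ (opposite i)))
    ≡⟨ shuffle (# s (pre g′ (toℕ i))) _ _ ⟩
  # s (pre g′ (toℕ i)) + (# s (pre g (toℕ (opposite i))) + # s [ g (opposite i) ])
    ≡⟨ cong (# s (pre g′ (toℕ i)) +_) (#-pre-suc s g (opposite i)) ⟨
  # s (pre g′ (toℕ i)) + # s (pre g (suc (toℕ (opposite i))))
    ≡⟨ cong₂ (λ a b → # s (pre g′ a) + # s (pre g b)) i≡ next ⟩
  # s (pre g′ k) + # s (pre g (n ∸ k))
    ≡⟨ #-opposite s g k (ℕ.<⇒≤ k<n) ⟩
  # s (tabulate g) ∎
  where
  open ≡-Reasoning
  g′ = g ∘ opposite
  i = fromℕ< k<n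
  i≡ : toℕ i ≡ k
  i≡ = Fin.toℕ-fromℕ< k<n
  next : suc (toℕ (opposite i)) ≡ n ∸ k
  next = trans (cong suc (trans (Fin.opposite-prop i) (cong (λ t → n ∸ suc t) i≡)))
               (sym (ℕ.+-∸-assoc 1 k<n))
  shuffle : ∀ a b c → a + b + c ≡ a + (c + b)
  shuffle = solve-∀

take-++ : ∀ {A : Set} k (xs ys : List A) → take k (xs ++ ys) ≡ take k xs ++ take (k ∸ length xs) ys
take-++ k       []       ys = cong (_++ take k ys) (sym (List.take-[] k))
take-++ zero    (x ∷ xs) ys = refl
take-++ (suc k) (x ∷ xs) ys = cong (x ∷_) (take-++ k xs ys)

flip : Step → Step
flip 𝚞 = 𝚍
flip 𝚍 = 𝚞

#-map-flip : ∀ w → # 𝚞 (map flip w) ≡ # 𝚍 w × # 𝚍 (map flip w) ≡ # 𝚞 w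
#-map-flip [] = refl , refl
#-map-flip (𝚞 ∷ w) = let (a , b) = #-map-flip w in a , cong suc b
#-map-flip (𝚍 ∷ w) = let (a , b) = #-map-flip w in cong suc a , b

#-flip : ∀ {n} {f g : Fin n → Step} → (∀ i → g i ≡ flip (f i)) → ∀ k →
         # 𝚞 (pre g k) ≡ # 𝚍 (pre f k) × # 𝚍 (pre g k) ≡ # 𝚞 (pre f k)
#-flip {n} {f} {g} h k = subst (λ w → # 𝚞 w ≡ # 𝚍 (pre f k) × # 𝚍 w ≡ # 𝚞 (pre f k))
  (sym pre-flip) (#-map-flip (pre f k))
  where
  pre-flip : pre g k ≡ map flip (pre f k)
  pre-flip = trans (cong (take k) (trans (List.tabulate-cong h) (sym (List.map-tabulate f flip))))
                   (List.take-map k (tabulate f))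

-- f followed by q reversed with its letters exchanged is a Dyck word.
module Fold {n} (f q : Fin n → Step) (g : Fin n → Step) (g≡ : ∀ i → g i ≡ flip (q i))
            (f-ballot : Ballot (tabulate f)) (q-ballot : Ballot (tabulate q))
            (same : # 𝚞 (tabulate f) ≡ # 𝚞 (tabulate q)) where

  private
    F = tabulate f
    B = tabulate (g ∘ opposite)
    lenF = List.length-tabulate f

    #-all : (h : Fin n → Step) → # 𝚞 (tabulate h) + # 𝚍 (tabulate h) ≡ n
    #-all h = trans (#-total (tabulate h)) (List.length-tabulate h)

    same𝚍 : # 𝚍 F ≡ # 𝚍 (tabulate q)
    same𝚍 = ℕ.+-cancelˡ-≡ (# 𝚞 F) _ _ (trans (#-all f) (sym (trans (cong (_+ # 𝚍 (tabulate q)) same) (#-all q))))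

    full : ∀ (h : Fin n → Step) → pre h n ≡ tabulate h
    full h = pre-full h ℕ.≤-refl

    g𝚞 : # 𝚞 (tabulate g) ≡ # 𝚍 F
    g𝚞 = trans (cong (# 𝚞) (sym (full g))) (trans (proj₁ (#-flip g≡ n)) (trans (cong (# 𝚍) (full q)) (sym same𝚍)))
    g𝚍 : # 𝚍 (tabulate g) ≡ # 𝚞 F
    g𝚍 = trans (cong (# 𝚍) (sym (full g))) (trans (proj₂ (#-flip g≡ n)) (trans (cong (# 𝚞) (full q)) (sym same)))

    B-count : ∀ s → # s B ≡ # s (tabulate g)
    B-count s = trans (sym (ℕ.+-identityʳ _)) (trans
      (cong₂ (λ v k → # s v + # s (pre g k)) (sym (full (g ∘ opposite))) (sym (ℕ.n∸n≡0 n)))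
      (#-opposite s g n ℕ.≤-refl))

  fold-ups : # 𝚞 (F ++ B) ≡ n
  fold-ups = trans (#-++ 𝚞 F B) (trans (cong (# 𝚞 F +_) (trans (B-count 𝚞) g𝚞)) (#-all f))

  fold-downs : # 𝚍 (F ++ B) ≡ n
  fold-downs = trans (#-++ 𝚍 F B) (trans (cong (# 𝚍 F +_) (trans (B-count 𝚍) g𝚍))
                 (trans (ℕ.+-comm (# 𝚍 F) _) (#-all f)))

  private
    Holds : List Step → Set
    Holds w = # 𝚍 w ℕ.≤ # 𝚞 w

    second : ∀ m → m ℕ.≤ n → Holds (F ++ take m B)
    second m m≤n = subst₂ ℕ._≤_ (sym (#-++ 𝚍 F _)) (sym (#-++ 𝚞 F _)) (begin
      # 𝚍 F + bd         ≡⟨ cong (_+ bd) (trans (sym g𝚞) (sym (#-opposite 𝚞 g m m≤n))) ⟩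
      bu + eu + bd       ≤⟨ ℕ.+-monoˡ-≤ bd (ℕ.+-monoʳ-≤ bu eu≤ed) ⟩
      bu + ed + bd       ≡⟨ shuffle bu ed bd ⟩
      bd + ed + bu       ≡⟨ cong (_+ bu) (trans (#-opposite 𝚍 g m m≤n) g𝚍) ⟩
      # 𝚞 F + bu         ∎)
      where
      open ℕ.≤-Reasoning
      bd = # 𝚍 (take m B)
      bu = # 𝚞 (take m B)
      ed = # 𝚍 (pre g (n ∸ m))
      eu = # 𝚞 (pre g (n ∸ m))
      eu≤ed : eu ℕ.≤ ed
      eu≤ed = subst₂ ℕ._≤_ (sym (proj₁ (#-flip g≡ (n ∸ m)))) (sym (proj₂ (#-flip g≡ (n ∸ m)))) (q-ballot (n ∸ m))
      shuffle : ∀ a b c → a + b + c ≡ c + b + a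
      shuffle = solve-∀

  fold-ballot : Ballot (F ++ B)
  fold-ballot k = subst Holds (sym (take-++ k F B)) (split (ℕ.≤-total k n))
    where
    split : _ → Holds (take k F ++ take (k ∸ length F) B)
    split (inj₁ k≤n) = subst Holds
      (trans (sym (List.++-identityʳ (take k F))) (cong (λ m → take k F ++ take m B)
        (sym (trans (cong (k ∸_) lenF) (ℕ.m≤n⇒m∸n≡0 k≤n)))))
      (f-ballot k)
    split (inj₂ n≤k) = subst (λ v → Holds (v ++ take (k ∸ length F) B)) (sym (pre-full f n≤k))
      (rest (ℕ.≤-total (k ∸ length F) n))
      where
      rest : _ → Holds (F ++ take (k ∸ length F) B)
      rest (inj₁ m≤n) = second _ m≤n
      rest (inj₂ n≤m) = subst (λ v → Holds (F ++ v))
        (trans (full (g ∘ opposite)) (sym (pre-full (g ∘ opposite) n≤m))) (second n ℕ.≤-refl)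

data InsertView {n} (x : Fin n) (r : List (Fin n)) : List (Fin n) × Maybe (Fin n) → Set where
  append : (∀ {z} → z ∈ˡ r → z ≤ x) → InsertView x r (r ++ [ x ] , nothing)
  bump   : ∀ {y r′} → y ∈ˡ r → x < y → (∀ {z} → z ∈ˡ r → y ≤ z ⊎ z ≤ x) →
           AllPairs _<_ r′ → (∀ {z} → z ∈ˡ r′ → z ≡ x ⊎ (z ∈ˡ r × z ≢ y)) →
           x ∈ˡ r′ → (∀ {z} → z ∈ˡ r → z ≢ y → z ∈ˡ r′) → length r′ ≡ length r →
           InsertView x r (r′ , just y)

insert-view : ∀ {n} (x : Fin n) r → AllPairs _<_ r → x ∉ˡ r → InsertView x r (insertRow x r)
insert-view x [] _ _ = append λ ()
insert-view x (z ∷ r) (z< ∷ s) x∉ with x Fin.<? z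
... | yes x<z = bump (here refl) x<z
        (λ { (here refl) → inj₁ ℕ.≤-refl ; (there w∈) → inj₁ (ℕ.<⇒≤ (All.lookup z< w∈)) })
        (All.map (ℕ.<-trans x<z) z< ∷ s)
        (λ { (here e) → inj₁ e ; (there w∈) → inj₂ (there w∈ , λ { refl → ℕ.<-irrefl refl (All.lookup z< w∈) }) })
        (here refl)
        (λ { (here refl) ne → contradiction refl ne ; (there w∈) _ → there w∈ })
        refl
... | no x≮z with insertRow x r | insert-view x r s (x∉ ∘ there)
... | _ | append ≤x = append λ { (here refl) → ℕ.≮⇒≥ x≮z ; (there w∈) → ≤x w∈ }
... | _ | bump {y} y∈ x<y gap s′ from x∈ keep len = bump (there y∈) x<y
        (λ { (here refl) → inj₂ (ℕ.≮⇒≥ x≮z) ; (there w∈) → gap w∈ })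
        (All.tabulate (λ w∈ → smaller (from w∈)) ∷ s′)
        (λ { (here refl) → inj₂ (here refl , λ { refl → x≮z x<y })
           ; (there w∈) → Sum.map₂ (λ (p , q) → there p , q) (from w∈) })
        (there x∈)
        (λ { (here refl) _ → here refl ; (there w∈) ne → there (keep w∈ ne) })
        (cong suc len)
  where
  smaller : ∀ {w} → w ≡ x ⊎ (w ∈ˡ r × w ≢ y) → z < w
  smaller (inj₁ refl) = ≰⇒>ᶠ x≮z (x∉ ∘ here)
  smaller (inj₂ (w∈ , _)) = All.lookup z< w∈

insertRow-largest : ∀ {n} (x : Fin n) r → (∀ {z} → z ∈ˡ r → z < x) → insertRow x r ≡ (r ++ [ x ] , nothing)
insertRow-largest x [] _ = refl
insertRow-largest x (z ∷ r) h with x Fin.<? z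
... | yes x<z = contradiction x<z (ℕ.<-asym (h (here refl)))
... | no _ = cong (λ (r′ , b) → z ∷ r′ , b) (insertRow-largest x r (h ∘ there))

-- Missing rows are represented by [].
data TwoRows {n} : (r₁ s₁ r₂ s₂ : List (Fin n)) → Tableaux n → Set where
  none : TwoRows [] [] [] [] []
  one  : ∀ {r₁ s₁} → TwoRows r₁ s₁ [] [] [ r₁ , s₁ ]
  two  : ∀ {r₁ s₁ r₂ s₂} → TwoRows r₁ s₁ r₂ s₂ ((r₁ , s₁) ∷ [ r₂ , s₂ ])

insert-append : ∀ {n} {r₁ s₁ r₂ s₂ : List (Fin n)} {rows} t x → TwoRows r₁ s₁ r₂ s₂ rows →
  insertRow x r₁ ≡ (r₁ ++ [ x ] , nothing) → TwoRows (r₁ ++ [ x ]) (s₁ ++ [ t ]) r₂ s₂ (insert t x rows)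
insert-append t x none _ = one
insert-append t x (one {r₁}) e rewrite e = one
insert-append t x (two {r₁}) e rewrite e = two

insert-bump : ∀ {n} {r₁ s₁ r₂ s₂ r₁′ : List (Fin n)} {rows y} t x → TwoRows r₁ s₁ r₂ s₂ rows →
  insertRow x r₁ ≡ (r₁′ , just y) → insertRow y r₂ ≡ (r₂ ++ [ y ] , nothing) →
  TwoRows r₁′ s₁ (r₂ ++ [ y ]) (s₂ ++ [ t ]) (insert t x rows)
insert-bump t x none () _
insert-bump t x one e _ rewrite e = two
insert-bump t x two e e′ rewrite e | e′ = two

∈-snoc⁻ : ∀ {A : Set} {x y : A} xs → x ∈ˡ xs ++ [ y ] → x ∈ˡ xs ⊎ x ≡ y
∈-snoc⁻ xs x∈ with ∈-++⁻ xs x∈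
... | inj₁ p = inj₁ p
... | inj₂ (here e) = inj₂ e

sorted-snoc : ∀ {n} {x : Fin n} {xs} → AllPairs _<_ xs → (∀ {z} → z ∈ˡ xs → z < x) → AllPairs _<_ (xs ++ [ x ])
sorted-snoc [] _ = [] ∷ []
sorted-snoc {xs = y ∷ ys} (y< ∷ s) h =
  All.tabulate (λ w∈ → pick (∈-snoc⁻ ys w∈)) ∷ sorted-snoc s (h ∘ there)
  where
  pick : ∀ {w} → w ∈ˡ ys ⊎ w ≡ _ → y < w
  pick (inj₁ p) = All.lookup y< p
  pick (inj₂ refl) = h (here refl)

length-snoc : ∀ {A : Set} (xs : List A) {y} → length (xs ++ [ y ]) ≡ suc (length xs)
length-snoc xs = trans (List.length-++ xs) (ℕ.+-comm (length xs) 1)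

label : ∀ {n} → List (Fin n) → Fin n → Step
label row i = if does (i ∈?ˡ row) then 𝚞 else 𝚍

label-∈ : ∀ {n} {row : List (Fin n)} {i} → i ∈ˡ row → label row i ≡ 𝚞
label-∈ {row = row} {i} i∈ = cong (if_then 𝚞 else 𝚍) (dec-true (i ∈?ˡ row) i∈)

label-∉ : ∀ {n} {row : List (Fin n)} {i} → i ∉ˡ row → label row i ≡ 𝚍
label-∉ {row = row} {i} i∉ = cong (if_then 𝚞 else 𝚍) (dec-false (i ∈?ˡ row) i∉)

label-𝚍⁻ : ∀ {n} {row : List (Fin n)} {i} → label row i ≡ 𝚍 → i ∉ˡ row
label-𝚍⁻ e i∈ with () ← trans (sym e) (label-∈ i∈)

label-𝚞⁻ : ∀ {n} {row : List (Fin n)} {i} → label row i ≡ 𝚞 → i ∈ˡ row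
label-𝚞⁻ {row = row} {i} e with i ∈?ˡ row
... | yes i∈ = i∈

module Insertion {n} (π : 𝒮₃₂₁ n) where

  Seen : ℕ → Fin n → Set
  Seen t z = ∃ λ a → toℕ a ℕ.< t × π · a ≡ z

  -- z comes before a smaller value which is at least y.
  Descent : ℕ → Fin n → Fin n → Set
  Descent t z y = ∃₂ λ a b → a < b × toℕ b ℕ.< t × π · a ≡ z × π · b < z × y ≤ π · b

  record State (t : ℕ) (rows : Tableaux n) : Set where
    field
      r₁ s₁ r₂ s₂ : List (Fin n)
      shape   : TwoRows r₁ s₁ r₂ s₂ rows
      sorted  : AllPairs _<_ r₁
      unique₂ : Unique r₂
      seen₁   : ∀ {z} → z ∈ˡ r₁ → Seen t z
      seen₂   : ∀ {z} → z ∈ˡ r₂ → Seen t z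
      present : ∀ a → toℕ a ℕ.< t → π · a ∈ˡ r₁ ⊎ π · a ∈ˡ r₂
      descent : ∀ {z y} → z ∈ˡ r₂ → y ∈ˡ r₁ → y ≤ z →
                Descent t z y
      φ       : Fin n → Fin n
      φ-∈     : ∀ {z} → z ∈ˡ r₂ → φ z ∈ˡ r₁
      φ-<     : ∀ {z} → z ∈ˡ r₂ → φ z < z
      φ-inj   : ∀ {z w} → z ∈ˡ r₂ → w ∈ˡ r₂ → φ z ≡ φ w → z ≡ w
      times   : ∀ {i} → i ∈ˡ s₁ → toℕ i ℕ.< t
      ballotQ : ∀ k → k ℕ.≤ t → # 𝚍 (pre (label s₁) k) ℕ.≤ # 𝚞 (pre (label s₁) k)
      upsQ    : # 𝚞 (pre (label s₁) t) ≡ length r₁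
      downsQ  : # 𝚍 (pre (label s₁) t) ≡ length r₂

  start : State 0 []
  start = record
    { r₁ = [] ; s₁ = [] ; r₂ = [] ; s₂ = [] ; shape = none ; sorted = [] ; unique₂ = []
    ; seen₁ = λ () ; seen₂ = λ () ; present = λ _ () ; descent = λ () ; φ = id
    ; φ-∈ = λ () ; φ-< = λ () ; φ-inj = λ () ; times = λ ()
    ; ballotQ = λ { zero _ → z≤n } ; upsQ = refl ; downsQ = refl }

  seen-suc : ∀ {t z} → Seen t z → Seen (suc t) z
  seen-suc (a , a<t , e) = a , ℕ.m<n⇒m<1+n a<t , e

  module _ (i : Fin n) {rows} (S : State (toℕ i) rows) where
    open State S

    private
      t = toℕ i
      x = π · i

    fresh : ¬ Seen t x
    fresh (a , a<t , e) = Fin.<⇒≢ a<t (·-injective π e)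

    present-suc : ∀ {r₁′ r₂′} → (∀ {z} → z ∈ˡ r₁ ⊎ z ∈ˡ r₂ → z ∈ˡ r₁′ ⊎ z ∈ˡ r₂′) → x ∈ˡ r₁′ →
                  ∀ a → toℕ a ℕ.< suc t → π · a ∈ˡ r₁′ ⊎ π · a ∈ˡ r₂′
    present-suc keep x∈ a a< with ℕ.m≤n⇒m<n∨m≡n (ℕ.≤-pred a<)
    ... | inj₁ a<t = keep (present a a<t)
    ... | inj₂ e with refl ← Fin.toℕ-injective e = inj₁ x∈

    new-descent : ∀ {z} → Seen t z → x < z →
      Descent (suc t) z x
    new-descent (a , a<t , e) x<z = a , i , a<t , ℕ.≤-refl , e , x<z , ℕ.≤-refl

    old-descent : ∀ {z y} → Descent t z y → Descent (suc t) z y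
    old-descent (a , b , p , q , r) = a , b , p , ℕ.m<n⇒m<1+n q , r

    seen-≢ : ∀ {z} → Seen t z → z ≢ x
    seen-≢ s refl = fresh s

    appended : (∀ {z} → z ∈ˡ r₁ → z ≤ x) → insertRow x r₁ ≡ (r₁ ++ [ x ] , nothing) →
               State (suc t) (insert i x rows)
    appended ≤x e = record
      { r₁ = r₁ ++ [ x ] ; s₁ = s₁′ ; r₂ = r₂ ; s₂ = s₂
      ; shape = insert-append i x shape e
      ; sorted = sorted-snoc sorted (λ z∈ → Fin.≤∧≢⇒< (≤x z∈) (seen-≢ (seen₁ z∈)))
      ; unique₂ = unique₂
      ; seen₁ = λ z∈ → seen-new (∈-snoc⁻ r₁ z∈)
      ; seen₂ = seen-suc ∘ seen₂
      ; present = present-suc (Sum.map₁ ∈-++⁺ˡ) (∈-++⁺ʳ r₁ (here refl))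
      ; descent = λ z∈ y∈ y≤z → descent-new z∈ (∈-snoc⁻ r₁ y∈) y≤z
      ; φ = φ ; φ-∈ = ∈-++⁺ˡ ∘ φ-∈ ; φ-< = φ-< ; φ-inj = φ-inj
      ; times = λ j∈ → time-new (∈-snoc⁻ s₁ j∈)
      ; ballotQ = ballot-new
      ; upsQ = ups-new
      ; downsQ = downs-new
      }
      where
      s₁′ = s₁ ++ [ i ]
      seen-new : ∀ {z} → z ∈ˡ r₁ ⊎ z ≡ x → Seen (suc t) z
      seen-new (inj₁ p) = seen-suc (seen₁ p)
      seen-new (inj₂ refl) = i , ℕ.≤-refl , refl
      descent-new : ∀ {z y} → z ∈ˡ r₂ → y ∈ˡ r₁ ⊎ y ≡ x → y ≤ z →
        Descent (suc t) z y
      descent-new z∈ (inj₁ y∈) y≤z = old-descent (descent z∈ y∈ y≤z)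
      descent-new z∈ (inj₂ refl) y≤z =
        new-descent (seen₂ z∈) (Fin.≤∧≢⇒< y≤z (seen-≢ (seen₂ z∈) ∘ sym))
      time-new : ∀ {j} → j ∈ˡ s₁ ⊎ j ≡ i → toℕ j ℕ.< suc t
      time-new (inj₁ p) = ℕ.m<n⇒m<1+n (times p)
      time-new (inj₂ refl) = ℕ.≤-refl
      agree : ∀ {k} → k ℕ.≤ t → pre (label s₁) k ≡ pre (label s₁′) k
      agree {k} k≤t = pre-cong k λ j j<k → same j (ℕ.<-≤-trans j<k k≤t)
        where
        same : ∀ j → toℕ j ℕ.< t → label s₁ j ≡ label s₁′ j
        same j j<t with j ∈?ˡ s₁
        ... | yes j∈ = sym (label-∈ (∈-++⁺ˡ j∈))
        ... | no j∉ = sym (label-∉ λ j∈ → [ j∉ , (λ { refl → ℕ.<-irrefl refl j<t }) ]′ (∈-snoc⁻ s₁ j∈))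
          where open Sum using ([_,_]′)
      label-i : label s₁′ i ≡ 𝚞
      label-i = label-∈ (∈-++⁺ʳ s₁ (here refl))
      ups-new : # 𝚞 (pre (label s₁′) (suc t)) ≡ length (r₁ ++ [ x ])
      ups-new = trans (#-pre-suc 𝚞 (label s₁′) i) (trans
        (cong₂ (λ w s → # 𝚞 w + # 𝚞 [ s ]) (sym (agree ℕ.≤-refl)) label-i)
        (trans (ℕ.+-comm _ 1) (trans (cong suc upsQ) (sym (length-snoc r₁)))))
      downs-new : # 𝚍 (pre (label s₁′) (suc t)) ≡ length r₂
      downs-new = trans (#-pre-suc 𝚍 (label s₁′) i) (trans
        (cong₂ (λ w s → # 𝚍 w + # 𝚍 [ s ]) (sym (agree ℕ.≤-refl)) label-i)
        (trans (ℕ.+-identityʳ _) downsQ))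
      ballot-new : ∀ k → k ℕ.≤ suc t → # 𝚍 (pre (label s₁′) k) ℕ.≤ # 𝚞 (pre (label s₁′) k)
      ballot-new k k≤ with ℕ.m≤n⇒m<n∨m≡n k≤
      ... | inj₁ k<  = subst (λ w → # 𝚍 w ℕ.≤ # 𝚞 w) (agree (ℕ.≤-pred k<)) (ballotQ k (ℕ.≤-pred k<))
      ... | inj₂ refl = subst₂ ℕ._≤_ (sym downs-new) (sym (trans ups-new (length-snoc r₁)))
              (ℕ.m≤n⇒m≤1+n (subst₂ ℕ._≤_ downsQ upsQ (ballotQ t ℕ.≤-refl)))

    module Bumped {y r₁′} (y∈ : y ∈ˡ r₁) (x<y : x < y) (gap : ∀ {z} → z ∈ˡ r₁ → y ≤ z ⊎ z ≤ x)
      (sorted′ : AllPairs _<_ r₁′) (from : ∀ {z} → z ∈ˡ r₁′ → z ≡ x ⊎ (z ∈ˡ r₁ × z ≢ y))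
      (x∈ : x ∈ˡ r₁′) (keep : ∀ {z} → z ∈ˡ r₁ → z ≢ y → z ∈ˡ r₁′) (len : length r₁′ ≡ length r₁)
      (e : insertRow x r₁ ≡ (r₁′ , just y)) where

      -- otherwise z, π b and x would form a 321 pattern
      y-largest : ∀ {z} → z ∈ˡ r₂ → z < y
      y-largest {z} z∈ = ℕ.≰⇒> λ y≤z → pattern₃₂₁ (descent z∈ y∈ y≤z)
        where
        pattern₃₂₁ : ¬ Descent t z y
        pattern₃₂₁ (a , b , a<b , b<t , ez , πb<z , y≤πb) =
          avoids π a<b b<t (subst (π · b <_) (sym ez) πb<z , ℕ.<-≤-trans x<y y≤πb)

      r₂′ = r₂ ++ [ y ]

      φ′ : Fin n → Fin n
      φ′ z = if does (z Fin.≟ y) then x else φ z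

      φ′-y : φ′ y ≡ x
      φ′-y = cong (if_then x else φ y) (dec-true (y Fin.≟ y) refl)

      φ′-old : ∀ {z} → z ∈ˡ r₂ → φ′ z ≡ φ z
      φ′-old {z} z∈ = cong (if_then x else φ z) (dec-false (z Fin.≟ y) (Fin.<⇒≢ (y-largest z∈)))

      φ-≢x : ∀ {z} → z ∈ˡ r₂ → φ z ≢ x
      φ-≢x z∈ = seen-≢ (seen₁ (φ-∈ z∈))

      φ′-∈ : ∀ {z} → z ∈ˡ r₂ ⊎ z ≡ y → φ′ z ∈ˡ r₁′
      φ′-∈ (inj₁ z∈) = subst (_∈ˡ r₁′) (sym (φ′-old z∈))
        (keep (φ-∈ z∈) (Fin.<⇒≢ (ℕ.<-trans (φ-< z∈) (y-largest z∈))))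
      φ′-∈ (inj₂ refl) = subst (_∈ˡ r₁′) (sym φ′-y) x∈

      φ′-< : ∀ {z} → z ∈ˡ r₂ ⊎ z ≡ y → φ′ z < z
      φ′-< {z} (inj₁ z∈) = subst (_< z) (sym (φ′-old z∈)) (φ-< z∈)
      φ′-< (inj₂ refl) = subst (_< y) (sym φ′-y) x<y

      φ′-inj : ∀ {z w} → z ∈ˡ r₂ ⊎ z ≡ y → w ∈ˡ r₂ ⊎ w ≡ y → φ′ z ≡ φ′ w → z ≡ w
      φ′-inj (inj₁ z∈) (inj₁ w∈) eq = φ-inj z∈ w∈ (trans (sym (φ′-old z∈)) (trans eq (φ′-old w∈)))
      φ′-inj (inj₁ z∈) (inj₂ refl) eq = contradiction (trans (sym (φ′-old z∈)) (trans eq φ′-y)) (φ-≢x z∈)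
      φ′-inj (inj₂ refl) (inj₁ w∈) eq = contradiction (trans (sym (φ′-old w∈)) (trans (sym eq) φ′-y)) (φ-≢x w∈)
      φ′-inj (inj₂ refl) (inj₂ refl) _ = refl

      unique₂′ : Unique r₂′
      unique₂′ = Unique.++⁺ unique₂ ([] ∷ [])
        λ { (z∈ , here refl) → ℕ.<-irrefl refl (y-largest z∈) }

      seen-new : ∀ {z} → z ≡ x ⊎ (z ∈ˡ r₁ × z ≢ y) → Seen (suc t) z
      seen-new (inj₁ refl) = i , ℕ.≤-refl , refl
      seen-new (inj₂ (z∈ , _)) = seen-suc (seen₁ z∈)

      seen-new₂ : ∀ {z} → z ∈ˡ r₂ ⊎ z ≡ y → Seen (suc t) z
      seen-new₂ (inj₁ p) = seen-suc (seen₂ p)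
      seen-new₂ (inj₂ refl) = seen-suc (seen₁ y∈)

      move : ∀ {z} → z ∈ˡ r₁ ⊎ z ∈ˡ r₂ → z ∈ˡ r₁′ ⊎ z ∈ˡ r₂′
      move {z} (inj₁ z∈) with z Fin.≟ y
      ... | yes refl = inj₂ (∈-++⁺ʳ r₂ (here refl))
      ... | no z≢y = inj₁ (keep z∈ z≢y)
      move (inj₂ z∈) = inj₂ (∈-++⁺ˡ z∈)

      descent-new : ∀ {z w} → z ∈ˡ r₂ ⊎ z ≡ y → w ≡ x ⊎ (w ∈ˡ r₁ × w ≢ y) → w ≤ z →
        Descent (suc t) z w
      descent-new (inj₁ z∈) (inj₁ refl) w≤z =
        new-descent (seen₂ z∈) (Fin.≤∧≢⇒< w≤z (seen-≢ (seen₂ z∈) ∘ sym))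
      descent-new (inj₁ z∈) (inj₂ (w∈ , _)) w≤z = old-descent (descent z∈ w∈ w≤z)
      descent-new (inj₂ refl) (inj₁ refl) w≤z = new-descent (seen₁ y∈) x<y
      descent-new (inj₂ refl) (inj₂ (w∈ , w≢y)) w≤y with gap w∈
      ... | inj₁ y≤w = contradiction (Fin.≤-antisym w≤y y≤w) w≢y
      ... | inj₂ w≤x = let (a , b , p , q , r , s , x≤πb) = new-descent (seen₁ y∈) x<y in
                       a , b , p , q , r , s , ℕ.≤-trans w≤x x≤πb

      label-i : label s₁ i ≡ 𝚍
      label-i = label-∉ λ i∈ → ℕ.<-irrefl refl (times i∈)

      ups-new : # 𝚞 (pre (label s₁) (suc t)) ≡ length r₁′
      ups-new = trans (#-pre-suc 𝚞 (label s₁) i)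
        (trans (cong (λ s → # 𝚞 (pre (label s₁) t) + # 𝚞 [ s ]) label-i)
          (trans (ℕ.+-identityʳ _) (trans upsQ (sym len))))

      downs-new : # 𝚍 (pre (label s₁) (suc t)) ≡ length r₂′
      downs-new = trans (#-pre-suc 𝚍 (label s₁) i)
        (trans (cong (λ s → # 𝚍 (pre (label s₁) t) + # 𝚍 [ s ]) label-i)
          (trans (ℕ.+-comm _ 1) (trans (cong suc downsQ) (sym (length-snoc r₂)))))

      ballot-new : ∀ k → k ℕ.≤ suc t → # 𝚍 (pre (label s₁) k) ℕ.≤ # 𝚞 (pre (label s₁) k)
      ballot-new k k≤ with ℕ.m≤n⇒m<n∨m≡n k≤
      ... | inj₁ k<  = ballotQ k (ℕ.≤-pred k<)
      ... | inj₂ refl = subst₂ ℕ._≤_ (sym downs-new) (sym ups-new)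
              (injection⇒length-≤ φ′ unique₂′
                (λ z∈ w∈ → φ′-inj (∈-snoc⁻ r₂ z∈) (∈-snoc⁻ r₂ w∈))
                (λ z∈ → φ′-∈ (∈-snoc⁻ r₂ z∈)))

      bumped : State (suc t) (insert i x rows)
      bumped = record
        { r₁ = r₁′ ; s₁ = s₁ ; r₂ = r₂′ ; s₂ = s₂ ++ [ i ]
        ; shape = insert-bump i x shape e (insertRow-largest y r₂ y-largest)
        ; sorted = sorted′
        ; unique₂ = unique₂′
        ; seen₁ = λ z∈ → seen-new (from z∈)
        ; seen₂ = λ z∈ → seen-new₂ (∈-snoc⁻ r₂ z∈)
        ; present = present-suc move x∈
        ; descent = λ z∈ w∈ w≤z → descent-new (∈-snoc⁻ r₂ z∈) (from w∈) w≤z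
        ; φ = φ′
        ; φ-∈ = λ z∈ → φ′-∈ (∈-snoc⁻ r₂ z∈)
        ; φ-< = λ z∈ → φ′-< (∈-snoc⁻ r₂ z∈)
        ; φ-inj = λ z∈ w∈ → φ′-inj (∈-snoc⁻ r₂ z∈) (∈-snoc⁻ r₂ w∈)
        ; times = ℕ.m<n⇒m<1+n ∘ times
        ; ballotQ = ballot-new
        ; upsQ = ups-new
        ; downsQ = downs-new
        }

    state-suc : State (suc t) (insert i x rows)
    state-suc = choose (insert-view x r₁ sorted (fresh ∘ seen₁)) refl
      where
      choose : ∀ {res} → InsertView x r₁ res → insertRow x r₁ ≡ res → State (suc t) (insert i x rows)
      choose (append ≤x) e = appended ≤x e
      choose (bump y∈ x<y gap s f x∈ k l) e = Bumped.bumped y∈ x<y gap s f x∈ k l e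

  final : State n (insertAll (perm π))
  final = foldl-invariant State _ start (λ i rows → state-suc i)

module RSK-Dyck {n} (π : 𝒮₃₂₁ n) where
  open Insertion π
  open State final

  tops : topRow (proj₁ (RSK (perm π))) ≡ r₁ × topRow (proj₂ (RSK (perm π))) ≡ s₁
  tops = go shape
    where
    go : ∀ {r₁ s₁ r₂ s₂ : List (Fin n)} {rows} → TwoRows r₁ s₁ r₂ s₂ rows →
         topRow (map proj₁ rows) ≡ r₁ × topRow (map proj₂ rows) ≡ s₁
    go none = refl , refl
    go one = refl , refl
    go two = refl , refl

  private
    topP = topRow (proj₁ (RSK (perm π)))
    topQ = topRow (proj₂ (RSK (perm π)))

  bottom : ∀ {z} → z ∉ˡ r₁ → z ∈ˡ r₂
  bottom {z} z∉ with present (perm π ⟨$⟩ˡ z) (Fin.toℕ<n _)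
  ... | inj₁ p = contradiction (subst (_∈ˡ r₁) (Perm.inverseʳ (perm π)) p) z∉
  ... | inj₂ p = subst (_∈ˡ r₂) (Perm.inverseʳ (perm π)) p

  ballotP : Ballot (tabulate (label r₁))
  ballotP = injection⇒ballot (label r₁) φ
    (λ {z} e → label-∈ (φ-∈ (low e)))
    (λ e → φ-< (low e))
    (λ e f → φ-inj (low e) (low f))
    where
    low : ∀ {z} → label r₁ z ≡ 𝚍 → z ∈ˡ r₂
    low e = bottom (label-𝚍⁻ e)

  upsP : # 𝚞 (tabulate (label r₁)) ≡ length r₁
  upsP = trans (cong (# 𝚞) (sym (pre-full (label r₁) ℕ.≤-refl))) (trans (#-pre 𝚞 (label r₁) n) (ℕ.≤-antisym
    (unique-⊆⇒length-≤ {ys = r₁} (Unique.filter⁺ is𝚞 (Unique.take⁺ n (Unique.allFin⁺ n)))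
      (λ z∈ → label-𝚞⁻ (proj₂ (∈-filter⁻ is𝚞 {xs = below n n} z∈))))
    (unique-⊆⇒length-≤ (AllPairs.map Fin.<⇒≢ sorted)
      (λ {z} z∈ → ∈-filter⁺ is𝚞 (∈-below⁺ id n z (Fin.toℕ<n z)) (label-∈ z∈)))))
    where
    is𝚞 : Decidable (λ i → label r₁ i ≡ 𝚞)
    is𝚞 i = label r₁ i ≟ˢ 𝚞

  ballotQ′ : Ballot (tabulate (label s₁))
  ballotQ′ k with ℕ.≤-total k n
  ... | inj₁ k≤n = ballotQ k k≤n
  ... | inj₂ n≤k = subst (λ w → # 𝚍 w ℕ.≤ # 𝚞 w)
          (trans (pre-full (label s₁) ℕ.≤-refl) (sym (pre-full (label s₁) n≤k))) (ballotQ n ℕ.≤-refl)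

  stepQ-flip : ∀ i → stepQ (perm π) i ≡ flip (label s₁ i)
  stepQ-flip i = trans (cong (λ row → if does (i ∈?ˡ row) then 𝚍 else 𝚞) (proj₂ tops)) (flipped (i ∈?ˡ s₁))
    where
    flipped : ∀ {A : Set} (a? : Dec A) → (if does a? then 𝚍 else 𝚞) ≡ flip (if does a? then 𝚞 else 𝚍)
    flipped (yes _) = refl
    flipped (no _) = refl

  open Fold (label r₁) (label s₁) (stepQ (perm π)) stepQ-flip ballotP ballotQ′
    (trans upsP (trans (sym upsQ) (cong (# 𝚞) (pre-full (label s₁) ℕ.≤-refl)))) public

  word≡ : toList (RSK-word (perm π)) ≡ tabulate (label r₁) ++ tabulate (stepQ (perm π) ∘ opposite)
  word≡ = trans (Vec.toList-++ (Vec.tabulate (stepP (perm π))) _)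
    (cong₂ _++_ (trans (toList-tabulate _) (List.tabulate-cong λ i → cong (λ row → label row i) (proj₁ tops)))
                (toList-tabulate _))
    where
    toList-tabulate : ∀ {A : Set} {m} (f : Fin m → A) → toList (Vec.tabulate f) ≡ tabulate f
    toList-tabulate {m = zero} f = refl
    toList-tabulate {m = suc m} f = cong (f zero ∷_) (toList-tabulate (f ∘ suc))

RSK^ : ∀ {n} → 𝒮₃₂₁ n → 𝒟 n
RSK^ π = record
  { word   = RSK-word (perm π)
  ; ups    = trans (cong (# 𝚞) word≡) fold-ups
  ; downs  = trans (cong (# 𝚍) word≡) fold-downs
  ; ballot = subst Ballot (sym word≡) fold-ballot
  }
  where open RSK-Dyck π

{-# OPTIONS --safe #-}

-- A noncrossing perfect matching of 1,…,2n is determined by the set of points matched to a smaller one, so it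
-- suffices to see that AST and Match have the same such points.  Run AST and the row insertion of π in
-- parallel.  Let m be the least number such that all values seen lie below m, and call the unseen values below
-- m holes.  Since the nonexcedance values arrive in increasing order, each hole will bump the next larger
-- entry of the first row, if there is one.  Pairing holes with the entries they will bump splits the holes
-- into a that bump and b that do not, and (a , b) obeys the same recurrence as the numbers of unmatched
-- barred points and of unmatched vertices below m in AST.  Hence a nonexcedance bumps iff AST matches two
-- barred points, and an excedance value is eventually bumped iff AST matches it to a smaller vertex.

module Submission where

open import Defs
open import Data.Bool.Base using (if_then_else_)
open import Data.Empty using (⊥)
open import Data.Fin.Base using (Fin; toℕ; fromℕ<; opposite; _<_; _↑ʳ_; splitAt) renaming (_≤_ to _≤ᶠ_)
open import Data.Fin.Induction using (>-wellFounded)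
open import Data.Fin.Permutation as Perm using (_⟨$⟩ˡ_)
import Data.Fin.Properties as Fin
open import Data.List.Base using (List; []; _∷_; [_]; _++_; length; map; foldl; allFin)
open import Data.List.Membership.Propositional using () renaming (_∈_ to _∈ˡ_; _∉_ to _∉ˡ_)
open import Data.List.Membership.Propositional.Properties using (∈-∃++; ∈-++⁺ˡ; ∈-++⁺ʳ; ∈-map⁺)
import Data.List.Properties as List
open import Data.List.Relation.Binary.Permutation.Propositional using (_↭_; ↭-sym; ↭⇒↭ₛ)
open import Data.List.Relation.Binary.Permutation.Propositional.Properties using (∈-resp-↭; ↭-length; shift)
import Data.List.Relation.Binary.Permutation.Setoid.Properties as Permutation
open import Data.List.Relation.Unary.All as All using (All; []; _∷_)
import Data.List.Relation.Unary.All.Properties as All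
open import Data.List.Relation.Unary.AllPairs as AllPairs using (AllPairs; []; _∷_)
open import Data.List.Relation.Unary.Any using (here; there)
open import Data.List.Relation.Unary.Unique.Propositional using (Unique)
open import Data.Maybe.Base using (maybe′)
open import Data.Nat.Base as ℕ using (ℕ; _≤_; _∸_; _+_; suc; z≤n; s≤s)
import Data.Nat.Properties as ℕ
open import Data.Product using (∃; ∃₂; _×_; _,_; proj₁; proj₂)
open import Data.Sum as Sum using (_⊎_; inj₁; inj₂)
import Data.Vec.Base as Vec
import Data.Vec.Properties as Vec
open import Function.Base using (_∘_; id)
open import Function.Bundles using (Equivalence)
open import Induction.WellFounded using (Acc; acc)
open import Relation.Binary using (tri<; tri≈; tri>)
open import Relation.Binary.PropositionalEquality
  using (_≡_; _≢_; refl; sym; trans; cong; subst; subst₂; setoid)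
open import Relation.Nullary using (¬_; Dec; does; yes; no; contradiction)

-- Counting by explicit lists.

tail-∈ : ∀ {A : Set} {x y : A} {ys} → x ≢ y → x ∈ˡ y ∷ ys → x ∈ˡ ys
tail-∈ x≢y (here e) = contradiction e x≢y
tail-∈ _ (there x∈) = x∈

-- The count carries a duplicate-free list of the elements, so that it can be raised or lowered by
-- one without deciding `P`.
record Count {A : Set} (P : A → Set) (l : ℕ) : Set where
  field
    elements  : List A
    distinct : Unique elements
    sound    : ∀ {x} → x ∈ˡ elements → P x
    complete : ∀ {x} → P x → x ∈ˡ elements
    length≡     : length elements ≡ l

module _ {A : Set} where

  count-none : {P : A → Set} → (∀ x → ¬ P x) → Count P 0
  count-none ¬P = record
    { elements = [] ; distinct = [] ; sound = λ () ; complete = λ p → contradiction p (¬P _) ; length≡ = refl }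

  count-resp : {P Q : A → Set} {l : ℕ} → (∀ {x} → P x → Q x) → (∀ {x} → Q x → P x) → Count P l → Count Q l
  count-resp P⊆Q Q⊆P c = record
    { elements = elements ; distinct = distinct ; sound = P⊆Q ∘ sound ; complete = complete ∘ Q⊆P ; length≡ = length≡ }
    where open Count c

  count-add : {P Q : A → Set} {l : ℕ} {x : A} → ¬ P x → Q x → (∀ {y} → P y → Q y) →
              (∀ {y} → Q y → y ≡ x ⊎ P y) → Count P l → Count Q (suc l)
  count-add {P} {Q} {x = x} ¬Px Qx P⊆Q Q⊆ c = record
    { elements = x ∷ elements
    ; distinct = All.tabulate (λ y∈ x≡y → ¬Px (subst P (sym x≡y) (sound y∈))) ∷ distinct
    ; sound    = λ { (here refl) → Qx ; (there y∈) → P⊆Q (sound y∈) }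
    ; complete = λ q → Sum.[ here , there ∘ complete ]′ (Q⊆ q)
    ; length≡  = cong suc length≡
    }
    where open Count c

  -- The complete list is split around `x`. Moving `x` to the front is a permutation and preserves
  -- uniqueness, so the other elements are distinct and differ from `x`.
  count-remove : {P Q : A → Set} {l : ℕ} {x : A} → P x → (∀ {y} → Q y → P y × y ≢ x) →
                 (∀ {y} → P y → y ≢ x → Q y) → Count P (suc l) → Count Q l
  count-remove {P} {Q} {l} {x} Px Q⊆ ⊆Q c = removed (∈-∃++ (complete Px))
    where
    open Count c
    removed : (∃₂ λ ys zs → elements ≡ ys ++ [ x ] ++ zs) → Count Q l
    removed (ys , zs , eq) = record
      { elements = ys ++ zs
      ; distinct = AllPairs.tail unique
      ; sound    = λ y∈ → ⊆Q (sound (∈-resp-↭ (↭-sym perm′) (there y∈))) (All.lookup (AllPairs.head unique) y∈ ∘ sym)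
      ; complete = λ q → let (p , y≢x) = Q⊆ q in tail-∈ y≢x (∈-resp-↭ perm′ (complete p))
      ; length≡  = ℕ.suc-injective (trans (sym (↭-length perm′)) length≡)
      }
      where
      perm′ : elements ↭ x ∷ ys ++ zs
      perm′ = subst (_↭ x ∷ ys ++ zs) (sym eq) (shift x ys zs)
      unique : Unique (x ∷ ys ++ zs)
      unique = Permutation.Unique-resp-↭ (setoid A) (↭⇒↭ₛ perm′) distinct

  count-zero⁻ : {P : A → Set} {x : A} → Count P 0 → ¬ P x
  count-zero⁻ record { elements = [] ; complete = complete } p with () ← complete p

  count-suc⁻ : {P : A → Set} {l : ℕ} → Count P (suc l) → ∃ P
  count-suc⁻ record { elements = x ∷ _ ; sound = sound } = x , sound (here refl)

-- Noncrossing matchings with the same closing points.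

-- If x < M x < M′ x, then z = M′ (M x) lies between x and M x, and z < M z < M′ z; so x ascends forever.
module _ {n} (M M′ : 𝒩 n) (opener : ∀ x → x < partner M′ x → x < partner M x)
         (closer : ∀ x → partner M x < x → partner M′ x < x) where

  partner-≮ : ∀ x → x < partner M x → ¬ partner M x < partner M′ x
  partner-≮ x = go x (>-wellFounded x)
    where
    go : ∀ x → Acc (λ y z → z < y) x → x < partner M x → ¬ partner M x < partner M′ x
    go x (acc rs) x<y y<y′ = order (Fin.<-cmp z x)
      where
      y = partner M x
      z = partner M′ y
      z<y : z < y
      z<y = closer y (subst (_< y) (sym (involutive M x)) x<y)
      order : _ → ⊥
      -- The arcs of `M′` from `z` to `y` and from `x` to `partner M′ x` would cross.
      order (tri< z<x _ _) = noncrossing M′ z<x x<y y<y′ (involutive M′ y , refl)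
      order (tri≈ _ z≡x _) = Fin.<⇒≢ y<y′ (trans (sym (involutive M′ y)) (cong (partner M′) z≡x))
      order (tri> _ _ x<z) = go z (rs x<z) z<Mz (subst (partner M z <_) (sym (involutive M′ y)) Mz<y)
        where
        z<Mz : z < partner M z
        z<Mz = opener z (subst (z <_) (sym (involutive M′ y)) z<y)
        Mz<y : partner M z < y
        Mz<y with Fin.<-cmp (partner M z) y
        ... | tri< lt _ _ = lt
        ... | tri≈ _ e _ = contradiction (trans (sym (involutive M x)) (trans (cong (partner M) (sym e)) (involutive M z))) (Fin.<⇒≢ x<z)
        -- The arcs of `M` from `x` to `y` and from `z` to `partner M z` would cross.
        ... | tri> _ _ gt = contradiction (refl , refl) (noncrossing M x<z z<y gt)

-- ds lists the points which close an arc.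
Typed : ∀ {N} → List (Fin N) → PartialMatching N → Fin N → Set
Typed ds σ x = (x ∈ˡ ds × σ x < x) ⊎ (x ∉ˡ ds × x < σ x)

module _ {n} (M M′ : 𝒩 n) (ds : List (Fin (n + n)))
         (typed : ∀ x → Typed ds (partner M) x) (typed′ : ∀ x → Typed ds (partner M′) x) where

  private
    -- `partner-≮` excludes only one direction of inequality, so its hypotheses are needed for the
    -- two matchings in both orders.
    module Uniform (M M′ : 𝒩 n) (typed : ∀ x → Typed ds (partner M) x) (typed′ : ∀ x → Typed ds (partner M′) x) where
      opener : ∀ x → x < partner M′ x → x < partner M x
      opener x lt with typed x | typed′ x
      ... | inj₂ (_ , p) | _ = p
      ... | inj₁ _ | inj₁ (_ , gt) = contradiction lt (ℕ.<-asym gt)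
      ... | inj₁ (∈ , _) | inj₂ (∉ , _) = contradiction ∈ ∉
      closer : ∀ x → partner M x < x → partner M′ x < x
      closer x lt with typed x | typed′ x
      ... | _ | inj₁ (_ , p) = p
      ... | inj₂ (_ , gt) | inj₂ _ = contradiction lt (ℕ.<-asym gt)
      ... | inj₁ (∈ , _) | inj₂ (∉ , _) = contradiction ∈ ∉

    open Uniform

  openers-agree : ∀ {x} → x < partner M x → partner M x ≡ partner M′ x
  openers-agree {x} lt with Fin.<-cmp (partner M x) (partner M′ x)
  ... | tri≈ _ e _ = e
  ... | tri< l _ _ = contradiction l
          (partner-≮ M M′ (opener M M′ typed typed′) (closer M M′ typed typed′) x lt)
  ... | tri> _ _ g = contradiction g
          (partner-≮ M′ M (opener M′ M typed′ typed) (closer M′ M typed′ typed) x (opener M′ M typed′ typed x lt))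

  -- A closing point is the partner of an opening one, where the matchings agree; involutivity
  -- carries the agreement over.
  typed⇒≈ : M ≈ᴺ M′
  typed⇒≈ x with typed x
  ... | inj₂ (_ , lt) = openers-agree lt
  ... | inj₁ (_ , gt) = trans (sym (involutive M′ _)) (cong (partner M′) (trans
          (sym (openers-agree (subst (partner M x <_) (sym (involutive M x)) gt))) (involutive M x)))

-- The nearest unmatched point.

module _ {N} {walk : Fin N → ℕ → Fin N} (W : Walk walk) {σ : PartialMatching N} {v : Fin N} where
  open Walk W

  -- If the walk has gone round the end of the circle, everything outside the new arc was walked
  -- over and found matched. This rules out going round whenever a free point is known to lie there.
  nearest : ∀ k₀ → suc k₀ ℕ.< N → σ (walk v (suc k₀)) ≡ walk v (suc k₀) →
    ∃₂ λ k w → matchNearest walk v σ ≡ link v w σ × σ w ≡ w × suc k ℕ.< N ×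
      (Near v (suc k) w ⊎ (Far v (suc k) w × ∀ y → Outside v w y → σ y ≢ y))
  nearest k₀ k₀< free₀
    with find-first (λ x → σ x Fin.≟ x) (λ k → walk v (suc k)) (N ∸ 1) k₀ (ℕ.<⇒≤pred k₀<) free₀
  ... | k , k≤k₀ , before , free , e =
    k , walk v (suc k) , cong (maybe′ (λ w → link v w σ) σ) e , free , k<N ,
    Sum.map₂ (λ p → p , passed p) (position v (suc k) k<N)
    where
    k<N = ℕ.≤-<-trans (s≤s k≤k₀) k₀<
    passed : Far v (suc k) (walk v (suc k)) → ∀ y → Outside v (walk v (suc k)) y → σ y ≢ y
    passed p y out with far-side k<N p out
    ... | suc l , s≤s l<k , _ , inj₁ q = subst (λ y → σ y ≢ y) (near (ℕ.<-trans (s≤s l<k) k<N) q) (before l l<k)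
    ... | suc l , s≤s l<k , _ , inj₂ q = subst (λ y → σ y ≢ y) (far (ℕ.<-trans (s≤s l<k) k<N) q) (before l l<k)

m+[1+n]≡o : ∀ {m o} → m ℕ.< o → m + suc (o ∸ suc m) ≡ o
m+[1+n]≡o {m} {o} m<o = trans (ℕ.+-suc m _) (ℕ.m+[n∸m]≡n m<o)

-- Any free point other than `v` makes the search succeed. The alternatives for `w` say whether the
-- walk stays beyond `v` or passes from the last point of the circle to the first.
nearest-clockwise : ∀ {N} {σ : PartialMatching N} {v y : Fin N} → y ≢ v → σ y ≡ y →
  ∃ λ w → matchNearest clockwise v σ ≡ link v w σ × σ w ≡ w ×
    (v < w ⊎ (w < v × ∀ z → Outside v w z → σ z ≢ z))
nearest-clockwise {suc m} {σ} {v} {y} y≢v y-free = result (start (Fin.<-cmp v y))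
  where
  open Walk (clockwise-walk {m})
  at : ∀ k → clockwise v (suc k) ≡ y → σ (clockwise v (suc k)) ≡ clockwise v (suc k)
  at _ e = subst (λ z → σ z ≡ z) (sym e) y-free
  start : _ → ∃ λ k₀ → suc k₀ ℕ.< suc m × σ (clockwise v (suc k₀)) ≡ clockwise v (suc k₀)
  -- The search begins one step away from `v`, so its index is one less than the distance to `y`.
  start (tri< v<y _ _) = toℕ y ∸ suc (toℕ v) , k< , at _ (near k< (sym (m+[1+n]≡o v<y)))
    where
    k< : suc (toℕ y ∸ suc (toℕ v)) ℕ.< suc m
    k< = ℕ.≤-<-trans (subst (suc (toℕ y ∸ suc (toℕ v)) ℕ.≤_) (m+[1+n]≡o v<y) (ℕ.m≤n+m _ (toℕ v))) (Fin.toℕ<n y)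
  start (tri≈ _ v≡y _) = contradiction (sym v≡y) y≢v
  -- The distance now leads across the end of the circle, hence the added `suc m`.
  start (tri> _ _ y<v) = toℕ y + suc m ∸ suc (toℕ v) , k< , at _ (far k< (sym eq))
    where
    eq = m+[1+n]≡o (ℕ.<-≤-trans (Fin.toℕ<n v) (ℕ.m≤n+m (suc m) (toℕ y)))
    k< : suc (toℕ y + suc m ∸ suc (toℕ v)) ℕ.< suc m
    k< = ℕ.+-cancelˡ-< (toℕ v) _ _ (subst (ℕ._< toℕ v + suc m) (sym eq) (ℕ.+-monoˡ-< (suc m) y<v))
  result : _ → _
  result (k₀ , k₀< , free₀) with nearest (clockwise-walk {m}) {σ} {v} k₀ k₀< free₀
  ... | k , w , e , w-free , k< , inj₁ p = w , e , w-free ,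
          inj₁ (subst (toℕ v ℕ.<_) (sym p) (ℕ.m<m+n (toℕ v) (s≤s z≤n)))
  ... | k , w , e , w-free , k< , inj₂ (p , out) = w , e , w-free ,
          inj₂ (ℕ.+-cancelʳ-< (suc m) _ _ (subst (ℕ._< toℕ v + suc m) (sym p) (ℕ.+-monoʳ-< (toℕ v) k<)) , out)

nearest-counterclockwise : ∀ {N} {σ : PartialMatching N} {v y : Fin N} → y ≢ v → σ y ≡ y →
  ∃ λ w → matchNearest counterclockwise v σ ≡ link v w σ × σ w ≡ w ×
    (w < v ⊎ (v < w × ∀ z → Outside v w z → σ z ≢ z))
nearest-counterclockwise {suc m} {σ} {v} {y} y≢v y-free = result (start (Fin.<-cmp v y))
  where
  open Walk (counterclockwise-walk {m})
  at : ∀ k → counterclockwise v (suc k) ≡ y → σ (counterclockwise v (suc k)) ≡ counterclockwise v (suc k)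
  at _ e = subst (λ z → σ z ≡ z) (sym e) y-free
  start : _ → ∃ λ k₀ → suc k₀ ℕ.< suc m × σ (counterclockwise v (suc k₀)) ≡ counterclockwise v (suc k₀)
  start (tri> _ _ y<v) = toℕ v ∸ suc (toℕ y) , k< , at (toℕ v ∸ suc (toℕ y)) (near k< (m+[1+n]≡o y<v))
    where
    k< : suc (toℕ v ∸ suc (toℕ y)) ℕ.< suc m
    k< = ℕ.≤-<-trans (subst (suc (toℕ v ∸ suc (toℕ y)) ℕ.≤_) (m+[1+n]≡o y<v) (ℕ.m≤n+m _ (toℕ y))) (Fin.toℕ<n v)
  start (tri≈ _ v≡y _) = contradiction (sym v≡y) y≢v
  start (tri< v<y _ _) = toℕ v + suc m ∸ suc (toℕ y) , k< , at (toℕ v + suc m ∸ suc (toℕ y)) (far k< eq)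
    where
    eq = m+[1+n]≡o (ℕ.<-≤-trans (Fin.toℕ<n y) (ℕ.m≤n+m (suc m) (toℕ v)))
    k< : suc (toℕ v + suc m ∸ suc (toℕ y)) ℕ.< suc m
    k< = ℕ.+-cancelˡ-< (toℕ y) _ _ (subst (ℕ._< toℕ y + suc m) (sym eq) (ℕ.+-monoˡ-< (suc m) v<y))
  result : _ → _
  result (k₀ , k₀< , free₀) with nearest (counterclockwise-walk {m}) {σ} {v} k₀ k₀< free₀
  ... | k , w , e , w-free , k< , inj₁ p = w , e , w-free ,
          inj₁ (subst (toℕ w ℕ.<_) p (ℕ.m<m+n (toℕ w) (s≤s z≤n)))
  ... | k , w , e , w-free , k< , inj₂ (p , out) = w , e , w-free ,
          inj₂ (ℕ.+-cancelʳ-< (suc m) _ _ (subst (ℕ._< toℕ w + suc m) p (ℕ.+-monoʳ-< (toℕ w) k<)) , out)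

-- The effect of a new arc.

module Link {N} (σ : PartialMatching N) {v w : Fin N} (v≢w : v ≢ w) where

  link-v : link v w σ v ≡ w
  link-v with link-view v w σ v
  ... | at-v _ e = e
  ... | at-w v≢v _ _ = contradiction refl v≢v
  ... | other v≢v _ _ = contradiction refl v≢v

  link-w : link v w σ w ≡ v
  link-w with link-view v w σ w
  ... | at-v e _ = contradiction (sym e) v≢w
  ... | at-w _ _ e = e
  ... | other _ w≢w _ = contradiction refl w≢w

  link-other : ∀ {x} → x ≢ v → x ≢ w → link v w σ x ≡ σ x
  link-other {x} x≢v x≢w with link-view v w σ x
  ... | at-v e _ = contradiction e x≢v
  ... | at-w _ e _ = contradiction e x≢w
  ... | other _ _ e = e

  link-free⁺ : ∀ {x} → σ x ≡ x → x ≢ v → x ≢ w → link v w σ x ≡ x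
  link-free⁺ e x≢v x≢w = trans (link-other x≢v x≢w) e

  link-free⁻ : ∀ {x} → link v w σ x ≡ x → σ x ≡ x × x ≢ v × x ≢ w
  link-free⁻ {x} e with link-view v w σ x
  ... | at-v x≡v e′ = contradiction (trans (sym x≡v) (trans (sym e) e′)) v≢w
  ... | at-w x≢v x≡w e′ = contradiction (trans (sym e) e′) x≢v
  ... | other x≢v x≢w e′ = trans (sym e′) e , x≢v , x≢w

  -- Every point newly listed in `ds′` was unmatched in `σ`, so the old arcs keep their types and
  -- only the ends of the new arc need checking.
  link-typed : ∀ {ds ds′} → (∀ {x} → σ x ≢ x → Typed ds σ x) →
    (∀ {x} → x ∈ˡ ds → x ∈ˡ ds′) → (∀ {x} → σ x ≢ x → x ∈ˡ ds′ → x ∈ˡ ds) →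
    ((v ∈ˡ ds′ × w < v) ⊎ (v ∉ˡ ds′ × v < w)) → ((w ∈ˡ ds′ × v < w) ⊎ (w ∉ˡ ds′ × w < v)) →
    ∀ {x} → link v w σ x ≢ x → Typed ds′ (link v w σ) x
  link-typed typed ⊆ ⊇ at-v′ at-w′ {x} ne = cases (x Fin.≟ v) (x Fin.≟ w)
    where
    cases : Dec (x ≡ v) → Dec (x ≡ w) → Typed _ (link v w σ) x
    cases (yes refl) _ = Sum.map (λ (p , q) → p , subst (_< v) (sym link-v) q) (λ (p , q) → p , subst (v <_) (sym link-v) q) at-v′
    cases (no _) (yes refl) = Sum.map (λ (p , q) → p , subst (_< w) (sym link-w) q) (λ (p , q) → p , subst (w <_) (sym link-w) q) at-w′
    cases (no x≢v) (no x≢w) = Sum.map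
      (λ (p , q) → ⊆ p , subst (_< x) (sym e) q) (λ (p , q) → p ∘ ⊇ matched , subst (x <_) (sym e) q) (typed matched)
      where
      e = link-other x≢v x≢w
      matched : σ x ≢ x
      matched = ne ∘ trans e

-- Vertices and barred points.

module Circle {n : ℕ} where

  vertex-<⁺ : ∀ {i j : Fin n} → i < j → vertex i < vertex j
  vertex-<⁺ {i} {j} = subst₂ ℕ._<_ (sym (toℕ-vertex i)) (sym (toℕ-vertex j))

  vertex-<⁻ : ∀ {i j : Fin n} → vertex i < vertex j → i < j
  vertex-<⁻ {i} {j} = subst₂ ℕ._<_ (toℕ-vertex i) (toℕ-vertex j)

  vertex-injective : ∀ {i j : Fin n} → vertex i ≡ vertex j → i ≡ j
  vertex-injective {i} {j} = Fin.↑ˡ-injective n i j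

  barred-injective : ∀ {i j : Fin n} → barred i ≡ barred j → i ≡ j
  barred-injective {i} {j} e = Fin.toℕ-injective (ℕ.suc-injective (ℕ.+-cancelˡ-≡ (toℕ (barred i)) _ _
    (trans (toℕ-barred i) (trans (sym (toℕ-barred j)) (cong (λ x → toℕ x + suc (toℕ j)) (sym e))))))

  -- By `toℕ-barred`, a barred point and its index have a constant sum, so the order is reversed.
  barred-<⁺ : ∀ {i j : Fin n} → j < i → barred i < barred j
  barred-<⁺ {i} {j} j<i = ℕ.≰⇒> λ j≤i → ℕ.<-irrefl (trans (toℕ-barred j) (sym (toℕ-barred i)))
    (ℕ.+-mono-≤-< j≤i (s≤s j<i))

  barred-<⁻ : ∀ {i j : Fin n} → barred i < barred j → j < i
  barred-<⁻ {i} {j} lt = ℕ.≰⇒> λ i≤j → ℕ.<-irrefl (trans (toℕ-barred i) (sym (toℕ-barred j)))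
    (ℕ.+-mono-<-≤ lt (s≤s i≤j))

  vertex<barred : ∀ {i j : Fin n} → vertex i < barred j
  vertex<barred {i} {j} = subst (ℕ._< toℕ (barred j)) (sym (toℕ-vertex i)) (ℕ.<-≤-trans (Fin.toℕ<n i)
    (ℕ.+-cancelʳ-≤ (suc (toℕ j)) n _ (subst (n + suc (toℕ j) ℕ.≤_) (sym (toℕ-barred j)) (ℕ.+-monoʳ-≤ n (Fin.toℕ<n j)))))

  vertex≢barred : ∀ {i j : Fin n} → vertex i ≢ barred j
  vertex≢barred = Fin.<⇒≢ vertex<barred

  -- Serves to split the circle into its two halves and to read the second half of a Dyck word.
  barred-↑ʳ : ∀ (i : Fin n) → barred i ≡ n ↑ʳ opposite i
  barred-↑ʳ i = Fin.toℕ-injective (trans (Fin.opposite-prop (vertex i))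
    (trans (cong (λ t → n + n ∸ suc t) (toℕ-vertex i))
    (trans (ℕ.+-∸-assoc n (Fin.toℕ<n i))
    (trans (cong (n +_) (sym (Fin.opposite-prop i))) (sym (Fin.toℕ-↑ʳ n (opposite i)))))))

  data Point : Fin (n + n) → Set where
    vertexᵖ : ∀ (i : Fin n) → Point (vertex i)
    barredᵖ : ∀ (i : Fin n) → Point (barred i)

  point : ∀ x → Point x
  point x with splitAt n x | Fin.join-splitAt n n x
  ... | inj₁ i | refl = vertexᵖ i
  ... | inj₂ j | refl = subst Point (trans (barred-↑ʳ (opposite j)) (cong (n ↑ʳ_) (Fin.opposite-involutive j)))
                          (barredᵖ (opposite j))

open Circle public

-- The recurrence for the unmatched points in AST.

module _ {n : ℕ} where

  ≤∧≢⇒<ᶠ : ∀ {k i : Fin n} → toℕ k ℕ.< suc (toℕ i) → k ≢ i → k < i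
  ≤∧≢⇒<ᶠ (s≤s k≤i) = Fin.≤∧≢⇒< k≤i

  -- The points seen after t steps are the barred points of index below t and the vertices below m;
  -- a and b count the unmatched ones.
  record Partial (t m a b : ℕ) (ds : List (Fin (n + n))) (σ : PartialMatching (n + n)) : Set where
    field
      free-vertex   : ∀ {z : Fin n} → m ℕ.≤ toℕ z → σ (vertex z) ≡ vertex z
      free-barred   : ∀ {k : Fin n} → t ℕ.≤ toℕ k → σ (barred k) ≡ barred k
      free-bars     : Count (λ (k : Fin n) → toℕ k ℕ.< t × σ (barred k) ≡ barred k) a
      free-vertices : Count (λ (z : Fin n) → toℕ z ℕ.< m × σ (vertex z) ≡ vertex z) b
      vertex-opens  : ∀ {z : Fin n} → σ (vertex z) ≡ vertex z → vertex z ∉ˡ ds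
      barred-closes : ∀ {k : Fin n} → toℕ k ℕ.< t → σ (barred k) ≡ barred k → barred k ∈ˡ ds
      barred-<      : ∀ {k : Fin n} → barred k ∈ˡ ds → toℕ k ℕ.< t
      typed         : ∀ {x} → σ x ≢ x → Typed ds σ x

  partial-start : Partial 0 0 0 0 [] id
  partial-start = record
    { free-vertex = λ _ → refl ; free-barred = λ _ → refl
    ; free-bars = count-none λ _ () ; free-vertices = count-none λ _ ()
    ; vertex-opens = λ _ () ; barred-closes = λ () ; barred-< = λ ()
    ; typed = λ x≢x → contradiction refl x≢x }

  module _ {t m a b ds σ} (m<n : m ℕ.< n) (P : Partial t m a b ds σ) where
    open Partial P

    -- Vertex `m` is passed over without a partner and so becomes one more free vertex below the
    -- bound.
    partial-raise : Partial t (suc m) a (suc b) ds σ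
    partial-raise = record
      { free-vertex = free-vertex ∘ ℕ.<⇒≤ ; free-barred = free-barred ; free-bars = free-bars
      ; free-vertices = count-add {x = fromℕ< m<n}
          (λ (lt , _) → ℕ.<-irrefl (Fin.toℕ-fromℕ< m<n) lt)
          (subst (ℕ._< suc m) (sym (Fin.toℕ-fromℕ< m<n)) ℕ.≤-refl
            , free-vertex (ℕ.≤-reflexive (sym (Fin.toℕ-fromℕ< m<n))))
          (λ (lt , e) → ℕ.m<n⇒m<1+n lt , e)
          (λ (lt , e) → Sum.[ (λ z< → inj₂ (z< , e)) , (λ z≡ → inj₁ (Fin.toℕ-injective (trans z≡ (sym (Fin.toℕ-fromℕ< m<n))))) ]′
                          (ℕ.m≤n⇒m<n∨m≡n (ℕ.≤-pred lt)))
          free-vertices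
      ; vertex-opens = vertex-opens ; barred-closes = barred-closes ; barred-< = barred-< ; typed = typed }

  module _ {m a b ds σ} (i : Fin n) (P : Partial (toℕ i) m a b ds σ) where
    open Partial P

    private
      t = toℕ i

    i-free : σ (barred i) ≡ barred i
    i-free = free-barred ℕ.≤-refl

    i∉ : barred i ∉ˡ ds
    i∉ i∈ = ℕ.<-irrefl refl (barred-< i∈)

    closes-suc : ∀ {k : Fin n} → toℕ k ℕ.< suc t → σ (barred k) ≡ barred k → barred k ∈ˡ barred i ∷ ds
    closes-suc {k} k< e with k Fin.≟ i
    ... | yes refl = here refl
    ... | no k≢i = there (barred-closes (≤∧≢⇒<ᶠ k< k≢i) e)

    bars-suc : Count (λ (k : Fin n) → toℕ k ℕ.< suc t × σ (barred k) ≡ barred k) (suc a)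
    bars-suc = count-add {x = i} (λ (lt , _) → ℕ.<-irrefl refl lt) (ℕ.≤-refl , i-free)
      (λ (lt , e) → ℕ.m<n⇒m<1+n lt , e) split free-bars
      where
      split : ∀ {k : Fin n} → toℕ k ℕ.< suc t × σ (barred k) ≡ barred k → k ≡ i ⊎ (toℕ k ℕ.< t × σ (barred k) ≡ barred k)
      split {k} (k< , e) with k Fin.≟ i
      ... | yes k≡i = inj₁ k≡i
      ... | no k≢i = inj₂ (≤∧≢⇒<ᶠ k< k≢i , e)

  module _ {m a b ds σ} (i : Fin n) (P : Partial (toℕ i) m (suc a) b ds σ) where
    open Partial P

    private
      t = toℕ i

    -- Barred points of smaller index lie clockwise of `barred i`, so a free one is met before any
    -- vertex. It was listed as a closer already, and `barred i` opens; hence `ds` does not change.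
    partial-cancel : Partial (suc t) m a b ds (matchNearest clockwise (barred i) σ)
    partial-cancel with count-suc⁻ free-bars
    ... | k , k<t , k-free
      with nearest-clockwise {v = barred i} (λ e → Fin.<⇒≢ k<t (barred-injective e)) k-free
    -- A walk going round would have passed the free point `barred k`.
    ... | w , e , w-free , inj₂ (w<i , out) = contradiction k-free (out _ (inj₂ (barred-<⁺ k<t , ℕ.<-trans w<i (barred-<⁺ k<t))))
    ... | w , e , w-free , inj₁ i<w with point {n} w
    ... | vertexᵖ z = contradiction i<w (ℕ.<-asym vertex<barred)
    ... | barredᵖ l = subst (Partial (suc t) m a b ds) (sym e) (record
      { free-vertex = λ z≥ → link-free⁺ (free-vertex z≥) vertex≢barred vertex≢barred
      ; free-barred = λ {k} k> → link-free⁺ (free-barred (ℕ.<⇒≤ k>))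
          (λ e → Fin.<⇒≢ k> (sym (barred-injective e))) (λ e → Fin.<⇒≢ (ℕ.<-trans l<i k>) (sym (barred-injective e)))
      ; free-bars = count-remove {x = l} (l<i , w-free)
          (λ (k< , e) → let (e′ , k≢i , k≢l) = link-free⁻ e in (≤∧≢⇒<ᶠ k< (k≢i ∘ cong barred) , e′) , k≢l ∘ cong barred)
          (λ (k< , e) k≢l → ℕ.m<n⇒m<1+n k< , link-free⁺ e (Fin.<⇒≢ k< ∘ barred-injective) (k≢l ∘ barred-injective))
          free-bars
      ; free-vertices = count-resp
          (λ (z< , e) → z< , link-free⁺ e vertex≢barred vertex≢barred)
          (λ (z< , e) → z< , proj₁ (link-free⁻ e)) free-vertices
      ; vertex-opens = λ e → vertex-opens (proj₁ (link-free⁻ e))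
      ; barred-closes = λ k< e → let (e′ , k≢i , _) = link-free⁻ e in barred-closes (≤∧≢⇒<ᶠ k< (k≢i ∘ cong barred)) e′
      ; barred-< = ℕ.m<n⇒m<1+n ∘ barred-<
      ; typed = link-typed typed id (λ _ → id) (inj₂ (i∉ i P , i<w)) (inj₁ (barred-closes l<i w-free , i<w)) })
      where
      i≢l = Fin.<⇒≢ i<w
      open Link σ i≢l
      l<i = barred-<⁻ {n} {i} {l} i<w

  module _ {m b ds σ} (i : Fin n) (P : Partial (toℕ i) m 0 (suc b) ds σ) where
    open Partial P

    private
      t = toℕ i

    -- With no free barred point ahead, the walk goes round and takes a free vertex; `barred i`
    -- closes this arc.
    partial-wrap : Partial (suc t) m 0 b (barred i ∷ ds) (matchNearest clockwise (barred i) σ)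
    partial-wrap with count-suc⁻ free-vertices
    ... | u , u<m , u-free
      with nearest-clockwise {v = barred i} vertex≢barred u-free
    ... | w , e , w-free , side with point {n} w
    ... | barredᵖ l = contradiction side impossible
      where
      impossible : ¬ (barred i < barred l ⊎ (barred l < barred i × ∀ z → Outside (barred i) (barred l) z → σ z ≢ z))
      impossible (inj₁ i<l) = count-zero⁻ free-bars (barred-<⁻ i<l , w-free)
      impossible (inj₂ (_ , out)) = out _ (inj₁ (vertex<barred , vertex<barred)) u-free
    ... | vertexᵖ z = subst (Partial (suc t) m 0 b (barred i ∷ ds)) (sym e) (record
      { free-vertex = λ {y} y≥ → link-free⁺ (free-vertex y≥) vertex≢barred
          (λ e → Fin.<⇒≢ (ℕ.<-≤-trans z<m y≥) (sym (vertex-injective e)))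
      ; free-barred = λ {k} k> → link-free⁺ (free-barred (ℕ.<⇒≤ k>))
          (λ e → Fin.<⇒≢ k> (sym (barred-injective e))) (vertex≢barred ∘ sym)
      ; free-bars = count-none λ k (k< , e) → let (e′ , k≢i , _) = link-free⁻ e in
          count-zero⁻ free-bars (≤∧≢⇒<ᶠ k< (k≢i ∘ cong barred) , e′)
      ; free-vertices = count-remove {x = z} (z<m , w-free)
          (λ (y< , e) → let (e′ , _ , y≢z) = link-free⁻ e in (y< , e′) , y≢z ∘ cong vertex)
          (λ (y< , e) y≢z → y< , link-free⁺ e vertex≢barred (y≢z ∘ vertex-injective))
          free-vertices
      ; vertex-opens = λ { e (here e′) → vertex≢barred e′ ; e (there y∈) → vertex-opens (proj₁ (link-free⁻ e)) y∈ }
      ; barred-closes = λ k< e → closes-suc i P k< (proj₁ (link-free⁻ e))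
      ; barred-< = λ { (here e) → ℕ.≤-reflexive (cong (suc ∘ toℕ) (barred-injective e)) ; (there k∈) → ℕ.m<n⇒m<1+n (barred-< k∈) }
      ; typed = link-typed typed there
          (λ { ne (here refl) → contradiction (i-free i P) ne ; _ (there x∈) → x∈ })
          (inj₁ (here refl , vertex<barred))
          (inj₂ ((λ { (here e) → vertex≢barred e ; (there z∈) → vertex-opens w-free z∈ }) , vertex<barred)) })
      where
      i≢z : barred i ≢ vertex z
      i≢z = vertex≢barred ∘ sym
      open Link σ i≢z
      -- The walk reaches the vertices from the first one upwards and cannot have passed the free
      -- `vertex u`. Hence `z` is among the vertices counted below `m`.
      z≤u : toℕ (vertex z) ℕ.≤ toℕ (vertex u)
      z≤u = ℕ.≮⇒≥ λ u<z → Sum.[ ℕ.<-asym vertex<barred , (λ (_ , out) → out _ (inj₁ (vertex<barred , u<z)) u-free) ]′ side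
      z<m : toℕ z ℕ.< m
      z<m = ℕ.≤-<-trans (subst₂ ℕ._≤_ (toℕ-vertex z) (toℕ-vertex u) z≤u) u<m

  module _ {a b ds σ} (i v : Fin n) (P : Partial (toℕ i) (toℕ v) a (suc b) ds σ) where
    open Partial P

    private
      t = toℕ i

    -- Vertex `v` closes an arc from a smaller vertex. The point `barred i` is now seen but still
    -- free; it is listed as a closer in advance, which accounts for `suc a`.
    partial-near : Partial (suc t) (suc (toℕ v)) (suc a) b (vertex v ∷ barred i ∷ ds)
                     (matchNearest counterclockwise (vertex v) σ)
    partial-near with count-suc⁻ free-vertices
    ... | u , u<v , u-free
      with nearest-counterclockwise {v = vertex v} (λ e → Fin.<⇒≢ u<v (vertex-injective e)) u-free
    ... | w , e , w-free , inj₂ (v<w , out) = contradiction u-free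
            (out _ (inj₁ (vertex-<⁺ u<v , ℕ.<-trans (vertex-<⁺ u<v) v<w)))
    ... | w , e , w-free , inj₁ w<v with point {n} w
    ... | barredᵖ l = contradiction w<v (ℕ.<-asym vertex<barred)
    ... | vertexᵖ z = subst (Partial (suc t) (suc (toℕ v)) (suc a) b ds′) (sym e) (record
      { free-vertex = λ {y} y> → link-free⁺ (free-vertex (ℕ.<⇒≤ y>))
          (λ e → Fin.<⇒≢ y> (sym (vertex-injective e)))
          (λ e → Fin.<⇒≢ (ℕ.<-trans z<v y>) (sym (vertex-injective e)))
      ; free-barred = λ k> → link-free⁺ (free-barred (ℕ.<⇒≤ k>)) (vertex≢barred ∘ sym) (vertex≢barred ∘ sym)
      ; free-bars = count-resp
          (λ (k< , e) → k< , link-free⁺ e (vertex≢barred ∘ sym) (vertex≢barred ∘ sym))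
          (λ (k< , e) → k< , proj₁ (link-free⁻ e)) (bars-suc i P)
      ; free-vertices = count-remove {x = z} (z<v , w-free)
          (λ (y< , e) → let (e′ , y≢v , y≢z) = link-free⁻ e in (≤∧≢⇒<ᶠ y< (y≢v ∘ cong vertex) , e′) , y≢z ∘ cong vertex)
          (λ (y< , e) y≢z → ℕ.m<n⇒m<1+n y< , link-free⁺ e (Fin.<⇒≢ y< ∘ vertex-injective) (y≢z ∘ vertex-injective))
          free-vertices
      ; vertex-opens = λ e → let (e′ , y≢v , _) = link-free⁻ e in
          λ { (here y≡v) → y≢v y≡v ; (there y∈) → vertex∉ e′ y∈ }
      ; barred-closes = λ k< e → there (closes-suc i P k< (proj₁ (link-free⁻ e)))
      ; barred-< = λ { (here e) → contradiction (sym e) vertex≢barred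
                     ; (there (here e)) → ℕ.≤-reflexive (cong (suc ∘ toℕ) (barred-injective e))
                     ; (there (there k∈)) → ℕ.m<n⇒m<1+n (barred-< k∈) }
      ; typed = link-typed typed (there ∘ there)
          (λ { ne (here refl) → contradiction (free-vertex ℕ.≤-refl) ne
             ; ne (there (here refl)) → contradiction (i-free i P) ne
             ; _ (there (there x∈)) → x∈ })
          (inj₁ (here refl , w<v))
          (inj₂ ((λ { (here e) → v≢z (sym e) ; (there z∈) → vertex∉ w-free z∈ }) , w<v)) })
      where
      ds′ = vertex v ∷ barred i ∷ ds
      v≢z = Fin.<⇒≢ w<v ∘ sym
      open Link σ v≢z
      z<v = vertex-<⁻ {n} {z} {v} w<v
      vertex∉ : ∀ {y : Fin n} → σ (vertex y) ≡ vertex y → vertex y ∉ˡ barred i ∷ ds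
      vertex∉ e (here e′) = vertex≢barred e′
      vertex∉ e (there y∈) = vertex-opens e y∈

  module _ {a ds σ} (i v : Fin n) (P : Partial (toℕ i) (toℕ v) a 0 ds σ) where
    open Partial P

    private
      t = toℕ i

    -- With no smaller free vertex the walk goes round to the barred points, where `barred i` itself
    -- is free. One barred point joins the count and one, possibly the same, leaves it.
    partial-far : Partial (suc t) (suc (toℕ v)) a 0 (barred i ∷ ds) (matchNearest counterclockwise (vertex v) σ)
    partial-far
      with nearest-counterclockwise {v = vertex v} (vertex≢barred ∘ sym) (i-free i P)
    ... | w , e , w-free , side with point {n} w
    ... | vertexᵖ z = contradiction side impossible
      where
      impossible : ¬ (vertex z < vertex v ⊎ (vertex v < vertex z × ∀ y → Outside (vertex v) (vertex z) y → σ y ≢ y))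
      impossible (inj₁ z<v) = count-zero⁻ free-vertices (vertex-<⁻ z<v , w-free)
      impossible (inj₂ (_ , out)) = out _ (inj₂ (vertex<barred , vertex<barred)) (i-free i P)
    ... | barredᵖ l = subst (Partial (suc t) (suc (toℕ v)) a 0 (barred i ∷ ds)) (sym e) (record
      { free-vertex = λ {y} y> → link-free⁺ (free-vertex (ℕ.<⇒≤ y>))
          (λ e → Fin.<⇒≢ y> (sym (vertex-injective e))) vertex≢barred
      ; free-barred = λ k> → link-free⁺ (free-barred (ℕ.<⇒≤ k>)) (vertex≢barred ∘ sym)
          (λ e → Fin.<⇒≢ (ℕ.<-≤-trans l≤ k>) (sym (barred-injective e)))
      ; free-bars = count-remove {x = l} (l≤ , w-free)
          (λ (k< , e) → let (e′ , _ , k≢l) = link-free⁻ e in (k< , e′) , k≢l ∘ cong barred)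
          (λ (k< , e) k≢l → k< , link-free⁺ e (vertex≢barred ∘ sym) (k≢l ∘ barred-injective))
          (bars-suc i P)
      ; free-vertices = count-none λ y (y< , e) → let (e′ , y≢v , _) = link-free⁻ e in
          count-zero⁻ free-vertices (≤∧≢⇒<ᶠ y< (y≢v ∘ cong vertex) , e′)
      ; vertex-opens = λ e → vertex∉ (proj₁ (link-free⁻ e))
      ; barred-closes = λ k< e → closes-suc i P k< (proj₁ (link-free⁻ e))
      ; barred-< = λ { (here e) → ℕ.≤-reflexive (cong (suc ∘ toℕ) (barred-injective e)) ; (there k∈) → ℕ.m<n⇒m<1+n (barred-< k∈) }
      ; typed = link-typed typed there
          (λ { ne (here refl) → contradiction (i-free i P) ne ; _ (there x∈) → x∈ })
          (inj₂ (vertex∉ (free-vertex ℕ.≤-refl) , vertex<barred))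
          (inj₁ (closes-suc i P l≤ w-free , vertex<barred)) })
      where
      v≢l : vertex v ≢ barred l
      v≢l = vertex≢barred
      open Link σ v≢l
      -- The walk comes down from the last point of the circle and cannot have passed the free
      -- `barred i`.
      i≤l : toℕ (barred i) ℕ.≤ toℕ (barred l)
      i≤l = ℕ.≮⇒≥ λ l<i → Sum.[ ℕ.<-asym vertex<barred , (λ (_ , out) → out _ (inj₂ (vertex<barred , l<i)) (i-free i P)) ]′ side
      l≤ : toℕ l ℕ.< suc t
      l≤ = s≤s (ℕ.≮⇒≥ λ i<l → ℕ.<⇒≱ (barred-<⁺ i<l) i≤l)
      vertex∉ : ∀ {y : Fin n} → σ (vertex y) ≡ vertex y → vertex y ∉ˡ barred i ∷ ds
      vertex∉ e (here e′) = vertex≢barred e′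
      vertex∉ e (there y∈) = vertex-opens e y∈

-- The queue of holes in the row insertion.

-- The values below m still to come arrive in increasing order: the first coordinates of ps will bump the
-- second ones out of the first row r₁, and those of rest will bump none of the current entries of r₁.
module RowQueue {n} (π : 𝒮₃₂₁ n) where
  open Insertion π

  holes : List (Fin n × Fin n) → List (Fin n) → List (Fin n)
  holes ps rest = map proj₁ ps ++ rest

  doomed : List (Fin n × Fin n) → List (Fin n)
  doomed = map proj₂

  -- Entry `z` escapes the hole `h`: if `z` exceeds `h`, then `g` is a smaller candidate and is
  -- bumped instead.
  Passes : Fin n → Fin n × Fin n → Set
  Passes z (h , g) = h < z → g < z

  record Queue (t m : ℕ) (r₁ : List (Fin n)) (ps : List (Fin n × Fin n)) (rest : List (Fin n)) : Set where
    field
      increasing    : All (λ (h , g) → h < g) ps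
      holes-sorted  : AllPairs _<_ (holes ps rest)
      doomed-sorted : AllPairs _<_ (doomed ps)
      hole⁻         : ∀ {z} → z ∈ˡ holes ps rest → ¬ Seen t z × toℕ z ℕ.< m
      hole⁺         : ∀ {z} → ¬ Seen t z → toℕ z ℕ.< m → z ∈ˡ holes ps rest
      doomed-∈      : ∀ {z} → z ∈ˡ doomed ps → z ∈ˡ r₁
      safe          : ∀ {z} → z ∈ˡ r₁ → z ∈ˡ doomed ps ⊎ (All (Passes z) ps × All (z <_) rest)
      seen-<        : ∀ {z} → Seen t z → toℕ z ℕ.< m

  open Queue

  queue-start : Queue 0 0 [] [] []
  queue-start = record
    { increasing = [] ; holes-sorted = [] ; doomed-sorted = [] ; hole⁻ = λ () ; hole⁺ = λ _ ()
    ; doomed-∈ = λ () ; safe = λ () ; seen-< = λ () }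

  -- The value `m` exceeds all values seen, hence all entries of `r₁`. As a new hole it would bump
  -- none of them, so it joins the end of `rest`.
  queue-raise : ∀ {t m r₁ ps rest} (m<n : m ℕ.< n) → (∀ {z} → z ∈ˡ r₁ → Seen t z) →
    Queue t m r₁ ps rest → Queue t (suc m) r₁ ps (rest ++ [ fromℕ< m<n ])
  queue-raise {t} {m} {r₁} {ps} {rest} m<n seen₁ Q = record
    { increasing    = increasing Q
    ; holes-sorted  = subst (AllPairs _<_) assoc
        (sorted-snoc (holes-sorted Q) (λ z∈ → subst (_ ℕ.<_) (sym w≡m) (proj₂ (hole⁻ Q z∈))))
    ; doomed-sorted = doomed-sorted Q
    ; hole⁻         = λ z∈ → hole-new⁻ (∈-snoc⁻ (holes ps rest) (subst (_ ∈ˡ_) (sym assoc) z∈))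
    ; hole⁺         = λ unseen z< → subst (_ ∈ˡ_) assoc
        (Sum.[ (λ z<m → ∈-++⁺ˡ (hole⁺ Q unseen z<m))
             , (λ z≡m → ∈-++⁺ʳ (holes ps rest) (here (Fin.toℕ-injective (trans z≡m (sym w≡m))))) ]′
          (ℕ.m≤n⇒m<n∨m≡n (ℕ.≤-pred z<)))
    ; doomed-∈      = doomed-∈ Q
    ; safe          = λ z∈ → Sum.map₂ (λ (p , q) → p , All.++⁺ q (subst (_ ℕ.<_) (sym w≡m) (seen-< Q (seen₁ z∈)) ∷ [])) (safe Q z∈)
    ; seen-<        = ℕ.m<n⇒m<1+n ∘ seen-< Q
    }
    where
    w = fromℕ< m<n
    w≡m : toℕ w ≡ m
    w≡m = Fin.toℕ-fromℕ< m<n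
    assoc : holes ps rest ++ [ w ] ≡ holes ps (rest ++ [ w ])
    assoc = List.++-assoc (map proj₁ ps) rest [ w ]
    hole-new⁻ : ∀ {z} → z ∈ˡ holes ps rest ⊎ z ≡ w → ¬ Seen t z × toℕ z ℕ.< suc m
    hole-new⁻ (inj₁ z∈) = let (p , q) = hole⁻ Q z∈ in p , ℕ.m<n⇒m<1+n q
    hole-new⁻ (inj₂ refl) = (λ s → ℕ.<-irrefl w≡m (seen-< Q s)) , s≤s (ℕ.≤-reflexive w≡m)

  module _ (i : Fin n) where

    private
      t = toℕ i
      x = π · i

    seen-suc⁻ : ∀ {z} → Seen (suc t) z → Seen t z ⊎ z ≡ x
    seen-suc⁻ (a , a≤t , e) with ℕ.m≤n⇒m<n∨m≡n (ℕ.≤-pred a≤t)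
    ... | inj₁ a<t = inj₁ (a , a<t , e)
    ... | inj₂ a≡t = inj₂ (trans (sym e) (cong (π ·_) (Fin.toℕ-injective a≡t)))

    x-seen : Seen (suc t) x
    x-seen = i , ℕ.≤-refl , refl

    x-unseen : ¬ Seen t x
    x-unseen (a , a<t , e) = Fin.<⇒≢ a<t (·-injective π e)

    unseen-suc : ∀ {z} → ¬ Seen t z → z ≢ x → ¬ Seen (suc t) z
    unseen-suc unseen z≢x s = Sum.[ unseen , z≢x ]′ (seen-suc⁻ s)

    exc-largest : i < x → ∀ {z} → Seen t z → z < x
    exc-largest i<x (a , a<t , refl) = exc-increasing π a<t i<x

    -- An unseen value other than `x` stands at a later position, and all values after a
    -- nonexcedance are larger.
    nonexc-least : ¬ i < x → ∀ {z} → ¬ Seen t z → z ≢ x → x < z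
    nonexc-least i≮x {z} unseen z≢x = subst (x <_) πq≡z (nonexc-increasing π i<q i≮x)
      where
      q = perm π ⟨$⟩ˡ z
      πq≡z : π · q ≡ z
      πq≡z = Perm.inverseʳ (perm π)
      i<q : i < q
      i<q = Fin.≤∧≢⇒< (ℕ.≮⇒≥ λ q<i → unseen (q , q<i , πq≡z)) λ i≡q → z≢x (trans (sym πq≡z) (cong (π ·_) (sym i≡q)))

    -- A nonexcedance value is the least unseen one and the holes are sorted, so the holes are
    -- filled from the front of the list.
    first-hole : ∀ {m r₁ ps rest h hs} → ¬ i < x → toℕ x ℕ.< m → Queue t m r₁ ps rest →
      holes ps rest ≡ h ∷ hs → h ≡ x
    first-hole {h = h} {hs} i≮x x<m Q eq =
      first (subst (x ∈ˡ_) eq (hole⁺ Q x-unseen x<m)) (subst (AllPairs _<_) eq (holes-sorted Q))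
      where
      first : x ∈ˡ h ∷ hs → AllPairs _<_ (h ∷ hs) → h ≡ x
      first (here e) _ = sym e
      first (there x∈) (h< ∷ _) = contradiction (All.lookup h< x∈)
        (ℕ.<-asym (nonexc-least i≮x (proj₁ (hole⁻ Q (subst (h ∈ˡ_) (sym eq) (here refl)))) (Fin.<⇒≢ (All.lookup h< x∈))))

    module _ {m r₁ ps rest g} (Q : Queue t m r₁ ((x , g) ∷ ps) rest) where

      -- The bumped entry is the least one above `x`, so it is at most `g`. Any other doomed entry
      -- exceeds `g` by sortedness, and a safe entry above `x` exceeds `g` by `Passes`.
      bumped-≡ : ∀ {y} → y ∈ˡ r₁ → x < y → (∀ {z} → z ∈ˡ r₁ → y ≤ᶠ z ⊎ z ≤ᶠ x) → y ≡ g
      bumped-≡ {y} y∈ x<y gap with gap (doomed-∈ Q (here refl))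
      ... | inj₂ g≤x = contradiction (All.head (increasing Q)) (ℕ.≤⇒≯ g≤x)
      ... | inj₁ y≤g with safe Q y∈
      ... | inj₁ (here e) = e
      ... | inj₁ (there y∈′) = contradiction y≤g (ℕ.<⇒≱ (All.lookup (AllPairs.head (doomed-sorted Q)) y∈′))
      ... | inj₂ (p , _) = contradiction y≤g (ℕ.<⇒≱ (All.head p x<y))

      not-appended : ¬ (∀ {z} → z ∈ˡ r₁ → z ≤ᶠ x)
      not-appended ≤x = ℕ.<⇒≱ (All.head (increasing Q)) (≤x (doomed-∈ Q (here refl)))

      queue-bump : ∀ {r₁′} → (∀ {z} → z ∈ˡ r₁′ → z ≡ x ⊎ (z ∈ˡ r₁ × z ≢ g)) →
        (∀ {z} → z ∈ˡ r₁ → z ≢ g → z ∈ˡ r₁′) → Queue (suc t) m r₁′ ps rest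
      queue-bump {r₁′} from keep = record
        { increasing    = All.tail (increasing Q)
        ; holes-sorted  = AllPairs.tail (holes-sorted Q)
        ; doomed-sorted = AllPairs.tail (doomed-sorted Q)
        ; hole⁻         = λ z∈ → let (p , q) = hole⁻ Q (there z∈) in
            unseen-suc p (Fin.<⇒≢ (All.lookup x< z∈) ∘ sym) , q
        ; hole⁺         = λ unseen z<m → tail-∈ (λ { refl → unseen x-seen }) (hole⁺ Q (unseen ∘ seen-suc) z<m)
        ; doomed-∈      = λ z∈ → keep (doomed-∈ Q (there z∈)) (λ { refl → ℕ.<-irrefl refl (All.lookup (AllPairs.head (doomed-sorted Q)) z∈) })
        ; safe          = λ z∈ → safe-new (from z∈)
        ; seen-<        = λ s → Sum.[ seen-< Q , (λ { refl → proj₂ (hole⁻ Q (here refl)) }) ]′ (seen-suc⁻ s)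
        }
        where
        x< = AllPairs.head (holes-sorted Q)
        safe-new : ∀ {z} → z ≡ x ⊎ (z ∈ˡ r₁ × z ≢ g) → z ∈ˡ doomed ps ⊎ (All (Passes z) ps × All (z <_) rest)
        -- The new entry `x` lies below every remaining hole, so none of them can bump it.
        safe-new (inj₁ refl) = inj₂
          (All.tabulate (λ p∈ h<x → contradiction h<x (ℕ.<-asym (All.lookup x< (∈-++⁺ˡ (∈-map⁺ proj₁ p∈)))))
          , All.++⁻ʳ (map proj₁ ps) x<)
        safe-new (inj₂ (z∈ , z≢g)) = Sum.map (tail-∈ z≢g) (λ (p , q) → All.tail p , q) (safe Q z∈)

    module _ {m r₁ rest} (Q : Queue t m r₁ [] (x ∷ rest)) where

      -- With no pairs left no entry is doomed, and safe entries lie below every hole in `x ∷ rest`.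
      not-bumped : ∀ {y} → y ∈ˡ r₁ → ¬ x < y
      not-bumped y∈ x<y with safe Q y∈
      ... | inj₂ (_ , y<) = ℕ.<-asym x<y (All.head y<)

      queue-append : Queue (suc t) m (r₁ ++ [ x ]) [] rest
      queue-append = record
        { increasing    = []
        ; holes-sorted  = AllPairs.tail (holes-sorted Q)
        ; doomed-sorted = []
        ; hole⁻         = λ z∈ → let (p , q) = hole⁻ Q (there z∈) in
            unseen-suc p (Fin.<⇒≢ (All.lookup x< z∈) ∘ sym) , q
        ; hole⁺         = λ unseen z<m → tail-∈ (λ { refl → unseen x-seen }) (hole⁺ Q (unseen ∘ seen-suc) z<m)
        ; doomed-∈      = λ ()
        ; safe          = λ z∈ → safe-new (∈-snoc⁻ r₁ z∈)
        ; seen-<        = λ s → Sum.[ seen-< Q , (λ { refl → proj₂ (hole⁻ Q (here refl)) }) ]′ (seen-suc⁻ s)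
        }
        where
        x< = AllPairs.head (holes-sorted Q)
        safe-new : ∀ {z} → z ∈ˡ r₁ ⊎ z ≡ x → z ∈ˡ [] ⊎ (All (Passes z) [] × All (z <_) rest)
        safe-new (inj₁ z∈) = Sum.map₂ (λ (p , q) → p , All.tail q) (safe Q z∈)
        safe-new (inj₂ refl) = inj₂ ([] , x<)

    module _ {r₁} (seen₁ : ∀ {z} → z ∈ˡ r₁ → Seen t z) {ps rest} (Q : Queue t (toℕ x) r₁ ps rest) where

      private
        doomed-< : ∀ {z} → z ∈ˡ doomed ps → z < x
        doomed-< z∈ = seen-< Q (seen₁ (doomed-∈ Q z∈))

        hole-suc⁻ : ∀ {z} → z ∈ˡ holes ps rest → ¬ Seen (suc t) z × toℕ z ℕ.< suc (toℕ x)
        hole-suc⁻ z∈ = let (p , q) = hole⁻ Q z∈ in unseen-suc p (Fin.<⇒≢ q) , ℕ.m<n⇒m<1+n q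

        hole-suc⁺ : ∀ {z} → ¬ Seen (suc t) z → toℕ z ℕ.< suc (toℕ x) → z ∈ˡ holes ps rest
        hole-suc⁺ unseen z≤x = hole⁺ Q (unseen ∘ seen-suc) (≤∧≢⇒<ᶠ z≤x λ { refl → unseen x-seen })

        seen-suc-< : ∀ {z} → Seen (suc t) z → toℕ z ℕ.< suc (toℕ x)
        seen-suc-< s = Sum.[ ℕ.m<n⇒m<1+n ∘ seen-< Q , (λ { refl → ℕ.≤-refl }) ]′ (seen-suc⁻ s)

      -- Every hole has a doomed entry, and all of these are smaller than the new largest entry `x`;
      -- so no present hole will bump `x`.
      queue-safe : rest ≡ [] → Queue (suc t) (suc (toℕ x)) (r₁ ++ [ x ]) ps rest
      queue-safe refl = record
        { increasing    = increasing Q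
        ; holes-sorted  = holes-sorted Q
        ; doomed-sorted = doomed-sorted Q
        ; hole⁻         = hole-suc⁻
        ; hole⁺         = hole-suc⁺
        ; doomed-∈      = ∈-++⁺ˡ ∘ doomed-∈ Q
        ; safe          = λ z∈ → safe-new (∈-snoc⁻ r₁ z∈)
        ; seen-<        = seen-suc-<
        }
        where
        safe-new : ∀ {z} → z ∈ˡ r₁ ⊎ z ≡ x → z ∈ˡ doomed ps ⊎ (All (Passes z) ps × All (z <_) rest)
        safe-new (inj₁ z∈) = safe Q z∈
        safe-new (inj₂ refl) = inj₂ (All.tabulate (λ p∈ _ → doomed-< (∈-map⁺ proj₂ p∈)) , [])

      -- The safe entries lie below `h`, the first hole without a target, so the new largest entry
      -- `x` becomes its target.
      queue-doomed : ∀ {h rest′} → rest ≡ h ∷ rest′ → Queue (suc t) (suc (toℕ x)) (r₁ ++ [ x ]) (ps ++ [ h , x ]) rest′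
      queue-doomed {h} {rest′} refl = record
        { increasing    = All.++⁺ (increasing Q) (proj₂ (hole⁻ Q (∈-++⁺ʳ (map proj₁ ps) (here refl))) ∷ [])
        ; holes-sorted  = subst (AllPairs _<_) holes≡ (holes-sorted Q)
        ; doomed-sorted = subst (AllPairs _<_) doomed≡ (sorted-snoc (doomed-sorted Q) doomed-<)
        ; hole⁻         = hole-suc⁻ ∘ subst (_ ∈ˡ_) (sym holes≡)
        ; hole⁺         = λ unseen z≤x → subst (_ ∈ˡ_) holes≡ (hole-suc⁺ unseen z≤x)
        ; doomed-∈      = λ z∈ → Sum.[ ∈-++⁺ˡ ∘ doomed-∈ Q , (λ { refl → ∈-++⁺ʳ r₁ (here refl) }) ]′
                            (∈-snoc⁻ (doomed ps) (subst (_ ∈ˡ_) (sym doomed≡) z∈))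
        ; safe          = λ z∈ → safe-new (∈-snoc⁻ r₁ z∈)
        ; seen-<        = seen-suc-<
        }
        where
        holes≡ : holes ps (h ∷ rest′) ≡ holes (ps ++ [ h , x ]) rest′
        holes≡ = sym (trans (cong (_++ rest′) (List.map-++ proj₁ ps [ h , x ])) (List.++-assoc (map proj₁ ps) [ h ] rest′))
        doomed≡ : doomed ps ++ [ x ] ≡ doomed (ps ++ [ h , x ])
        doomed≡ = sym (List.map-++ proj₂ ps [ h , x ])
        safe-new : ∀ {z} → z ∈ˡ r₁ ⊎ z ≡ x → z ∈ˡ doomed (ps ++ [ h , x ]) ⊎ (All (Passes z) (ps ++ [ h , x ]) × All (z <_) rest′)
        safe-new (inj₂ refl) = inj₁ (subst (x ∈ˡ_) doomed≡ (∈-++⁺ʳ (doomed ps) (here refl)))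
        safe-new (inj₁ z∈) = Sum.map (subst (_ ∈ˡ_) doomed≡ ∘ ∈-++⁺ˡ)
          -- An old safe entry is smaller than `h`, so it passes the new pair vacuously.
          (λ (p , q) → All.++⁺ p ((λ h<z → contradiction h<z (ℕ.<-asym (All.head q))) ∷ []) , All.tail q) (safe Q z∈)

-- AST and row insertion in parallel.

foldl-pair : {A B X : Set} (f : A → X → A) (g : B → X → B) (a : A) (b : B) (xs : List X) →
  foldl (λ (a , b) x → f a x , g b x) (a , b) xs ≡ (foldl f a xs , foldl g b xs)
foldl-pair f g a b [] = refl
foldl-pair f g a b (x ∷ xs) = foldl-pair f g (f a x) (g b x) xs

module Simulation {n} (A : 𝒜 (𝐀 (n ∸ 1))) (π : 𝒮₃₂₁ n)
  (arc⇒≡ : ∀ {i j : Fin n} → Arc A i j → j ≡ π · i)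
  (¬arc⇒nonexc : ∀ {i : Fin n} → ¬ (∃ λ j → Arc A i j) → ¬ i < π · i) where

  open Insertion π
  open RowQueue π

  -- The counts `a` and `b` of `Partial` are tied to the lengths of `ps` and `pending`. A vertex
  -- closes when its value is in the second row or doomed, a barred point when its index is in the
  -- top row of `Q`. The field `least` keeps `m` from overshooting a coming excedance value.
  record Joint (t : ℕ) (s : PartialMatching (n + n) × Tableaux n) : Set where
    field
      state   : State t (proj₂ s)
      m       : ℕ
      m≤n     : m ℕ.≤ n
      ps      : List (Fin n × Fin n)
      pending : List (Fin n)
      ds      : List (Fin (n + n))
    open State state public using (r₁; s₁; r₂; s₂)
    field
      queue   : Queue t m r₁ ps pending
      least   : ∀ (v : Fin n) → (∀ {z} → Seen t z → z < v) → t ℕ.≤ toℕ v → m ℕ.≤ toℕ v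
      partial : Partial {n} t m (length ps) (length pending) ds (proj₁ s)
      vertex-closes⁻ : ∀ {z : Fin n} → vertex z ∈ˡ ds → z ∈ˡ r₂ ⊎ z ∈ˡ doomed ps
      vertex-closes⁺ : ∀ {z : Fin n} → z ∈ˡ r₂ ⊎ z ∈ˡ doomed ps → vertex z ∈ˡ ds
      barred-closes⁻ : ∀ {k : Fin n} → barred k ∈ˡ ds → k ∈ˡ s₁
      barred-closes⁺ : ∀ {k : Fin n} → k ∈ˡ s₁ → barred k ∈ˡ ds

  joint-start : Joint 0 (id , [])
  joint-start = record
    { state = start ; m = 0 ; m≤n = z≤n ; ps = [] ; pending = [] ; ds = []
    ; queue = queue-start ; least = λ _ _ _ → z≤n ; partial = partial-start {n}
    ; vertex-closes⁻ = λ () ; vertex-closes⁺ = λ { (inj₁ ()) ; (inj₂ ()) }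
    ; barred-closes⁻ = λ () ; barred-closes⁺ = λ () }

  -- Each value passed over is at once a new hole without target and a new free vertex, so the two
  -- sides grow together.
  raise : ∀ {t m m′ r₁ ps pending ds σ} → (∀ {z} → z ∈ˡ r₁ → Seen t z) → m ℕ.≤′ m′ → m′ ℕ.≤ n →
    Queue t m r₁ ps pending → Partial {n} t m (length ps) (length pending) ds σ →
    ∃ λ pending′ → Queue t m′ r₁ ps pending′ × Partial {n} t m′ (length ps) (length pending′) ds σ
  raise seen (ℕ.≤′-reflexive refl) _ Q P = _ , Q , P
  raise {ps = ps} {ds = ds} {σ} seen (ℕ.≤′-step m≤) m<n Q P with raise seen m≤ (ℕ.<⇒≤ m<n) Q P
  ... | pending′ , Q′ , P′ = _ , queue-raise m<n seen Q′ ,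
        subst (λ b → Partial {n} _ _ (length ps) b ds σ) (sym (length-snoc pending′)) (partial-raise m<n P′)

  module _ (i : Fin n) {σ rows} (J : Joint (toℕ i) (σ , rows)) where
    open Joint J
    open State state using (sorted; seen₁)

    private
      t = toℕ i
      x = π · i

    view : InsertView x r₁ (insertRow x r₁)
    view = insert-view x r₁ sorted (x-unseen i ∘ seen₁)

    least-suc : ∀ (v : Fin n) → (∀ {z} → Seen (suc t) z → z < v) → suc t ℕ.≤ toℕ v → m ℕ.≤ toℕ v
    least-suc v above t<v = least v (above ∘ seen-suc) (ℕ.<⇒≤ t<v)

    barred-snoc⁻ : ∀ {k : Fin n} → barred k ∈ˡ barred i ∷ ds → k ∈ˡ s₁ ++ [ i ]
    barred-snoc⁻ (here e) = ∈-++⁺ʳ s₁ (here (barred-injective e))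
    barred-snoc⁻ (there k∈) = ∈-++⁺ˡ (barred-closes⁻ k∈)

    barred-snoc⁺ : ∀ {k : Fin n} → k ∈ˡ s₁ ++ [ i ] → barred k ∈ˡ barred i ∷ ds
    barred-snoc⁺ k∈ with ∈-snoc⁻ s₁ k∈
    ... | inj₁ k∈s₁ = there (barred-closes⁺ k∈s₁)
    ... | inj₂ refl = here refl

    module Nonexcedance (i≮x : ¬ i < x) where

      -- The bound must exceed `x`, so that `x` itself is a hole and `first-hole` applies.
      m′ = m ℕ.⊔ suc (toℕ x)

      x<m′ : toℕ x ℕ.< m′
      x<m′ = ℕ.m≤n⊔m m (suc (toℕ x))

      m′≤n : m′ ℕ.≤ n
      m′≤n = ℕ.⊔-lub m≤n (Fin.toℕ<n x)

      least-new : ∀ (v : Fin n) → (∀ {z} → Seen (suc t) z → z < v) → suc t ℕ.≤ toℕ v → m′ ℕ.≤ toℕ v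
      least-new v above t<v = ℕ.⊔-lub (least-suc v above t<v) (above (x-seen i))

      -- The hole `x` has a target `g`, and equally there is a free barred point. The value `g` only
      -- moves from the doomed entries to the second row, so the closers stay the same.
      bumps : ∀ {h g ps′ pending′ res} → h ≡ x → (h , g) ∷ ps′ ≡ ps → Queue t m′ r₁ ((h , g) ∷ ps′) pending′ →
        Partial {n} t m′ (suc (length ps′)) (length pending′) ds σ → InsertView x r₁ res → insertRow x r₁ ≡ res →
        Joint (suc t) (matchNearest clockwise (barred i) σ , insert i x rows)
      bumps refl refl Q P (append ≤x) e = contradiction (λ {z} → ≤x {z}) (not-appended i Q)
      bumps {g = g} {ps′} refl refl Q P (bump y∈ x<y gap s from x∈ keep len) e
        with refl ← bumped-≡ i Q y∈ x<y gap = record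
        { state = Bumped.bumped i state y∈ x<y gap s from x∈ keep len e
        ; m≤n = m′≤n
        ; queue = queue-bump i Q from keep
        ; least = least-new
        ; partial = partial-cancel i P
        ; vertex-closes⁻ = λ z∈ → moved⁻ (vertex-closes⁻ z∈)
        ; vertex-closes⁺ = λ z∈ → vertex-closes⁺ (moved⁺ z∈)
        ; barred-closes⁻ = barred-closes⁻
        ; barred-closes⁺ = barred-closes⁺
        }
        where
        moved⁻ : ∀ {z} → z ∈ˡ r₂ ⊎ z ∈ˡ g ∷ doomed ps′ → z ∈ˡ r₂ ++ [ g ] ⊎ z ∈ˡ doomed ps′
        moved⁻ (inj₁ z∈) = inj₁ (∈-++⁺ˡ z∈)
        moved⁻ (inj₂ (here e)) = inj₁ (∈-++⁺ʳ r₂ (here e))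
        moved⁻ (inj₂ (there z∈)) = inj₂ z∈
        moved⁺ : ∀ {z} → z ∈ˡ r₂ ++ [ g ] ⊎ z ∈ˡ doomed ps′ → z ∈ˡ r₂ ⊎ z ∈ˡ g ∷ doomed ps′
        moved⁺ (inj₁ z∈) = Sum.map₂ here (∈-snoc⁻ r₂ z∈)
        moved⁺ (inj₂ z∈) = inj₂ (there z∈)

      -- Without pairs there is no free barred point: insertion records `i` in the top row of `Q`
      -- while AST makes `barred i` a closer.
      appends : ∀ {h pending′ res} → h ≡ x → [] ≡ ps → Queue t m′ r₁ [] (h ∷ pending′) →
        Partial {n} t m′ 0 (suc (length pending′)) ds σ → InsertView x r₁ res → insertRow x r₁ ≡ res →
        Joint (suc t) (matchNearest clockwise (barred i) σ , insert i x rows)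
      appends refl refl Q P (bump y∈ x<y _ _ _ _ _ _) e = contradiction x<y (not-bumped i Q y∈)
      appends refl refl Q P (append ≤x) e = record
        { state = appended i state ≤x e
        ; m≤n = m′≤n
        ; queue = queue-append i Q
        ; least = least-new
        ; partial = partial-wrap i P
        ; vertex-closes⁻ = vertex-closes⁻ ∘ tail-∈ vertex≢barred
        ; vertex-closes⁺ = there ∘ vertex-closes⁺
        ; barred-closes⁻ = barred-snoc⁻
        ; barred-closes⁺ = barred-snoc⁺
        }

      nonexcedance : Joint (suc t) (matchNearest clockwise (barred i) σ , insert i x rows)
      nonexcedance with raise seen₁ (ℕ.≤⇒≤′ (ℕ.m≤m⊔n m (suc (toℕ x)))) m′≤n queue partial
      ... | pending′ , Q , P = split ps refl pending′ Q P
        where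
        split : ∀ ps′ → ps′ ≡ ps → ∀ pending′ → Queue t m′ r₁ ps′ pending′ →
          Partial {n} t m′ (length ps′) (length pending′) ds σ →
          Joint (suc t) (matchNearest clockwise (barred i) σ , insert i x rows)
        split ((h , g) ∷ ps′) eq pending′ Q P = bumps (first-hole i i≮x x<m′ Q refl) eq Q P view refl
        split [] eq (h ∷ pending′) Q P = appends (first-hole i i≮x x<m′ Q refl) eq Q P view refl
        split [] eq [] Q P with () ← Queue.hole⁺ Q (x-unseen i) x<m′

    module Excedance (i<x : i < x) where

      -- The value `x` exceeds all seen ones and is appended. If `pending` is empty, it is safe and
      -- its vertex opens; otherwise the first pending hole dooms it and its vertex closes.
      appends : ∀ {pending′ res} → Queue t (toℕ x) r₁ ps pending′ →
        Partial {n} t (toℕ x) (length ps) (length pending′) ds σ → InsertView x r₁ res → insertRow x r₁ ≡ res →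
        Joint (suc t) (matchNearest counterclockwise (vertex x) σ , insert i x rows)
      appends Q P (bump y∈ x<y _ _ _ _ _ _) e = contradiction x<y (ℕ.<-asym (exc-largest i i<x (seen₁ y∈)))
      appends {[]} Q P (append ≤x) e = record
        { state = appended i state ≤x e
        ; m≤n = Fin.toℕ<n x
        ; queue = queue-safe i seen₁ Q refl
        ; least = λ v above _ → above (x-seen i)
        ; partial = partial-far i x P
        ; vertex-closes⁻ = vertex-closes⁻ ∘ tail-∈ vertex≢barred
        ; vertex-closes⁺ = there ∘ vertex-closes⁺
        ; barred-closes⁻ = barred-snoc⁻
        ; barred-closes⁺ = barred-snoc⁺
        }
      appends {h ∷ pending′} Q P (append ≤x) e = record
        { state = appended i state ≤x e
        ; m≤n = Fin.toℕ<n x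
        ; queue = queue-doomed i seen₁ Q refl
        ; least = λ v above _ → above (x-seen i)
        ; partial = subst (λ a → Partial {n} _ _ a _ _ _) (sym (length-snoc ps)) (partial-near i x P)
        ; vertex-closes⁻ = closes⁻
        ; vertex-closes⁺ = closes⁺
        ; barred-closes⁻ = λ { (here e) → contradiction (sym e) vertex≢barred ; (there k∈) → barred-snoc⁻ k∈ }
        ; barred-closes⁺ = there ∘ barred-snoc⁺
        }
        where
        doomed≡ : doomed (ps ++ [ h , x ]) ≡ doomed ps ++ [ x ]
        doomed≡ = List.map-++ proj₂ ps [ h , x ]
        closes⁻ : ∀ {z : Fin n} → vertex z ∈ˡ vertex x ∷ barred i ∷ ds → z ∈ˡ r₂ ⊎ z ∈ˡ doomed (ps ++ [ h , x ])
        closes⁻ (here e) = inj₂ (subst (_ ∈ˡ_) (sym doomed≡) (∈-++⁺ʳ (doomed ps) (here (vertex-injective e))))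
        closes⁻ (there z∈) = Sum.map₂ (subst (_ ∈ˡ_) (sym doomed≡) ∘ ∈-++⁺ˡ) (vertex-closes⁻ (tail-∈ vertex≢barred z∈))
        closes⁺ : ∀ {z : Fin n} → z ∈ˡ r₂ ⊎ z ∈ˡ doomed (ps ++ [ h , x ]) → vertex z ∈ˡ vertex x ∷ barred i ∷ ds
        closes⁺ (inj₁ z∈) = there (there (vertex-closes⁺ (inj₁ z∈)))
        closes⁺ (inj₂ z∈) with ∈-snoc⁻ (doomed ps) (subst (_ ∈ˡ_) doomed≡ z∈)
        ... | inj₁ z∈′ = there (there (vertex-closes⁺ (inj₂ z∈′)))
        ... | inj₂ refl = here refl

      excedance : Joint (suc t) (matchNearest counterclockwise (vertex x) σ , insert i x rows)
      excedance with raise seen₁ (ℕ.≤⇒≤′ (least x (exc-largest i i<x) (ℕ.<⇒≤ i<x))) (ℕ.<⇒≤ (Fin.toℕ<n x)) queue partial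
      -- The bound has been raised exactly to `x`: the skipped values are holes, while `x` is not.
      ... | pending′ , Q , P = appends Q P view refl

  AST-step-arc : ∀ {σ i j} → Arc A i j → AST-step n A σ i ≡ matchNearest counterclockwise (vertex j) σ
  AST-step-arc {σ} {i} a with Fin.any? (arc? A i)
  ... | yes (_ , b) = cong (λ j → matchNearest counterclockwise (vertex j) σ) (arc-functional A b a)
  ... | no ¬a = contradiction (_ , a) ¬a

  AST-step-¬arc : ∀ {σ i} → ¬ (∃ λ j → Arc A i j) → AST-step n A σ i ≡ matchNearest clockwise (barred i) σ
  AST-step-¬arc {i = i} ¬a with Fin.any? (arc? A i)
  ... | yes a = contradiction a ¬a
  ... | no _ = refl

  joint-suc : ∀ i s → Joint (toℕ i) s → Joint (suc (toℕ i)) (AST-step n A (proj₁ s) i , insert i (π · i) (proj₂ s))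
  joint-suc i (σ , rows) J = step (Fin.any? (arc? A i))
    where
    step : Dec (∃ λ j → Arc A i j) → Joint (suc (toℕ i)) (AST-step n A σ i , insert i (π · i) rows)
    step (yes (j , a)) with refl ← arc⇒≡ a =
      subst (λ τ → Joint _ (τ , _)) (sym (AST-step-arc a)) (Excedance.excedance i J (arc-< A a))
    step (no ¬a) =
      subst (λ τ → Joint _ (τ , _)) (sym (AST-step-¬arc ¬a)) (Nonexcedance.nonexcedance i J (¬arc⇒nonexc ¬a))

  joint : Joint n (AST-result n A , insertAll (perm π))
  -- Both runs fold over the same list, so a single invariant on pairs governs them.
  joint = subst (Joint n) (foldl-pair (AST-step n A) _ id [] (allFin n))
    (foldl-invariant Joint _ joint-start joint-suc)

  -- Closing points and letters of the Dyck word.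

  open Joint joint
  open State state using (shape; descent; present)

  tops : topRow (proj₁ (RSK (perm π))) ≡ r₁ × topRow (proj₂ (RSK (perm π))) ≡ s₁
  tops = go shape
    where
    go : ∀ {r₁ s₁ r₂ s₂ : List (Fin n)} {rows} → TwoRows r₁ s₁ r₂ s₂ rows →
         topRow (map proj₁ rows) ≡ r₁ × topRow (map proj₂ rows) ≡ s₁
    go none = refl , refl
    go one = refl , refl
    go two = refl , refl

  all-seen : ∀ z → Seen n z
  all-seen z = perm π ⟨$⟩ˡ z , Fin.toℕ<n _ , Perm.inverseʳ (perm π)

  -- At the end all values are seen, so no hole and hence no doomed entry remains. The two rows are
  -- disjoint: `descent` at a common entry gives a value both below it and at least it.
  vertex-closes : ∀ {z : Fin n} → vertex z ∈ˡ ds → z ∉ˡ r₁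
  vertex-closes z∈ z∈r₁ = go ps queue (vertex-closes⁻ z∈)
    where
    go : ∀ ps → Queue n m r₁ ps pending → _ ∈ˡ r₂ ⊎ _ ∈ˡ doomed ps → ⊥
    go (_ ∷ _) Q _ = proj₁ (Queue.hole⁻ Q (here refl)) (all-seen _)
    go [] Q (inj₁ z∈r₂) with descent z∈r₂ z∈r₁ ℕ.≤-refl
    ... | _ , _ , _ , _ , _ , lt , le = ℕ.<⇒≱ lt le

  ∉r₁⇒closes : ∀ {z : Fin n} → z ∉ˡ r₁ → vertex z ∈ˡ ds
  ∉r₁⇒closes {z} z∉ with present (perm π ⟨$⟩ˡ z) (Fin.toℕ<n _)
  ... | inj₁ p = contradiction (subst (_∈ˡ r₁) (Perm.inverseʳ (perm π)) p) z∉
  ... | inj₂ p = vertex-closes⁺ (inj₁ (subst (_∈ˡ r₂) (Perm.inverseʳ (perm π)) p))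

  private
    D = RSK^ π

  at-vertex : ∀ (z : Fin n) → Vec.lookup (word D) (vertex z) ≡ stepP (perm π) z
  at-vertex z = trans (Vec.lookup-++ˡ (Vec.tabulate (stepP (perm π))) _ z) (Vec.lookup∘tabulate _ z)

  at-barred : ∀ (k : Fin n) → Vec.lookup (word D) (barred k) ≡ stepQ (perm π) k
  at-barred k = trans (cong (Vec.lookup (word D)) (barred-↑ʳ k))
    (trans (Vec.lookup-++ʳ (Vec.tabulate (stepP (perm π))) _ (opposite k))
    (trans (Vec.lookup∘tabulate _ (opposite k)) (cong (stepQ (perm π)) (Fin.opposite-involutive k))))

  if-dec : ∀ {B : Set} {a b : Step} (b? : Dec B) → (B × (if does b? then a else b) ≡ a)
                        ⊎ (¬ B × (if does b? then a else b) ≡ b)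
  if-dec (yes p) = inj₁ (p , refl)
  if-dec (no ¬p) = inj₂ (¬p , refl)

  step-closes : ∀ x → (x ∈ˡ ds × Vec.lookup (word D) x ≡ 𝚍) ⊎ (x ∉ˡ ds × Vec.lookup (word D) x ≡ 𝚞)
  step-closes x with point {n} x
  -- Membership in the top row means `𝚞` for `P` but `𝚍` for `Q`, so only this case swaps the
  -- alternatives.
  ... | vertexᵖ z = Sum.swap (Sum.map
          (λ (z∈ , e) → (λ z∈ds → vertex-closes z∈ds (subst (z ∈ˡ_) (proj₁ tops) z∈)) , trans (at-vertex z) e)
          (λ (z∉ , e) → ∉r₁⇒closes (z∉ ∘ subst (z ∈ˡ_) (sym (proj₁ tops))) , trans (at-vertex z) e)
          (if-dec (z ∈?ˡ topRow (proj₁ (RSK (perm π))))))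
  ... | barredᵖ k = Sum.map
          (λ (k∈ , e) → barred-closes⁺ (subst (k ∈ˡ_) (proj₂ tops) k∈) , trans (at-barred k) e)
          (λ (k∉ , e) → k∉ ∘ subst (k ∈ˡ_) (sym (proj₂ tops)) ∘ barred-closes⁻ , trans (at-barred k) e)
          (if-dec (k ∈?ˡ topRow (proj₂ (RSK (perm π)))))

  AST-typed : ∀ x → Typed ds (partner (AST n A)) x
  AST-typed x = Partial.typed {n} partial (no-fixed (AST n A) x)

  Match-typed : ∀ x → Typed ds (partner (Match D)) x
  Match-typed x = Sum.map
    (λ (x∈ , e) → x∈ , closes e (Equivalence.to (Match-tunnel D x _) refl))
    (λ (x∉ , e) → x∉ , opens e (Equivalence.to (Match-tunnel D x _) refl)) (step-closes x)
    where
    closes : ∀ {y} → Vec.lookup (word D) x ≡ 𝚍 → Matched D x y → y < x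
    closes e (inj₁ T) with () ← trans (sym e) (Tunnel.opening T)
    closes e (inj₂ T) = Tunnel.ordered T
    opens : ∀ {y} → Vec.lookup (word D) x ≡ 𝚞 → Matched D x y → x < y
    opens e (inj₁ T) = Tunnel.ordered T
    opens e (inj₂ T) with () ← trans (sym e) (Tunnel.closing T)

  AST≈Match : AST n A ≈ᴺ Match D
  AST≈Match = typed⇒≈ (AST n A) (Match D) ds AST-typed Match-typed

-- Excedances of the inverse image.

module _ {n} (A : 𝒜 (𝐀 (n ∸ 1))) where
  open FromAntichain {n} A

  Exc⁻¹-arc : ∀ {i j} → Arc A i j → j ≡ Exc⁻¹ n A · i
  Exc⁻¹-arc {i} a = functional (arc a) (to-graph i)

  -- A position without an arc receives its value from the increasing filling, which by
  -- `rest-nonexc` never exceeds the position.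
  Exc⁻¹-nonexc : ∀ {i} → ¬ (∃ λ j → Arc A i j) → ¬ i < Exc⁻¹ n A · i
  Exc⁻¹-nonexc {i} ¬a = nonexc (to-graph i)
    where
    nonexc : ∀ {j} → Graph i j → ¬ i < j
    nonexc (arc a) _ = ¬a (_ , a)
    nonexc g@(rest p _ _ _) = ℕ.≤⇒≯ (rest-nonexc p g)

theorem5p2 : (n : ℕ) → 1 ≤ n → (A : 𝒜 (𝐀 (n ∸ 1))) →
    AST n A ≈ᴺ Match (RSK^ (Exc⁻¹ n A))
theorem5p2 n _ A = Simulation.AST≈Match {n} A (Exc⁻¹ n A) (Exc⁻¹-arc {n} A) (Exc⁻¹-nonexc {n} A)
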